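{- For every integer $n\geq 1$, the neighborhood complex $\mathcal{N}(SG_{n,2})$ of the stable Kneser graph $SG_{n,2}$ simplicially collapses onto a subcomplex that is (isomorphic to) the boundary complex of a three-dimensional simplicial polytope.
   Context: For a graph $G=(V,E)$, the neighborhood complex $\mathcal{N}(G)$ is the simplicial complex on vertex set $V$ whose faces are the subsets $F\subseteq V$ having a common neighbor, i.e. there is $v\in V$ with $\{u,v\}\in E$ for all $u\in F$. An $n$-subset $\alpha$ of $[2n+2]=\{1,\dots,2n+2\}$ is stable if it contains no pair $\{i,i+1\}$ for $1\le i\le 2n+1$ and does not contain $\{1,2n+2\}$. The stable Kneser graph $SG_{n,2}$ has as vertices the stable $n$-subsets of $[2n+2]$, two being adjacent iff they are disjoint. A simplicial collapse onto a subcomplex is a finite sequence of elementary collapses (removals of a free face together with the unique face properly containing it); in particular the subcomplex is a deformation retract. -}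

module Defs where

open import Data.Nat using (ℕ; zero; suc) renaming (_+_ to _+ℕ_; _*_ to _*ℕ_)
open import Data.Fin using (Fin; zero; suc; inject₁; fromℕ)
open import Data.Fin.Subset using (Subset; _∈_; _∉_; _⊂_; _∩_; ∣_∣; Empty)
open import Data.Fin.Subset.Properties using (_∈?_)
open import Data.Fin.Properties using (all?)
open import Data.Bool using (true; false)
open import Data.Vec using (_∷_; [])
open import Data.List using (List; _∷_; []; _++_; map; filter; length; lookup)
open import Data.Product using (Σ; ∃; _×_; _,_)
open import Data.Rational using (ℚ; 0ℚ; _+_; _*_; _<_)
open import Function.Bundles using (_⇔_)
open import Relation.Nullary using (¬_; Dec)
open import Relation.Nullary.Decidable using (_×-dec_; ¬?)
open import Relation.Binary.PropositionalEquality using (_≡_; _≢_)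
import Data.Nat.Properties as ℕP
open import Level using (Level) renaming (suc to lsuc; zero to lzero)

Complex : ℕ → Set₁
Complex N = Subset N → Set

NbhdComplex : {N : ℕ} → (Fin N → Fin N → Set) → Complex N
NbhdComplex {N} Adj F = ∃ λ (v : Fin N) → ∀ (u : Fin N) → u ∈ F → Adj u v

record ElemCollapse {N : ℕ} (K L : Complex N) : Set where
  field
    σ τ   : Subset N
    σ⊂τ   : σ ⊂ τ
    σ∈K   : K σ
    τ∈K   : K τ
    free  : ∀ (ρ : Subset N) → K ρ → σ ⊂ ρ → ρ ≡ τ
    rest  : ∀ (ρ : Subset N) → L ρ ⇔ (K ρ × ρ ≢ σ × ρ ≢ τ)

data Collapses {N : ℕ} (K L : Complex N) : Set₁ where
  done : (∀ (ρ : Subset N) → K ρ ⇔ L ρ) → Collapses K L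
  step : (K′ : Complex N) → ElemCollapse K K′ → Collapses K′ L → Collapses K L

-- Stable Kneser graph SG_{n,2}.  Ground set [2n+2] is Fin (2n+2), with
-- element i ∈ [2n+2] represented by the Fin index i-1.

Ground : ℕ → ℕ
Ground n = suc (suc (2 *ℕ n))

Stable : (n : ℕ) → Subset (Ground n) → Set
Stable n s =
  (∣ s ∣ ≡ n) ×
  ((∀ (i : Fin (suc (2 *ℕ n))) → ¬ (inject₁ i ∈ s × suc i ∈ s)) ×
   ¬ (zero ∈ s × fromℕ (suc (2 *ℕ n)) ∈ s))

stable? : (n : ℕ) → (s : Subset (Ground n)) → Dec (Stable n s)
stable? n s =
  (∣ s ∣ ℕP.≟ n) ×-dec
  (all? (λ i → ¬? ((inject₁ i ∈? s) ×-dec (suc i ∈? s))) ×-dec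
   ¬? ((zero ∈? s) ×-dec (fromℕ (suc (2 *ℕ n)) ∈? s)))

allSubsets : (k : ℕ) → List (Subset k)
allSubsets zero = [] ∷ []
allSubsets (suc k) = map (false ∷_) (allSubsets k) ++ map (true ∷_) (allSubsets k)

SGVertices : (n : ℕ) → List (Subset (Ground n))
SGVertices n = filter (stable? n) (allSubsets (Ground n))

SGsize : ℕ → ℕ
SGsize n = length (SGVertices n)

SGvertex : (n : ℕ) → Fin (SGsize n) → Subset (Ground n)
SGvertex n i = lookup (SGVertices n) i

SGAdj : (n : ℕ) → Fin (SGsize n) → Fin (SGsize n) → Set
SGAdj n i j = Empty (SGvertex n i ∩ SGvertex n j)

NSG : (n : ℕ) → Complex (SGsize n)
NSG n = NbhdComplex (SGAdj n)

ℚ³ : Set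
ℚ³ = ℚ × ℚ × ℚ

_·_ : ℚ³ → ℚ³ → ℚ
(a₁ , a₂ , a₃) · (x₁ , x₂ , x₃) = (a₁ * x₁ + a₂ * x₂) + a₃ * x₃

0³ : ℚ³
0³ = 0ℚ , 0ℚ , 0ℚ

_⊕_ : ℚ³ → ℚ³ → ℚ³
(a₁ , a₂ , a₃) ⊕ (x₁ , x₂ , x₃) = a₁ + x₁ , a₂ + x₂ , a₃ + x₃

_⊙_ : ℚ → ℚ³ → ℚ³
c ⊙ (x₁ , x₂ , x₃) = c * x₁ , c * x₂ , c * x₃

sumℚ : {m : ℕ} → (Fin m → ℚ) → ℚ
sumℚ {zero} f = 0ℚ
sumℚ {suc m} f = f zero + sumℚ (λ j → f (suc j))

sumℚ³ : {m : ℕ} → (Fin m → ℚ³) → ℚ³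
sumℚ³ {zero} f = 0³
sumℚ³ {suc m} f = f zero ⊕ sumℚ³ (λ j → f (suc j))

-- T ⊆ Fin m is (the vertex set of) a proper face of conv{p 0,…,p (m-1)},
-- cut out by the supporting hyperplane a·x = b  (a ≠ 0); includes ∅.
PolyFace : {m : ℕ} → (Fin m → ℚ³) → Subset m → Set
PolyFace {m} p T = Σ ℚ³ λ a → Σ ℚ λ b →
  (a ≢ 0³) × (∀ (j : Fin m) → (j ∈ T → a · p j ≡ b) × (j ∉ T → a · p j < b))

AffinelyIndependent : {m : ℕ} → (Fin m → ℚ³) → Subset m → Set
AffinelyIndependent {m} p T = ∀ (c : Fin m → ℚ) →
  (∀ j → j ∉ T → c j ≡ 0ℚ) → sumℚ c ≡ 0ℚ → sumℚ³ (λ j → c j ⊙ p j) ≡ 0³ →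
  ∀ j → c j ≡ 0ℚ

IsSimplicial3PolytopeVertices : {m : ℕ} → (Fin m → ℚ³) → Set
IsSimplicial3PolytopeVertices {m} p =
  (∀ (j : Fin m) → PolyFace p (λ₁ j)) ×
  (∀ (a : ℚ³) (b : ℚ) → a ≢ 0³ → ¬ (∀ (j : Fin m) → a · p j ≡ b)) ×
  (∀ (T : Subset m) → PolyFace p T → AffinelyIndependent p T)
  where open import Data.Fin.Subset using () renaming (⁅_⁆ to λ₁)

IsoToBoundaryOf3Polytope : {N : ℕ} → Complex N → Set
IsoToBoundaryOf3Polytope {N} L =
  Σ ℕ λ m → Σ (Fin m → ℚ³) λ p → Σ (Fin m → Fin N) λ f →
    IsSimplicial3PolytopeVertices p ×
    (∀ j k → f j ≡ f k → j ≡ k) ×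
    (∀ (S : Subset N) → L S → ∀ i → i ∈ S → ∃ λ j → f j ≡ i) ×
    (∀ (S : Subset N) (T : Subset m) →
       (∀ i → i ∈ S → ∃ λ j → j ∈ T × f j ≡ i) →
       (∀ j → j ∈ T → f j ∈ S) →
       (L S ⇔ PolyFace p T))

{-# OPTIONS --safe #-}
{-
Cut the cycle [2n+2] into the blocks {2k, 2k+1}. A stable n-set has exactly one empty block, and read cyclically from
there it is r times {2k} and then n - r times {2k+1}. So the vertices of SG form a grid, (n+1) columns wrapped around
an annulus times the rows r = 0, …, n. In these coordinates the maximal faces of the neighborhood complex are
tetrahedra, one for each rhombus formed by a vertex, its two upper neighbours and the vertex above these, and
simplices consisting of all of the first (or last) row and one vertex of the adjacent row.

A tetrahedron has a diagonal that lies in no other maximal face, so it collapses onto the two triangles at the other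
diagonal; we remove the vertical diagonal, but the horizontal one in the rhombi at the seam of the annulus. The large
simplices collapse in the same way, first onto the triangles joining the two rows, and then the first and the last row
onto fans. If the vertices are numbered row by row, what remains is a helix: a is joined to a + 1, a + n + 1 and
a + n + 2, and the first and the last vertex close it at both ends.

Such a helix arises from a tetrahedron by repeatedly subdividing an edge. On a simplicial polytope this is realized
by a new vertex slightly outside the midpoint of the edge. To see that no other faces appear, we carry along the
inequalities of the facets and the fact that they generate the cone of all affine functions that are nonnegative on
the polytope.
-}
module Submission where

open import Defs
open import Data.Nat using (ℕ; _≥_)
open import Data.Product using (Σ; ∃; ∃₂; _×_; _,_; proj₁; proj₂; map₁; swap)
open import Data.Sum using (_⊎_; inj₁; inj₂)
open import Data.Empty using (⊥; ⊥-elim)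
open import Function using (_∘_)
open import Relation.Nullary using (¬_; Dec; yes; no; does)
open import Relation.Binary.PropositionalEquality

-- Why the seam is treated differently: write `N` for n + 1 and give (s , r) the number rN + s. In a
-- rhombus away from the seam the horizontal diagonal joins consecutive numbers. At the seam it
-- joins numbers that differ by n, whereas the vertical one joins a and a + N + 1. Removing the
-- horizontal one there gives the triangulation the same form around every number a, so a single
-- kind of subdivision step builds it.
--
-- The statement defines faces by arbitrary supporting planes, so a list of the facets does not
-- settle which vertex sets are faces. The generation of the cone does: a supporting function is a
-- nonnegative combination of facet functions, and where it vanishes, every facet function with a
-- positive coefficient vanishes too. Its zero set therefore lies in a facet.
--
-- The claims about codes, facets and triangles are linear in the coordinates once the product of a
-- row with `N` is taken as a variable of its own, so a verified refutation procedure can check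
-- them.

-- Linear arithmetic over the natural numbers by reflection.

module Lia where

  open import Data.Nat
  open import Data.Nat.Properties
  open import Data.Bool using (Bool; true; false; T; _∧_; _∨_; not; if_then_else_)
  open import Data.Bool.Properties using (T-∧; T-∨)
  open import Data.Vec using (Vec; []; _∷_; lookup; zipWith; map)
  open import Data.Fin using (Fin; zero; suc)
  open import Data.List as List using (List; []; _∷_; _++_; concatMap; filterᵇ)
  open import Data.Bool.ListAction using (any)
  open import Data.List.Relation.Unary.All as All using (All; []; _∷_)
  open import Data.List.Relation.Unary.All.Properties using (++⁺; map⁺)
  open import Data.Maybe using (Maybe; just; nothing)
  open import Data.Unit using (tt)
  open import Function.Bundles using (Equivalence)
  open import Relation.Nullary.Decidable using (_×-dec_; _⊎-dec_; _→-dec_)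

  -- Gauss and Fourier–Motzkin elimination refute the negation of a formula over ℕ; this is complete over ℚ only.

  infixr 12 _:·_
  infixl 11 _:+_
  infix 10 _:≤_ _:<_ _:≡_
  infixr 10 :¬_
  infixr 9 _:∧_
  infixr 8 _:∨_
  infixr 7 _:⇒_

  data Exp (k : ℕ) : Set where
    var : Fin k → Exp k
    con : ℕ → Exp k
    _:+_ : Exp k → Exp k → Exp k
    _:·_ : ℕ → Exp k → Exp k

  data Form (k : ℕ) : Set where
    _:≤_ _:<_ _:≡_ : Exp k → Exp k → Form k
    :⊥ : Form k
    _:∧_ _:∨_ _:⇒_ : Form k → Form k → Form k

  :¬_ : ∀ {k} → Form k → Form k
  :¬ φ = φ :⇒ :⊥

  ⟦_⟧ₑ : ∀ {k} → Exp k → Vec ℕ k → ℕ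
  ⟦ var i ⟧ₑ ρ = lookup ρ i
  ⟦ con c ⟧ₑ ρ = c
  ⟦ a :+ b ⟧ₑ ρ = ⟦ a ⟧ₑ ρ + ⟦ b ⟧ₑ ρ
  ⟦ c :· a ⟧ₑ ρ = c * ⟦ a ⟧ₑ ρ

  ⟦_⟧ : ∀ {k} → Form k → Vec ℕ k → Set
  ⟦ a :≤ b ⟧ ρ = ⟦ a ⟧ₑ ρ ≤ ⟦ b ⟧ₑ ρ
  ⟦ a :< b ⟧ ρ = ⟦ a ⟧ₑ ρ < ⟦ b ⟧ₑ ρ
  ⟦ a :≡ b ⟧ ρ = ⟦ a ⟧ₑ ρ ≡ ⟦ b ⟧ₑ ρ
  ⟦ :⊥ ⟧ ρ = ⊥
  ⟦ φ :∧ ψ ⟧ ρ = ⟦ φ ⟧ ρ × ⟦ ψ ⟧ ρ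
  ⟦ φ :∨ ψ ⟧ ρ = ⟦ φ ⟧ ρ ⊎ ⟦ ψ ⟧ ρ
  ⟦ φ :⇒ ψ ⟧ ρ = ⟦ φ ⟧ ρ → ⟦ ψ ⟧ ρ

  decide : ∀ {k} (φ : Form k) ρ → Dec (⟦ φ ⟧ ρ)
  decide (a :≤ b) ρ = ⟦ a ⟧ₑ ρ ≤? ⟦ b ⟧ₑ ρ
  decide (a :< b) ρ = ⟦ a ⟧ₑ ρ <? ⟦ b ⟧ₑ ρ
  decide (a :≡ b) ρ = ⟦ a ⟧ₑ ρ ≟ ⟦ b ⟧ₑ ρ
  decide :⊥ ρ = no λ ()
  decide (φ :∧ ψ) ρ = decide φ ρ ×-dec decide ψ ρ
  decide (φ :∨ ψ) ρ = decide φ ρ ⊎-dec decide ψ ρ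
  decide (φ :⇒ ψ) ρ = decide φ ρ →-dec decide ψ ρ

  -- The last entry of a row is the constant term.
  Row : ℕ → Set
  Row k = Vec ℕ (suc k)

  dot : ∀ {k} → Row k → Vec ℕ k → ℕ
  dot {zero} (c ∷ []) [] = c
  dot {suc k} (a ∷ as) (x ∷ ρ) = a * x + dot as ρ

  _⊞_ : ∀ {m} → Vec ℕ m → Vec ℕ m → Vec ℕ m
  _⊞_ = zipWith _+_

  _⊟_ : ∀ {m} → Vec ℕ m → Vec ℕ m → Vec ℕ m
  _⊟_ = zipWith _∸_

  constRow : ∀ {k} → ℕ → Row k
  constRow {zero} c = c ∷ []
  constRow {suc k} c = 0 ∷ constRow c

  unitRow : ∀ {k} → Fin k → Row k
  unitRow zero = 1 ∷ constRow 0
  unitRow (suc i) = 0 ∷ unitRow i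

  private
    swap-middle : ∀ a b c d → (a + b) + (c + d) ≡ (a + c) + (b + d)
    swap-middle a b c d = trans (+-assoc a b (c + d)) (trans (cong (a +_)
      (trans (sym (+-assoc b c d)) (trans (cong (_+ d) (+-comm b c)) (+-assoc c b d))))
      (sym (+-assoc a c (b + d))))

  dot-⊞ : ∀ {k} (as bs : Row k) ρ → dot (as ⊞ bs) ρ ≡ dot as ρ + dot bs ρ
  dot-⊞ {zero} (a ∷ []) (b ∷ []) [] = refl
  dot-⊞ {suc k} (a ∷ as) (b ∷ bs) (x ∷ ρ) =
    trans (cong₂ _+_ (*-distribʳ-+ x a b) (dot-⊞ as bs ρ)) (swap-middle (a * x) (b * x) _ _)

  dot-scale : ∀ {k} c (as : Row k) ρ → dot (map (c *_) as) ρ ≡ c * dot as ρ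
  dot-scale {zero} c (a ∷ []) [] = refl
  dot-scale {suc k} c (a ∷ as) (x ∷ ρ) =
    trans (cong₂ _+_ (*-assoc c a x) (dot-scale c as ρ)) (sym (*-distribˡ-+ c (a * x) _))

  dot-const : ∀ {k} c (ρ : Vec ℕ k) → dot (constRow c) ρ ≡ c
  dot-const c [] = refl
  dot-const c (x ∷ ρ) = dot-const c ρ

  dot-unit : ∀ {k} (i : Fin k) ρ → dot (unitRow i) ρ ≡ lookup ρ i
  dot-unit zero (x ∷ ρ) = trans (cong₂ _+_ (*-identityˡ x) (dot-const 0 ρ)) (+-identityʳ x)
  dot-unit (suc i) (x ∷ ρ) = dot-unit i ρ

  row : ∀ {k} → Exp k → Row k
  row (var i) = unitRow i
  row (con c) = constRow c
  row (a :+ b) = row a ⊞ row b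
  row (c :· a) = map (c *_) (row a)

  dot-row : ∀ {k} (e : Exp k) ρ → dot (row e) ρ ≡ ⟦ e ⟧ₑ ρ
  dot-row (var i) ρ = dot-unit i ρ
  dot-row (con c) ρ = dot-const c ρ
  dot-row (a :+ b) ρ = trans (dot-⊞ (row a) (row b) ρ) (cong₂ _+_ (dot-row a ρ) (dot-row b ρ))
  dot-row (c :· a) ρ = trans (dot-scale c (row a) ρ) (cong (c *_) (dot-row a ρ))

  -- (l , r) stands for l ≤ r.
  Ineq : ℕ → Set
  Ineq k = Row k × Row k

  Holds : ∀ {k} → Vec ℕ k → Ineq k → Set
  Holds ρ (l , r) = dot l ρ ≤ dot r ρ

  -- Coefficients are natural numbers. Truncated subtraction in both directions leaves every
  -- variable, and the constant, on at most one side, so the sides tell upper from lower bounds.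
  cancel : ∀ {k} → Ineq k → Ineq k
  cancel (l , r) = (l ⊟ r) , (r ⊟ l)

  private
    balance : ∀ a b → a + (b ∸ a) ≡ b + (a ∸ b)
    balance zero b = sym (trans (cong (b +_) (0∸n≡0 b)) (+-identityʳ b))
    balance (suc a) zero = cong suc (+-identityʳ a)
    balance (suc a) (suc b) = cong suc (balance a b)

  -- Entrywise, `l + (r ∸ l)` and `r + (l ∸ r)` are both the maximum of `l` and `r`.
  dot-balance : ∀ {k} (l r : Row k) ρ → dot l ρ + dot (r ⊟ l) ρ ≡ dot r ρ + dot (l ⊟ r) ρ
  dot-balance {zero} (a ∷ []) (b ∷ []) [] = balance a b
  dot-balance {suc k} (a ∷ as) (b ∷ bs) (x ∷ ρ) =
    trans (swap-middle (a * x) (dot as ρ) _ _)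
      (trans (cong₂ _+_ (trans (sym (*-distribʳ-+ x a (b ∸ a))) (trans (cong (_* x) (balance a b)) (*-distribʳ-+ x b (a ∸ b))))
                        (dot-balance as bs ρ))
        (sym (swap-middle (b * x) (dot bs ρ) _ _)))

  cancel-sound : ∀ {k} ρ (c : Ineq k) → Holds ρ c → Holds ρ (cancel c)
  cancel-sound ρ (l , r) h = +-cancelˡ-≤ (dot r ρ) _ _
    (≤-trans (≤-reflexive (sym (dot-balance l r ρ))) (+-monoˡ-≤ (dot (r ⊟ l) ρ) h))

  scaledSum : ∀ {k} → ℕ → Ineq k → ℕ → Ineq k → Ineq k
  scaledSum q (l , r) p (l′ , r′) = cancel (map (q *_) l ⊞ map (p *_) l′ , map (q *_) r ⊞ map (p *_) r′)

  dot-scaledSum : ∀ {k} q (a : Row k) p b ρ → dot (map (q *_) a ⊞ map (p *_) b) ρ ≡ q * dot a ρ + p * dot b ρ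
  dot-scaledSum q a p b ρ = trans (dot-⊞ (map (q *_) a) (map (p *_) b) ρ) (cong₂ _+_ (dot-scale q a ρ) (dot-scale p b ρ))

  scaledSum-sound : ∀ {k} ρ q (c : Ineq k) p d → Holds ρ c → Holds ρ d → Holds ρ (scaledSum q c p d)
  scaledSum-sound ρ q (l , r) p (l′ , r′) h h′ = cancel-sound ρ (map (q *_) l ⊞ map (p *_) l′ , map (q *_) r ⊞ map (p *_) r′)
    (subst₂ _≤_ (sym (dot-scaledSum q l p l′ ρ)) (sym (dot-scaledSum q r p r′ ρ)) (+-mono-≤ (*-monoʳ-≤ q h) (*-monoʳ-≤ p h′)))

  coeff : ∀ {k} → Fin k → Row k → ℕ
  coeff zero (a ∷ _) = a
  coeff (suc i) (_ ∷ as) = coeff i as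

  isZero : ℕ → Bool
  isZero zero = true
  isZero (suc _) = false

  allZero : ∀ {m} → Vec ℕ m → Bool
  allZero [] = true
  allZero (zero ∷ v) = allZero v
  allZero (suc _ ∷ v) = false

  below : ∀ {m} → Vec ℕ m → Vec ℕ m → Bool
  below [] [] = true
  below (a ∷ as) (b ∷ bs) = isZero (a ∸ b) ∧ below as bs

  -- An inequality with left side 0 always holds in ℕ, and one that is dominated entrywise by a
  -- stored one follows from it. Dropping facts cannot make a refutation unsound.
  redundant : ∀ {k} → Ineq k → List (Ineq k) → Bool
  redundant (l , r) cs = allZero l ∨ any (λ (l′ , r′) → below l l′ ∧ below r′ r) cs

  insert : ∀ {k} → Ineq k → List (Ineq k) → List (Ineq k)
  insert c cs = if redundant c cs then cs else c ∷ cs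

  insert-sound : ∀ {k} ρ (c : Ineq k) cs → Holds ρ c → All (Holds ρ) cs → All (Holds ρ) (insert c cs)
  insert-sound ρ c cs h hs with redundant c cs
  ... | true = hs
  ... | false = h ∷ hs

  insertAll : ∀ {k} → List (Ineq k) → List (Ineq k) → List (Ineq k)
  insertAll [] ds = ds
  insertAll (c ∷ cs) ds = insertAll cs (insert c ds)

  insertAll-sound : ∀ {k} ρ (cs ds : List (Ineq k)) → All (Holds ρ) cs → All (Holds ρ) ds → All (Holds ρ) (insertAll cs ds)
  insertAll-sound ρ [] ds [] js = js
  insertAll-sound ρ (c ∷ cs) ds (h ∷ hs) js = insertAll-sound ρ cs (insert c ds) hs (insert-sound ρ c ds h js)

  concatMap⁺ : ∀ {a b p q} {A : Set a} {B : Set b} {P : A → Set p} {Q : B → Set q} (f : A → List B) →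
    (∀ x → P x → All Q (f x)) → ∀ xs → All P xs → All Q (concatMap f xs)
  concatMap⁺ f g [] [] = []
  concatMap⁺ f g (x ∷ xs) (p ∷ ps) = ++⁺ (g x p) (concatMap⁺ f g xs ps)

  keep : ∀ {a p} {A : Set a} {P : A → Set p} (f : A → Bool) {xs : List A} → All P xs → All P (filterᵇ f xs)
  keep f [] = []
  keep f {x ∷ xs} (p ∷ ps) with f x
  ... | true = p ∷ keep f ps
  ... | false = keep f ps

  nonneg : ∀ {k} → Fin k → Ineq k
  nonneg i = constRow 0 , unitRow i

  nonneg-sound : ∀ {k} (i : Fin k) ρ → Holds ρ (nonneg i)
  nonneg-sound i ρ = ≤-trans (≤-reflexive (dot-const 0 ρ)) z≤n

  hasUpper hasLower lacks : ∀ {k} → Fin k → Ineq k → Bool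
  hasUpper i (l , r) = not (isZero (coeff i l))
  hasLower i (l , r) = not (isZero (coeff i r))
  lacks i (l , r) = isZero (coeff i l) ∧ isZero (coeff i r)

  resolve : ∀ {k} → Fin k → Ineq k → Ineq k → Ineq k
  resolve i c d = scaledSum (coeff i (proj₂ d)) c (coeff i (proj₁ c)) d

  eliminate : ∀ {k} → Fin k → List (Ineq k) → List (Ineq k)
  eliminate i cs =
    -- The bound 0 ≤ x, implicit in ℕ, takes part as a lower bound.
    insertAll (concatMap (λ c → List.map (resolve i c) (nonneg i ∷ filterᵇ (hasLower i) cs)) (filterᵇ (hasUpper i) cs))
      (filterᵇ (lacks i) cs)

  eliminate-sound : ∀ {k} i ρ (cs : List (Ineq k)) → All (Holds ρ) cs → All (Holds ρ) (eliminate i cs)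
  eliminate-sound i ρ cs hs = insertAll-sound ρ _ _
    (concatMap⁺ (λ c → List.map (resolve i c) (nonneg i ∷ filterᵇ (hasLower i) cs))
      (λ c h → map⁺ (All.map (λ {d} h′ → scaledSum-sound ρ (coeff i (proj₂ d)) c (coeff i (proj₁ c)) d h h′)
        (nonneg-sound i ρ ∷ keep (hasLower i) hs)))
      (filterᵇ (hasUpper i) cs) (keep (hasUpper i) hs))
    (keep (lacks i) hs)

  -- A variable that does not occur must not be chosen.
  cost : ∀ {k} → Fin k → List (Ineq k) → ℕ
  cost i cs with List.length (filterᵇ (hasUpper i) cs) | List.length (filterᵇ (hasLower i) cs)
  ... | zero | zero = 100000
  ... | u | v = u * suc v

  cheapest : ∀ {k} → List (Fin k × ℕ) → Maybe (Fin k × ℕ)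
  cheapest [] = nothing
  cheapest ((i , c) ∷ ics) with cheapest ics
  ... | nothing = just (i , c)
  ... | just (j , d) = if c ≤ᵇ d then just (i , c) else just (j , d)

  lastPos : ∀ {k} → Row k → Bool
  lastPos {zero} (c ∷ []) = 0 <ᵇ c
  lastPos {suc k} (_ ∷ l) = lastPos l

  lastPos-sound : ∀ {k} (l : Row k) ρ → T (lastPos l) → 0 < dot l ρ
  lastPos-sound {zero} (c ∷ []) [] t = <ᵇ⇒< 0 c t
  lastPos-sound {suc k} (a ∷ l) (x ∷ ρ) t = ≤-trans (lastPos-sound l ρ t) (m≤n+m _ (a * x))

  allZero-sound : ∀ {k} (r : Row k) ρ → T (allZero r) → dot r ρ ≡ 0
  allZero-sound {zero} (zero ∷ []) [] t = refl
  allZero-sound {suc k} (zero ∷ r) (x ∷ ρ) t = allZero-sound r ρ t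

  absurdIneq : ∀ {k} → Ineq k → Bool
  absurdIneq (l , r) = allZero r ∧ lastPos l

  absurdIneq-sound : ∀ {k} ρ (c : Ineq k) → T (absurdIneq c) → ¬ Holds ρ c
  absurdIneq-sound ρ (l , r) t h with Equivalence.to (T-∧ {allZero r}) t
  ... | t₁ , t₂ = n≮0 (≤-trans (lastPos-sound l ρ t₂) (≤-trans h (≤-reflexive (allZero-sound r ρ t₁))))

  any-absurd : ∀ {k} ρ (cs : List (Ineq k)) → T (any absurdIneq cs) → ¬ All (Holds ρ) cs
  any-absurd ρ (c ∷ cs) t (h ∷ hs) with Equivalence.to (T-∨ {absurdIneq c}) t
  ... | inj₁ t₁ = absurdIneq-sound ρ c t₁ h
  ... | inj₂ t₂ = any-absurd ρ cs t₂ hs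

  fourierMotzkin : ∀ {k} → ℕ → List (Ineq k) → Bool
  fourierMotzkin zero cs = any absurdIneq cs
  fourierMotzkin (suc m) cs with any absurdIneq cs | cheapest (List.map (λ i → i , cost i cs) (List.allFin _))
  ... | true | _ = true
  ... | false | nothing = false
  ... | false | just (i , _) = fourierMotzkin m (eliminate i cs)

  fourierMotzkin-sound : ∀ {k} m ρ (cs : List (Ineq k)) → T (fourierMotzkin m cs) → ¬ All (Holds ρ) cs
  fourierMotzkin-sound zero ρ cs t hs = any-absurd ρ cs t hs
  fourierMotzkin-sound (suc m) ρ cs t hs with any absurdIneq cs in eq | cheapest (List.map (λ i → i , cost i cs) (List.allFin _))
  ... | true | _ = any-absurd ρ cs (subst T (sym eq) tt) hs
  ... | false | just (i , _) = fourierMotzkin-sound m ρ (eliminate i cs) t (eliminate-sound i ρ cs hs)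

  HoldsEq : ∀ {k} → Vec ℕ k → Ineq k → Set
  HoldsEq ρ (l , r) = dot l ρ ≡ dot r ρ

  pivot : ∀ {k} → List (Fin k) → Ineq k → Maybe (Fin k)
  pivot [] c = nothing
  pivot (i ∷ is) c = if lacks i c then pivot is c else just i

  orient : ∀ {k} → Fin k → Ineq k → Ineq k
  orient i (l , r) = if hasUpper i (l , r) then l , r else r , l

  orient-sound : ∀ {k} i ρ (c : Ineq k) → HoldsEq ρ c → HoldsEq ρ (orient i c)
  orient-sound i ρ (l , r) h with hasUpper i (l , r)
  ... | true = h
  ... | false = sym h

  -- Adds to d the multiple of the equation l = r, where i occurs in l only, that removes i.
  substitute : ∀ {k} → Fin k → Ineq k → Ineq k → Ineq k
  substitute i (l , r) d with isZero (coeff i (proj₁ d))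
  ... | true = scaledSum (coeff i (proj₂ d)) (l , r) (coeff i l) d
  ... | false = scaledSum (coeff i (proj₁ d)) (r , l) (coeff i l) d

  substitute-sound : ∀ {k} i ρ (c d : Ineq k) → HoldsEq ρ c → Holds ρ d → Holds ρ (substitute i c d)
  substitute-sound i ρ (l , r) d h h′ with isZero (coeff i (proj₁ d))
  ... | true = scaledSum-sound ρ (coeff i (proj₂ d)) (l , r) (coeff i l) d (≤-reflexive h) h′
  ... | false = scaledSum-sound ρ (coeff i (proj₁ d)) (r , l) (coeff i l) d (≤-reflexive (sym h)) h′

  substitute-soundEq : ∀ {k} i ρ (c d : Ineq k) → HoldsEq ρ c → HoldsEq ρ d → HoldsEq ρ (substitute i c d)
  substitute-soundEq i ρ c@(l , r) d@(l′ , r′) h h′ with isZero (coeff i l′)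
  ... | true = ≤-antisym
      (scaledSum-sound ρ (coeff i r′) (l , r) (coeff i l) d (≤-reflexive h) (≤-reflexive h′))
      (scaledSum-sound ρ (coeff i r′) (r , l) (coeff i l) (r′ , l′) (≤-reflexive (sym h)) (≤-reflexive (sym h′)))
  ... | false = ≤-antisym
      (scaledSum-sound ρ (coeff i l′) (r , l) (coeff i l) d (≤-reflexive (sym h)) (≤-reflexive h′))
      (scaledSum-sound ρ (coeff i l′) (l , r) (coeff i l) (r′ , l′) (≤-reflexive h) (≤-reflexive (sym h′)))

  gauss : ∀ {k} → ℕ → List (Ineq k) → List (Ineq k) → Bool
  gauss zero es cs = false
  gauss {k} (suc m) [] cs = fourierMotzkin k (insertAll cs [])
  gauss (suc m) (e ∷ es) cs with pivot (List.allFin _) e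
  ... | nothing = any absurdIneq (e ∷ (proj₂ e , proj₁ e) ∷ []) ∨ gauss m es cs
  -- Substitution removes `i`, so its bound 0 ≤ x is added first and survives as an inequality in
  -- the other variables.
  ... | just i = gauss m (List.map (substitute i (orient i e)) es) (List.map (substitute i (orient i e)) (nonneg i ∷ cs))

  gauss-sound : ∀ {k} m ρ (es cs : List (Ineq k)) → T (gauss m es cs) → All (HoldsEq ρ) es → ¬ All (Holds ρ) cs
  gauss-sound {k} (suc m) ρ [] cs t ps hs = fourierMotzkin-sound k ρ (insertAll cs []) t (insertAll-sound ρ cs [] hs [])
  gauss-sound (suc m) ρ (e ∷ es) cs t (p ∷ ps) hs with pivot (List.allFin _) e
  ... | nothing with Equivalence.to (T-∨ {any absurdIneq (e ∷ (proj₂ e , proj₁ e) ∷ [])}) t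
  ...   | inj₁ t₁ = any-absurd ρ _ t₁ (≤-reflexive p ∷ ≤-reflexive (sym p) ∷ [])
  ...   | inj₂ t₂ = gauss-sound m ρ es cs t₂ ps hs
  gauss-sound (suc m) ρ (e ∷ es) cs t (p ∷ ps) hs | just i = gauss-sound m ρ _ _ t
    (map⁺ (All.map (λ {d} → substitute-soundEq i ρ (orient i e) d (orient-sound i ρ e p)) ps))
    (map⁺ (All.map (λ {d} → substitute-sound i ρ (orient i e) d (orient-sound i ρ e p)) (nonneg-sound i ρ ∷ hs)))

  leq lss : ∀ {k} → Exp k → Exp k → Ineq k
  leq a b = cancel (row a , row b)
  lss a b = leq (con 1 :+ a) b

  leq-sound : ∀ {k} ρ (a b : Exp k) → ⟦ a ⟧ₑ ρ ≤ ⟦ b ⟧ₑ ρ → Holds ρ (leq a b)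
  leq-sound ρ a b h = cancel-sound ρ (row a , row b) (subst₂ _≤_ (sym (dot-row a ρ)) (sym (dot-row b ρ)) h)

  eql : ∀ {k} → Exp k → Exp k → Ineq k
  eql a b = cancel (row a , row b)

  eql-sound : ∀ {k} ρ (a b : Exp k) → ⟦ a ⟧ₑ ρ ≡ ⟦ b ⟧ₑ ρ → HoldsEq ρ (eql a b)
  eql-sound ρ a b h = ≤-antisym (leq-sound ρ a b (≤-reflexive h)) (leq-sound ρ b a (≤-reflexive (sym h)))

  Signed : ℕ → Set
  Signed k = Bool × Form k

  ⟦_⟧ₛ : ∀ {k} → Signed k → Vec ℕ k → Set
  ⟦ true , φ ⟧ₛ ρ = ⟦ φ ⟧ ρ
  ⟦ false , φ ⟧ₛ ρ = ¬ ⟦ φ ⟧ ρ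

  -- Disjunctions are postponed to the list ss. If one side of some of them is refutable at once, the other side is
  -- asserted; only otherwise is a disjunction split.
  refute : ∀ {k} → ℕ → List (Ineq k) → List (Ineq k) → List (Signed k) → List (Signed k × Signed k) → Bool
  scan : ∀ {k} → ℕ → List (Ineq k) → List (Ineq k) → List (Signed k × Signed k) → List (Signed k × Signed k) → Bool
  refute zero es cs todo ss = false
  refute (suc m) es cs ((true , a :≤ b) ∷ todo) ss = refute m es (leq a b ∷ cs) todo ss
  refute (suc m) es cs ((true , a :< b) ∷ todo) ss = refute m es (lss a b ∷ cs) todo ss
  refute (suc m) es cs ((true , a :≡ b) ∷ todo) ss = refute m (eql a b ∷ es) cs todo ss
  refute (suc m) es cs ((true , :⊥) ∷ todo) ss = true
  refute (suc m) es cs ((true , φ :∧ ψ) ∷ todo) ss = refute m es cs ((true , φ) ∷ (true , ψ) ∷ todo) ss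
  refute (suc m) es cs ((true , φ :∨ ψ) ∷ todo) ss = refute m es cs todo (((true , φ) , (true , ψ)) ∷ ss)
  refute (suc m) es cs ((true , φ :⇒ ψ) ∷ todo) ss = refute m es cs todo (((false , φ) , (true , ψ)) ∷ ss)
  refute (suc m) es cs ((false , a :≤ b) ∷ todo) ss = refute m es (lss b a ∷ cs) todo ss
  refute (suc m) es cs ((false , a :< b) ∷ todo) ss = refute m es (leq b a ∷ cs) todo ss
  refute (suc m) es cs ((false , a :≡ b) ∷ todo) ss = refute m es cs todo (((true , a :< b) , (true , b :< a)) ∷ ss)
  refute (suc m) es cs ((false , :⊥) ∷ todo) ss = refute m es cs todo ss
  refute (suc m) es cs ((false , φ :∧ ψ) ∷ todo) ss = refute m es cs todo (((false , φ) , (false , ψ)) ∷ ss)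
  refute (suc m) es cs ((false , φ :∨ ψ) ∷ todo) ss = refute m es cs ((false , φ) ∷ (false , ψ) ∷ todo) ss
  refute (suc m) es cs ((false , φ :⇒ ψ) ∷ todo) ss = refute m es cs ((true , φ) ∷ (false , ψ) ∷ todo) ss
  refute (suc m) es cs [] [] = gauss 100 es cs
  refute (suc m) es cs [] (d ∷ ss) = gauss 100 es cs ∨ scan m es cs (d ∷ ss) []
  scan m es cs [] [] = false
  scan m es cs [] ((s , s′) ∷ ss) = refute m es cs (s ∷ []) ss ∧ refute m es cs (s′ ∷ []) ss
  scan m es cs ((s , s′) ∷ ss) ps with refute m es cs (s ∷ []) [] | refute m es cs (s′ ∷ []) []
  ... | true | _ = refute m es cs (s′ ∷ []) (ps ++ ss)
  ... | false | true = refute m es cs (s ∷ []) (ps ++ ss)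
  ... | false | false = scan m es cs ss ((s , s′) ∷ ps)

  Either : ∀ {k} → Vec ℕ k → Signed k × Signed k → Set
  Either ρ (s , s′) = ⟦ s ⟧ₛ ρ ⊎ ⟦ s′ ⟧ₛ ρ

  refute-sound : ∀ {k} m ρ (es cs : List (Ineq k)) todo ss → T (refute m es cs todo ss) →
    All (HoldsEq ρ) es → All (Holds ρ) cs → All (λ s → ⟦ s ⟧ₛ ρ) todo → All (Either ρ) ss → ⊥
  scan-sound : ∀ {k} m ρ (es cs : List (Ineq k)) ss ps → T (scan m es cs ss ps) →
    All (HoldsEq ρ) es → All (Holds ρ) cs → All (Either ρ) ss → All (Either ρ) ps → ⊥
  refute-sound (suc m) ρ es cs ((true , a :≤ b) ∷ todo) ss t gs hs (p ∷ ps) qs =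
    refute-sound m ρ es _ todo ss t gs (leq-sound ρ a b p ∷ hs) ps qs
  refute-sound (suc m) ρ es cs ((true , a :< b) ∷ todo) ss t gs hs (p ∷ ps) qs =
    refute-sound m ρ es _ todo ss t gs (leq-sound ρ (con 1 :+ a) b p ∷ hs) ps qs
  refute-sound (suc m) ρ es cs ((true , a :≡ b) ∷ todo) ss t gs hs (p ∷ ps) qs =
    refute-sound m ρ _ cs todo ss t (eql-sound ρ a b p ∷ gs) hs ps qs
  refute-sound (suc m) ρ es cs ((true , :⊥) ∷ todo) ss t gs hs (p ∷ ps) qs = p
  refute-sound (suc m) ρ es cs ((true , φ :∧ ψ) ∷ todo) ss t gs hs ((p , p′) ∷ ps) qs =
    refute-sound m ρ es cs _ ss t gs hs (p ∷ p′ ∷ ps) qs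
  refute-sound (suc m) ρ es cs ((true , φ :∨ ψ) ∷ todo) ss t gs hs (p ∷ ps) qs =
    refute-sound m ρ es cs todo _ t gs hs ps (p ∷ qs)
  refute-sound (suc m) ρ es cs ((true , φ :⇒ ψ) ∷ todo) ss t gs hs (p ∷ ps) qs =
    refute-sound m ρ es cs todo _ t gs hs ps (implication (decide φ ρ) ∷ qs)
    where
    implication : Dec (⟦ φ ⟧ ρ) → Either ρ ((false , φ) , (true , ψ))
    implication (yes a) = inj₂ (p a)
    implication (no ¬a) = inj₁ ¬a
  refute-sound (suc m) ρ es cs ((false , a :≤ b) ∷ todo) ss t gs hs (p ∷ ps) qs =
    refute-sound m ρ es _ todo ss t gs (leq-sound ρ (con 1 :+ b) a (≰⇒> p) ∷ hs) ps qs
  refute-sound (suc m) ρ es cs ((false , a :< b) ∷ todo) ss t gs hs (p ∷ ps) qs =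
    refute-sound m ρ es _ todo ss t gs (leq-sound ρ b a (≮⇒≥ p) ∷ hs) ps qs
  refute-sound (suc m) ρ es cs ((false , a :≡ b) ∷ todo) ss t gs hs (p ∷ ps) qs =
    refute-sound m ρ es cs todo _ t gs hs ps (≢⇒<⊎> (<-cmp (⟦ a ⟧ₑ ρ) (⟦ b ⟧ₑ ρ)) ∷ qs)
    where
    open import Relation.Binary.Definitions using (Tri; tri<; tri≈; tri>)
    ≢⇒<⊎> : Tri (⟦ a ⟧ₑ ρ < ⟦ b ⟧ₑ ρ) (⟦ a ⟧ₑ ρ ≡ ⟦ b ⟧ₑ ρ) (⟦ b ⟧ₑ ρ < ⟦ a ⟧ₑ ρ) → Either ρ ((true , a :< b) , (true , b :< a))
    ≢⇒<⊎> (tri< lt _ _) = inj₁ lt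
    ≢⇒<⊎> (tri≈ _ eq _) = ⊥-elim (p eq)
    ≢⇒<⊎> (tri> _ _ gt) = inj₂ gt
  refute-sound (suc m) ρ es cs ((false , :⊥) ∷ todo) ss t gs hs (p ∷ ps) qs = refute-sound m ρ es cs todo ss t gs hs ps qs
  refute-sound (suc m) ρ es cs ((false , φ :∧ ψ) ∷ todo) ss t gs hs (p ∷ ps) qs =
    refute-sound m ρ es cs todo _ t gs hs ps (deMorgan (decide φ ρ) ∷ qs)
    where
    deMorgan : Dec (⟦ φ ⟧ ρ) → Either ρ ((false , φ) , (false , ψ))
    deMorgan (yes a) = inj₂ λ b → p (a , b)
    deMorgan (no ¬a) = inj₁ ¬a
  refute-sound (suc m) ρ es cs ((false , φ :∨ ψ) ∷ todo) ss t gs hs (p ∷ ps) qs =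
    refute-sound m ρ es cs _ ss t gs hs (p ∘ inj₁ ∷ p ∘ inj₂ ∷ ps) qs
  refute-sound (suc m) ρ es cs ((false , φ :⇒ ψ) ∷ todo) ss t gs hs (p ∷ ps) qs =
    refute-sound m ρ es cs _ ss t gs hs (premise (decide φ ρ) ∷ (λ b → p λ _ → b) ∷ ps) qs
    where
    premise : Dec (⟦ φ ⟧ ρ) → ⟦ φ ⟧ ρ
    premise (yes a) = a
    premise (no ¬a) = ⊥-elim (p (⊥-elim ∘ ¬a))
  refute-sound (suc m) ρ es cs [] [] t gs hs [] [] = gauss-sound 100 ρ es cs t gs hs
  refute-sound (suc m) ρ es cs [] (d ∷ ss) t gs hs [] qs with Equivalence.to (T-∨ {gauss 100 es cs}) t
  ... | inj₁ t₁ = gauss-sound 100 ρ es cs t₁ gs hs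
  ... | inj₂ t₂ = scan-sound m ρ es cs (d ∷ ss) [] t₂ gs hs qs []
  scan-sound m ρ es cs [] ((s , s′) ∷ ss) t gs hs [] (q ∷ qs) with Equivalence.to (T-∧ {refute m es cs (s ∷ []) ss}) t | q
  ... | u , _ | inj₁ p = refute-sound m ρ es cs (s ∷ []) ss u gs hs (p ∷ []) qs
  ... | _ , u | inj₂ p = refute-sound m ρ es cs (s′ ∷ []) ss u gs hs (p ∷ []) qs
  scan-sound m ρ es cs ((s , s′) ∷ ss) ps t gs hs (q ∷ qs) rs
    with refute m es cs (s ∷ []) [] in eq | refute m es cs (s′ ∷ []) [] in eq′ | q
  ... | true | _ | inj₁ p = refute-sound m ρ es cs (s ∷ []) [] (subst T (sym eq) tt) gs hs (p ∷ []) []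
  ... | true | _ | inj₂ p = refute-sound m ρ es cs (s′ ∷ []) (ps ++ ss) t gs hs (p ∷ []) (++⁺ rs qs)
  ... | false | true | inj₂ p = refute-sound m ρ es cs (s′ ∷ []) [] (subst T (sym eq′) tt) gs hs (p ∷ []) []
  ... | false | true | inj₁ p = refute-sound m ρ es cs (s ∷ []) (ps ++ ss) t gs hs (p ∷ []) (++⁺ rs qs)
  ... | false | false | _ = scan-sound m ρ es cs ss ((s , s′) ∷ ps) t gs hs qs (q ∷ rs)

  Forms : ℕ → ℕ → Set
  Forms k zero = Form k
  Forms k (suc j) = Exp k → Forms k j

  apply : ∀ {k j} → Forms k j → Vec (Exp k) j → Form k
  apply f [] = f
  apply f (e ∷ es) = apply (f e) es

  variables : ∀ {k} → Vec (Exp k) k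
  variables = Data.Vec.tabulate var

  Every : ∀ k → (Vec ℕ k → Set) → Set
  Every zero P = P []
  Every (suc k) P = ∀ x → Every k (λ ρ → P (x ∷ ρ))

  every : ∀ k {P : Vec ℕ k → Set} → (∀ ρ → P ρ) → Every k P
  every zero p = p []
  every (suc k) p x = every k λ ρ → p (x ∷ ρ)

  -- Every formula is decidable at given values, so it suffices to refute its negation. The premise
  -- is a closed Boolean computation, which each use discharges by `refl`. Taking the formula as a
  -- function of expressions allows named variables.
  lia : ∀ k (f : Forms k k) → refute 1000 [] [] ((false , apply f variables) ∷ []) [] ≡ true →
    Every k ⟦ apply f variables ⟧
  lia k f t = every k λ ρ → valid ρ (decide (apply f variables) ρ)
    where
    valid : ∀ ρ → Dec (⟦ apply f variables ⟧ ρ) → ⟦ apply f variables ⟧ ρ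
    valid ρ (yes p) = p
    valid ρ (no ¬p) = ⊥-elim (refute-sound 1000 ρ [] [] ((false , apply f variables) ∷ []) [] (subst T (sym t) tt) [] [] (¬p ∷ []) [])

-- Bit sequences cut into blocks of two.

module Bits where

  open import Data.Nat
  open import Data.Nat.Properties
  open import Data.Bool using (Bool; true; false)
  open import Data.Fin using (zero; suc; toℕ)
  open import Data.Fin.Subset using (Subset; _∈_; ∣_∣)
  open import Data.Vec using (Vec; []; _∷_; tabulate)
  open import Data.Vec.Base using (here; there)
  open import Function using (case_of_)

  -- Positions past the end read `false`, so a true bit bounds its own position and yields a `Fin`
  -- index.
  at : ∀ {m} → Vec Bool m → ℕ → Bool
  at [] j = false
  at (b ∷ v) zero = b
  at (b ∷ v) (suc j) = at v j

  ∈⇒at : ∀ {m} {v : Subset m} {i} → i ∈ v → at v (toℕ i) ≡ true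
  ∈⇒at here = refl
  ∈⇒at (there p) = ∈⇒at p

  at⇒∈ : ∀ {m} (v : Subset m) i → at v (toℕ i) ≡ true → i ∈ v
  at⇒∈ (true ∷ v) zero p = here
  at⇒∈ (b ∷ v) (suc i) p = there (at⇒∈ v i p)

  at-bounded : ∀ {m} (v : Subset m) j → at v j ≡ true → j < m
  at-bounded (b ∷ v) zero p = s≤s z≤n
  at-bounded (b ∷ v) (suc j) p = s≤s (at-bounded v j p)

  at-tabulate : ∀ m (f : ℕ → Bool) j → j < m → at (tabulate {n = m} (f ∘ toℕ)) j ≡ f j
  at-tabulate (suc m) f zero p = refl
  at-tabulate (suc m) f (suc j) (s≤s p) = at-tabulate m (f ∘ suc) j p

  at-injective : ∀ {m} (v w : Vec Bool m) → (∀ j → j < m → at v j ≡ at w j) → v ≡ w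
  at-injective [] [] h = refl
  at-injective (a ∷ v) (b ∷ w) h = cong₂ _∷_ (h 0 (s≤s z≤n)) (at-injective v w λ j p → h (suc j) (s≤s p))

  bit : Bool → ℕ
  bit true = 1
  bit false = 0

  cnt : (ℕ → Bool) → ℕ → ℕ
  cnt b zero = 0
  cnt b (suc m) = bit (b 0) + cnt (λ j → b (suc j)) m

  card≡cnt : ∀ {m} (v : Subset m) → ∣ v ∣ ≡ cnt (at v) m
  card≡cnt [] = refl
  card≡cnt (true ∷ v) = cong suc (card≡cnt v)
  card≡cnt (false ∷ v) = card≡cnt v

  dbl : ℕ → ℕ
  dbl zero = 0
  dbl (suc k) = suc (suc (dbl k))

  -- Block k of a bit sequence consists of the bits dbl k and suc (dbl k).
  Xb Yb : (ℕ → Bool) → ℕ → Bool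
  Xb b k = b (dbl k)
  Yb b k = b (suc (dbl k))

  data Half : ℕ → Set where
    even : ∀ k → Half (dbl k)
    odd : ∀ k → Half (suc (dbl k))

  half : ∀ j → Half j
  half zero = even 0
  half (suc j) with half j
  ... | even k = odd k
  ... | odd k = even (suc k)

  dbl-≤ : ∀ k m → dbl k < m * 2 → k < m
  dbl-≤ zero (suc m) p = s≤s z≤n
  dbl-≤ (suc k) (suc m) (s≤s (s≤s p)) = s≤s (dbl-≤ k m p)

  dbl-< : ∀ {k m} → k < m → suc (dbl k) < m * 2
  dbl-< {zero} {suc m} (s≤s z≤n) = s≤s (s≤s z≤n)
  dbl-< {suc k} {suc m} (s≤s p) = s≤s (s≤s (dbl-< p))

  interleave : (ℕ → Bool) → (ℕ → Bool) → ℕ → Bool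
  interleave f g zero = f 0
  interleave f g (suc zero) = g 0
  interleave f g (suc (suc j)) = interleave (f ∘ suc) (g ∘ suc) j

  interleave-even : ∀ f g k → interleave f g (dbl k) ≡ f k
  interleave-even f g zero = refl
  interleave-even f g (suc k) = interleave-even (f ∘ suc) (g ∘ suc) k

  interleave-odd : ∀ f g k → interleave f g (suc (dbl k)) ≡ g k
  interleave-odd f g zero = refl
  interleave-odd f g (suc k) = interleave-odd (f ∘ suc) (g ∘ suc) k

  Single : (ℕ → Bool) → ℕ → Set
  Single b k = ¬ (Xb b k ≡ true × Yb b k ≡ true)

  Occupied : (ℕ → Bool) → ℕ → Set
  Occupied b k = Xb b k ≡ true ⊎ Yb b k ≡ true

  private
    shift : (ℕ → Bool) → ℕ → Bool
    shift b j = b (suc (suc j))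

  cnt-≤ : ∀ m b → (∀ k → k < m → Single b k) → cnt b (m * 2) ≤ m
  cnt-≤ zero b h = z≤n
  cnt-≤ (suc m) b h with b 0 | b 1 | h 0 (s≤s z≤n) | cnt-≤ m (shift b) (λ k p → h (suc k) (s≤s p))
  ... | true | true | h₀ | ih = ⊥-elim (h₀ (refl , refl))
  ... | true | false | h₀ | ih = s≤s ih
  ... | false | true | h₀ | ih = s≤s ih
  ... | false | false | h₀ | ih = m≤n⇒m≤1+n ih

  -- An empty block would leave the whole count `m` to the other m - 1 blocks.
  cnt-occupied : ∀ m b → (∀ k → k < m → Single b k) → cnt b (m * 2) ≡ m → ∀ k → k < m → Occupied b k
  cnt-occupied (suc m) b h e with b 0 in eq₀ | b 1 in eq₁ | h 0 (s≤s z≤n) | cnt-≤ m (shift b) (λ k p → h (suc k) (s≤s p)) | cnt-occupied m (shift b) (λ k p → h (suc k) (s≤s p))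
  ... | true | true | h₀ | _ | _ = ⊥-elim (h₀ (refl , refl))
  ... | true | false | h₀ | _ | ih = λ { zero _ → inj₁ eq₀ ; (suc k) (s≤s p) → ih (suc-injective e) k p }
  ... | false | true | h₀ | _ | ih = λ { zero _ → inj₂ eq₁ ; (suc k) (s≤s p) → ih (suc-injective e) k p }
  ... | false | false | h₀ | le | _ = ⊥-elim (1+n≰n (subst (_≤ m) e le))

  EmptyAt : (ℕ → Bool) → ℕ → ℕ → Set
  EmptyAt b m a = a ≤ m × Xb b a ≡ false × Yb b a ≡ false × (∀ k → k ≤ m → k ≢ a → Occupied b k)

  -- There are m + 1 blocks for `m` bits. Up to the first empty block each one uses up a bit, and
  -- after it the count is tight, so `cnt-occupied` applies.
  cnt-emptyAt : ∀ m b → (∀ k → k ≤ m → Single b k) → cnt b (suc m * 2) ≡ m → ∃ (EmptyAt b m)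
  cnt-emptyAt m b h e with b 0 in eq₀ | b 1 in eq₁ | h 0 z≤n
  ... | true | true | h₀ = ⊥-elim (h₀ (refl , refl))
  ... | false | false | h₀ = 0 , z≤n , eq₀ , eq₁ , occupied
    where
    occupied : ∀ k → k ≤ m → k ≢ 0 → Occupied b k
    occupied zero p q = ⊥-elim (q refl)
    occupied (suc k) p q = cnt-occupied m (shift b) (λ k p → h (suc k) p) e k p
  cnt-emptyAt (suc m) b h e | true | false | _
    with cnt-emptyAt m (shift b) (λ k p → h (suc k) (s≤s p)) (suc-injective e)
  ... | a , p , x , y , o = suc a , s≤s p , x , y , λ { zero _ _ → inj₁ eq₀ ; (suc k) (s≤s q) r → o k q (r ∘ cong suc) }
  cnt-emptyAt (suc m) b h e | false | true | _
    with cnt-emptyAt m (shift b) (λ k p → h (suc k) (s≤s p)) (suc-injective e)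
  ... | a , p , x , y , o = suc a , s≤s p , x , y , λ { zero _ _ → inj₂ eq₁ ; (suc k) (s≤s q) r → o k q (r ∘ cong suc) }

  occupied-cnt : ∀ m b → (∀ k → k < m → Single b k) → (∀ k → k < m → Occupied b k) → cnt b (m * 2) ≡ m
  occupied-cnt zero b h o = refl
  occupied-cnt (suc m) b h o with b 0 | b 1 | h 0 (s≤s z≤n) | o 0 (s≤s z≤n) | occupied-cnt m (shift b) (λ k p → h (suc k) (s≤s p)) (λ k p → o (suc k) (s≤s p))
  ... | true | true | h₀ | _ | _ = ⊥-elim (h₀ (refl , refl))
  ... | true | false | _ | _ | ih = cong suc ih
  ... | false | true | _ | _ | ih = cong suc ih
  ... | false | false | _ | inj₁ () | _
  ... | false | false | _ | inj₂ () | _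

  emptyAt-cnt : ∀ m b a → (∀ k → k ≤ m → Single b k) → EmptyAt b m a → cnt b (suc m * 2) ≡ m
  emptyAt-cnt m b zero h (p , x , y , o) with b 0 | b 1
  ... | false | false = occupied-cnt m (shift b) (λ k p → h (suc k) p) (λ k p → o (suc k) p λ ())
  emptyAt-cnt (suc m) b (suc a) h (s≤s p , x , y , o) with b 0 | b 1 | h 0 z≤n | o 0 z≤n (λ ()) | emptyAt-cnt m (shift b) a (λ k p → h (suc k) (s≤s p)) (p , x , y , λ k q r → o (suc k) (s≤s q) (r ∘ suc-injective))
  ... | true | true | h₀ | _ | _ = ⊥-elim (h₀ (refl , refl))
  ... | true | false | _ | _ | ih = cong suc ih
  ... | false | true | _ | _ | ih = cong suc ih
  ... | false | false | _ | inj₁ () | _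
  ... | false | false | _ | inj₂ () | _

  -- Extracts the row of a code: the X blocks met after the empty block form an initial segment, and
  -- `r` is its length.
  threshold : ∀ m (q : ℕ → Bool) → (∀ e → suc e < m → q (suc e) ≡ true → q e ≡ true) →
    ∃ λ r → r ≤ m × ∀ e → e < m → (q e ≡ true → e < r) × (e < r → q e ≡ true)
  threshold zero q mono = 0 , z≤n , λ e ()
  threshold (suc m) q mono with threshold m q (λ e p → mono e (m<n⇒m<1+n p)) | q m in eq
  ... | r , r≤m , spec | true = suc m , ≤-refl , λ e p → (λ _ → p) , (λ _ → full m ≤-refl eq e (≤-pred p))
    where
    full : ∀ j → j < suc m → q j ≡ true → ∀ e → e ≤ j → q e ≡ true
    full zero p h zero z≤n = h
    full (suc j) p h e e≤ with e ≟ suc j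
    ... | yes refl = h
    ... | no ne = full j (<-trans (n<1+n j) p) (mono j p h) e (≤-pred (≤∧≢⇒< e≤ ne))
  ... | r , r≤m , spec | false = r , m≤n⇒m≤1+n r≤m , λ e p → below e p , above e p
    where
    below : ∀ e → e < suc m → q e ≡ true → e < r
    below e p h with e ≟ m
    ... | yes refl = ⊥-elim (case trans (sym h) eq of λ ())
    ... | no ne = proj₁ (spec e (≤∧≢⇒< (≤-pred p) ne)) h
    above : ∀ e → e < suc m → e < r → q e ≡ true
    above e p e<r = proj₂ (spec e (<-≤-trans e<r r≤m)) e<r

-- Codes of stable sets, and adjacency in terms of codes.

module Code where

  open import Data.Nat
  open import Data.Nat.Properties
  open import Data.Vec using ([])
  open Lia using (Exp; con; _:+_; Form; _:≤_; _:<_; _:≡_; _:∧_; _:∨_; _:⇒_; :¬_; ⟦_⟧; decide; lia)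

  -- The pair (s , r) with s , r ≤ n encodes the stable set whose block number n - s is empty and whose other blocks,
  -- read cyclically upwards from there, are r blocks X = {2k} followed by n - r blocks Y = {2k+1}.
  xForm yForm : ∀ {j} (n s r k : Exp j) → Form j
  xForm n s r k = (con 1 :+ n :≤ k :+ s :∧ k :+ s :< con 1 :+ n :+ r) :∨ (k :+ s :< n :∧ k :+ s :< r)
  yForm n s r k = (con 1 :+ n :+ r :≤ k :+ s) :∨ (k :+ s :< n :∧ r :≤ k :+ s)

  IsX IsY : (n s r k : ℕ) → Set
  IsX n s r k = ⟦ xForm (con n) (con s) (con r) (con k) ⟧ []
  IsY n s r k = ⟦ yForm (con n) (con s) (con r) (con k) ⟧ []

  isX? : ∀ n s r k → Dec (IsX n s r k)
  isX? n s r k = decide (xForm (con n) (con s) (con r) (con k)) []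

  isY? : ∀ n s r k → Dec (IsY n s r k)
  isY? n s r k = decide (yForm (con n) (con s) (con r) (con k)) []

  -- Block k is the e-th block (from 0) cyclically after the empty block.
  posForm : ∀ {j} (n s k e : Exp j) → Form j
  posForm n s k e = k :+ s :≡ con 1 :+ n :+ e :∨ k :+ s :≡ e

  Pos : (n s k e : ℕ) → Set
  Pos n s k e = ⟦ posForm (con n) (con s) (con k) (con e) ⟧ []

  position : (n s e : ℕ) → ℕ
  position n s e with suc e ≤? s
  ... | yes _ = suc n + e ∸ s
  ... | no _ = e ∸ s

  position-spec : ∀ n s e → s ≤ n → e < n → position n s e ≤ n × Pos n s (position n s e) e
  position-spec n s e s≤n e<n with suc e ≤? s
  ... | yes p = lia 4 (λ n s e k → k :+ s :≡ con 1 :+ n :+ e :⇒ con 1 :+ e :≤ s :⇒ k :≤ n :∧ posForm n s k e) refl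
        n s e (suc n + e ∸ s) (m∸n+n≡m (≤-trans s≤n (≤-trans (n≤1+n n) (m≤m+n (suc n) e)))) p
  ... | no p = lia 4 (λ n s e k → k :+ s :≡ e :⇒ e :< n :⇒ k :≤ n :∧ posForm n s k e) refl
        n s e (e ∸ s) (m∸n+n≡m (≤-pred (≰⇒> p))) e<n

  position-unique : ∀ n s k k′ e → k ≤ n → k′ ≤ n → e < n → Pos n s k e → Pos n s k′ e → k ≡ k′
  position-unique = lia 5 (λ n s k k′ e → k :≤ n :⇒ k′ :≤ n :⇒ e :< n :⇒ posForm n s k e :⇒ posForm n s k′ e :⇒ k :≡ k′) refl

  offset : ∀ n s k → k ≤ n → s ≤ n → k + s ≢ n → ∃ λ e → e < n × Pos n s k e
  offset n s k k≤n s≤n ne with suc n ≤? k + s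
  ... | yes p = let e = k + s ∸ suc n in
        e , lia 4 (λ n s k e → e :+ (con 1 :+ n) :≡ k :+ s :⇒ k :≤ n :⇒ s :≤ n :⇒ e :< n :∧ posForm n s k e) refl
          n s k e (m∸n+n≡m p) k≤n s≤n
  ... | no p = k + s , lia 3 (λ n s k → k :+ s :< con 1 :+ n :⇒ :¬ (k :+ s :≡ n) :⇒ k :+ s :< n :∧ posForm n s k (k :+ s)) refl
        n s k (≰⇒> p) ne

  pos-X : ∀ n s r k e → k ≤ n → s ≤ n → e < n → Pos n s k e → (IsX n s r k → e < r) × (e < r → IsX n s r k)
  pos-X = lia 5 (λ n s r k e → k :≤ n :⇒ s :≤ n :⇒ e :< n :⇒ posForm n s k e :⇒
    (xForm n s r k :⇒ e :< r) :∧ (e :< r :⇒ xForm n s r k)) refl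

  pos-Y : ∀ n s r k e → k ≤ n → s ≤ n → e < n → Pos n s k e → (IsY n s r k → r ≤ e) × (r ≤ e → IsY n s r k)
  pos-Y = lia 5 (λ n s r k e → k :≤ n :⇒ s :≤ n :⇒ e :< n :⇒ posForm n s k e :⇒
    (yForm n s r k :⇒ r :≤ e) :∧ (r :≤ e :⇒ yForm n s r k)) refl

  ¬X∧Y : ∀ n s r k → ¬ (IsX n s r k × IsY n s r k)
  ¬X∧Y = lia 4 (λ n s r k → :¬ (xForm n s r k :∧ yForm n s r k)) refl

  -- Read cyclically after the empty block, X blocks come before Y blocks, so passing from Y to X
  -- crosses the empty block. This excludes the adjacent elements 2k + 1 and 2k + 2.
  ¬Y∧X⁺ : ∀ n s r k → s ≤ n → r ≤ n → suc k ≤ n → ¬ (IsY n s r k × IsX n s r (suc k))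
  ¬Y∧X⁺ = lia 4 (λ n s r k → s :≤ n :⇒ r :≤ n :⇒ con 1 :+ k :≤ n :⇒ :¬ (yForm n s r k :∧ xForm n s r (con 1 :+ k))) refl

  ¬X₀∧Yₙ : ∀ n s r → s ≤ n → r ≤ n → ¬ (IsX n s r 0 × IsY n s r n)
  ¬X₀∧Yₙ = lia 3 (λ n s r → s :≤ n :⇒ r :≤ n :⇒ :¬ (xForm n s r (con 0) :∧ yForm n s r n)) refl

  empty-block : ∀ n s r k → k + s ≡ n → ¬ IsX n s r k × ¬ IsY n s r k
  empty-block = lia 4 (λ n s r k → k :+ s :≡ n :⇒ :¬ xForm n s r k :∧ :¬ yForm n s r k) refl

  nonempty-block : ∀ n s r k → ¬ IsX n s r k → ¬ IsY n s r k → k + s ≡ n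
  nonempty-block = lia 4 (λ n s r k → :¬ xForm n s r k :⇒ :¬ yForm n s r k :⇒ k :+ s :≡ n) refl

  predForm : ∀ {j} (n s s′ : Exp j) → Form j
  predForm n s s′ = con 1 :+ s :≡ s′ :∨ (s :≡ n :∧ s′ :≡ con 0)

  shiftForm : ∀ {j} (n x r₀ s₀ : Exp j) → Form j
  shiftForm n x r₀ s₀ = x :+ r₀ :≡ s₀ :∨ x :+ r₀ :≡ s₀ :+ (con 1 :+ n)

  -- A set disjoint from `(s₀ , r₀)` can only take Y in its X blocks, X in its Y blocks, and either
  -- element of its empty block. As Y may precede X only across an empty block, for 0 < r₀ < n the
  -- new empty block is the last X or the first Y block; with the two choices in the old empty block
  -- this gives the four sets of `adjRhomb`. For r₀ = 0 or r₀ = n only one letter is possible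
  -- outside the old empty block, and the new empty block can be anywhere.
  adjTop adjBot adjRhomb adjForm : ∀ {j} (n s₀ r₀ s r : Exp j) → Form j
  adjTop n s₀ r₀ s r = r₀ :≡ con 0 :∧ (r :≡ n :∨ (con 1 :+ r :≡ n :∧ predForm n s s₀))
  adjBot n s₀ r₀ s r = r₀ :≡ n :∧ (r :≡ con 0 :∨ (r :≡ con 1 :∧ predForm n s₀ s))
  adjRhomb n s₀ r₀ s r =
    con 1 :≤ r₀ :∧ r₀ :< n :∧
      ((shiftForm n s r₀ s₀ :∧ (r :+ r₀ :≡ n :∨ r :+ r₀ :≡ con 1 :+ n)) :∨
       (shiftForm n (con 1 :+ s) r₀ s₀ :∧ (r :+ r₀ :≡ n :∨ con 1 :+ r :+ r₀ :≡ n)))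
  adjForm n s₀ r₀ s r = adjTop n s₀ r₀ s r :∨ adjBot n s₀ r₀ s r :∨ adjRhomb n s₀ r₀ s r

  CodeAdj : (n s₀ r₀ s r : ℕ) → Set
  CodeAdj n s₀ r₀ s r = ⟦ adjForm (con n) (con s₀) (con r₀) (con s) (con r) ⟧ []

  DisjointAt : (n s₀ r₀ s r k : ℕ) → Set
  DisjointAt n s₀ r₀ s r k = ¬ (IsX n s₀ r₀ k × IsX n s r k) × ¬ (IsY n s₀ r₀ k × IsY n s r k)

  oppForm : ∀ {j} (r₀ r e e′ : Exp j) → Form j
  oppForm r₀ r e e′ = :¬ (e :< r₀ :∧ e′ :< r) :∧ :¬ (r₀ :≤ e :∧ r :≤ e′)

  Opp : (r₀ r e e′ : ℕ) → Set
  Opp r₀ r e e′ = ¬ (e < r₀ × e′ < r) × ¬ (r₀ ≤ e × r ≤ e′)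

  module _ (n s₀ r₀ s r : ℕ) (s₀≤n : s₀ ≤ n) (r₀≤n : r₀ ≤ n) (s≤n : s ≤ n) (r≤n : r ≤ n) where

    opp⇒disjoint : ∀ k e e′ → k ≤ n → e < n → e′ < n → Pos n s₀ k e → Pos n s k e′ → Opp r₀ r e e′ → DisjointAt n s₀ r₀ s r k
    opp⇒disjoint k e e′ k≤n e<n e′<n p p′ (o , o′) =
      (λ (x , x′) → o (proj₁ (pos-X n s₀ r₀ k e k≤n s₀≤n e<n p) x , proj₁ (pos-X n s r k e′ k≤n s≤n e′<n p′) x′)) ,
      (λ (y , y′) → o′ (proj₁ (pos-Y n s₀ r₀ k e k≤n s₀≤n e<n p) y , proj₁ (pos-Y n s r k e′ k≤n s≤n e′<n p′) y′))

    disjoint⇒opp : ∀ k e e′ → k ≤ n → e < n → e′ < n → Pos n s₀ k e → Pos n s k e′ → DisjointAt n s₀ r₀ s r k → Opp r₀ r e e′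
    disjoint⇒opp k e e′ k≤n e<n e′<n p p′ (d , d′) =
      (λ (x , x′) → d (proj₂ (pos-X n s₀ r₀ k e k≤n s₀≤n e<n p) x , proj₂ (pos-X n s r k e′ k≤n s≤n e′<n p′) x′)) ,
      (λ (y , y′) → d′ (proj₂ (pos-Y n s₀ r₀ k e k≤n s₀≤n e<n p) y , proj₂ (pos-Y n s r k e′ k≤n s≤n e′<n p′) y′))

    adj⇒disjoint : 1 ≤ n → CodeAdj n s₀ r₀ s r → ∀ k → k ≤ n → DisjointAt n s₀ r₀ s r k
    adj⇒disjoint n≥1 adj k k≤n with k + s₀ ≟ n | k + s ≟ n
    ... | yes q | _ = (λ (x , _) → proj₁ (empty-block n s₀ r₀ k q) x) , (λ (y , _) → proj₂ (empty-block n s₀ r₀ k q) y)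
    ... | no _ | yes q = (λ (_ , x) → proj₁ (empty-block n s r k q) x) , (λ (_ , y) → proj₂ (empty-block n s r k q) y)
    ... | no q | no q′ with offset n s₀ k k≤n s₀≤n q | offset n s k k≤n s≤n q′
    ...   | e , e<n , p | e′ , e′<n , p′ = opp⇒disjoint k e e′ k≤n e<n e′<n p p′ (opposite adj)
      where
      opposite : CodeAdj n s₀ r₀ s r → Opp r₀ r e e′
      opposite (inj₁ a) =
        lia 8 (λ n s₀ r₀ s r k e e′ → s₀ :≤ n :⇒ r₀ :≤ n :⇒ s :≤ n :⇒ r :≤ n :⇒ k :≤ n :⇒ e :< n :⇒ e′ :< n :⇒
          posForm n s₀ k e :⇒ posForm n s k e′ :⇒ adjTop n s₀ r₀ s r :⇒ oppForm r₀ r e e′) refl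
          n s₀ r₀ s r k e e′ s₀≤n r₀≤n s≤n r≤n k≤n e<n e′<n p p′ a
      opposite (inj₂ (inj₁ a)) =
        lia 8 (λ n s₀ r₀ s r k e e′ → s₀ :≤ n :⇒ r₀ :≤ n :⇒ s :≤ n :⇒ r :≤ n :⇒ k :≤ n :⇒ e :< n :⇒ e′ :< n :⇒
          posForm n s₀ k e :⇒ posForm n s k e′ :⇒ adjBot n s₀ r₀ s r :⇒ oppForm r₀ r e e′) refl
          n s₀ r₀ s r k e e′ s₀≤n r₀≤n s≤n r≤n k≤n e<n e′<n p p′ a
      opposite (inj₂ (inj₂ a)) =
        lia 8 (λ n s₀ r₀ s r k e e′ → s₀ :≤ n :⇒ r₀ :≤ n :⇒ s :≤ n :⇒ r :≤ n :⇒ k :≤ n :⇒ e :< n :⇒ e′ :< n :⇒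
          posForm n s₀ k e :⇒ posForm n s k e′ :⇒ adjRhomb n s₀ r₀ s r :⇒ oppForm r₀ r e e′) refl
          n s₀ r₀ s r k e e′ s₀≤n r₀≤n s≤n r≤n k≤n e<n e′<n p p′ a

-- Disjoint stable sets have adjacent codes.

module Disjointness where

  open import Data.Nat
  open import Data.Nat.Properties
  open import Relation.Binary.Definitions using (tri<; tri≈; tri>)
  open Lia using (con; _:+_; _:≤_; _:<_; _:≡_; _:∧_; _:∨_; _:⇒_; lia)
  open Code

  module _ (n s₀ r₀ s r : ℕ) (n≥1 : 1 ≤ n) (s₀≤n : s₀ ≤ n) (r₀≤n : r₀ ≤ n) (s≤n : s ≤ n) (r≤n : r ≤ n)
    (disjoint : ∀ k → k ≤ n → DisjointAt n s₀ r₀ s r k) where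

    private
      -- E is the position of the empty block of (s , r) in the cyclic order that starts after the one of (s₀ , r₀).
      opp : ∀ E → (s + suc E ≡ s₀ ⊎ E + s ≡ s₀ + n) → s ≢ s₀ → E < n → ∀ e e′ → e < n → e′ < n →
        (E + suc e′ ≡ e ⊎ e + n ≡ E + e′) → Opp r₀ r e e′
      opp E h ne E<n e e′ e<n e′<n h′ with position-spec n s₀ e s₀≤n e<n
      ... | k≤n , p = disjoint⇒opp n s₀ r₀ s r s₀≤n r₀≤n s≤n r≤n k e e′ k≤n e<n e′<n p
        (lia 7 (λ n s₀ s E e e′ k → s :≤ n :⇒ s₀ :≤ n :⇒ k :≤ n :⇒ E :< n :⇒ e :< n :⇒ e′ :< n :⇒ posForm n s₀ k e :⇒
           (s :+ (con 1 :+ E) :≡ s₀ :∨ E :+ s :≡ s₀ :+ n) :⇒ (E :+ (con 1 :+ e′) :≡ e :∨ e :+ n :≡ E :+ e′) :⇒ posForm n s k e′) refl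
           n s₀ s E e e′ k s≤n s₀≤n k≤n E<n e<n e′<n p h h′)
        (disjoint k k≤n)
        where
        k = position n s₀ e

      same-opp : s ≡ s₀ → ∀ e → e < n → Opp r₀ r e e
      same-opp eq e e<n with position-spec n s₀ e s₀≤n e<n
      ... | k≤n , p = disjoint⇒opp n s₀ r₀ s r s₀≤n r₀≤n s≤n r≤n k e e k≤n e<n e<n p (subst (λ s → Pos n s k e) (sym eq) p) (disjoint k k≤n)
        where
        k = position n s₀ e

      -- Four blocks decide everything: those next to the two empty blocks, at offsets E + 1 and n -
      -- 1 (`after`), 0 and E - 1 (`before`). They pin `E` down to r₀ - 1 or r₀, unless `r₀` is 0 or
      -- `n`.
      shifted : ∀ E → (s + suc E ≡ s₀ ⊎ E + s ≡ s₀ + n) → s ≢ s₀ → E < n → CodeAdj n s₀ r₀ s r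
      shifted E h ne E<n = conclude h (suc E <? n) (1 ≤? E)
        where
        m = n ∸ 1
        d = m ∸ suc E
        u = E ∸ 1
        v = n ∸ E
        v-eq : v + E ≡ n
        v-eq = m∸n+n≡m (<⇒≤ E<n)
        v<n : 1 ≤ E → v < n
        v<n p = lia 3 (λ n E v → v :+ E :≡ n :⇒ con 1 :≤ E :⇒ v :< n) refl n E v v-eq p
        n≡1+m : n ≡ 1 + m
        n≡1+m = sym (m+[n∸m]≡n n≥1)
        m<n : m < n
        m<n = ≤-reflexive (sym n≡1+m)
        p′ : suc E < n → suc E ≤ m
        p′ p = ≤-pred (subst (suc E <_) n≡1+m p)
        u-eq : 1 ≤ E → u + n ≡ E + m
        u-eq p = lia 4 (λ n m E u → n :≡ con 1 :+ m :⇒ u :+ con 1 :≡ E :⇒ u :+ n :≡ E :+ m) refl n m E u n≡1+m (m∸n+n≡m p)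

        -- The blocks after, respectively before, the empty block of (s , r).
        after : suc E < n → (r ≡ 0 × r₀ ≡ n) ⊎ (r₀ ≤ suc E × n ≤ suc (r + E))
        after p = lia 6 (λ n r₀ r E m d → n :≡ con 1 :+ m :⇒ r₀ :≤ n :⇒ con 1 :+ E :< n :⇒ d :+ (con 1 :+ E) :≡ m :⇒
            oppForm r₀ r (con 1 :+ E) (con 0) :⇒ oppForm r₀ r m d :⇒
            (r :≡ con 0 :∧ r₀ :≡ n) :∨ (r₀ :≤ con 1 :+ E :∧ n :≤ con 1 :+ (r :+ E))) refl
          n r₀ r E m d n≡1+m r₀≤n p (m∸n+n≡m (p′ p))
          (opp E h ne E<n (suc E) 0 p n≥1 (inj₁ (+-comm E 1)))
          (opp E h ne E<n m d m<n (≤-<-trans (m∸n≤m m (suc E)) m<n) (inj₁ (trans (+-suc E d) (m+[n∸m]≡n (p′ p)))))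
        before : 1 ≤ E → (r₀ ≡ 0 × r ≡ n) ⊎ (E ≤ r₀ × r + E ≤ n)
        before p = lia 7 (λ n r₀ r E m u v → n :≡ con 1 :+ m :⇒ r :≤ n :⇒ con 1 :≤ E :⇒ E :< n :⇒ u :+ con 1 :≡ E :⇒ v :+ E :≡ n :⇒
            oppForm r₀ r (con 0) v :⇒ oppForm r₀ r u m :⇒
            (r₀ :≡ con 0 :∧ r :≡ n) :∨ (E :≤ r₀ :∧ r :+ E :≤ n)) refl
          n r₀ r E m u v n≡1+m r≤n p E<n (m∸n+n≡m p) v-eq
          (opp E h ne E<n 0 v n≥1 (v<n p) (inj₂ (trans (sym v-eq) (+-comm v E))))
          (opp E h ne E<n u m (≤-<-trans (m∸n≤m E 1) E<n) m<n (inj₂ (u-eq p)))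
        conclude : s + suc E ≡ s₀ ⊎ E + s ≡ s₀ + n → Dec (suc E < n) → Dec (1 ≤ E) → CodeAdj n s₀ r₀ s r
        conclude h (yes p) (yes q) with after p | before q
        ... | inj₁ (refl , refl) | _ = inj₂ (inj₁ (refl , inj₁ refl))
        ... | inj₂ _ | inj₁ (refl , refl) = inj₁ (refl , inj₁ refl)
        ... | inj₂ a | inj₂ b = inj₂ (inj₂ (lia 6 (λ n s₀ r₀ s r E → con 1 :+ E :< n :⇒ con 1 :≤ E :⇒
            (r₀ :≤ con 1 :+ E :∧ n :≤ con 1 :+ (r :+ E)) :⇒ (E :≤ r₀ :∧ r :+ E :≤ n) :⇒ 
            (s :+ (con 1 :+ E) :≡ s₀ :∨ E :+ s :≡ s₀ :+ n) :⇒ adjRhomb n s₀ r₀ s r) refl n s₀ r₀ s r E p q a b h))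
        conclude h (no p) (yes q) with before q
        ... | inj₁ (refl , refl) = inj₁ (refl , inj₁ refl)
        ... | inj₂ b = lia 6 (λ n s₀ r₀ s r E → s₀ :≤ n :⇒ r₀ :≤ n :⇒ s :≤ n :⇒ n :≤ con 1 :+ E :⇒ con 1 :≤ E :⇒ E :< n :⇒ (E :≤ r₀ :∧ r :+ E :≤ n) :⇒
            (s :+ (con 1 :+ E) :≡ s₀ :∨ E :+ s :≡ s₀ :+ n) :⇒ adjForm n s₀ r₀ s r) refl n s₀ r₀ s r E s₀≤n r₀≤n s≤n (≮⇒≥ p) q E<n b h
        conclude h (yes p) (no q) with after p
        ... | inj₁ (refl , refl) = inj₂ (inj₁ (refl , inj₁ refl))
        ... | inj₂ a = lia 6 (λ n s₀ r₀ s r E → s₀ :≤ n :⇒ r :≤ n :⇒ s :≤ n :⇒ E :< con 1 :⇒ con 1 :+ E :< n :⇒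
            (r₀ :≤ con 1 :+ E :∧ n :≤ con 1 :+ (r :+ E)) :⇒
            (s :+ (con 1 :+ E) :≡ s₀ :∨ E :+ s :≡ s₀ :+ n) :⇒ adjForm n s₀ r₀ s r) refl n s₀ r₀ s r E s₀≤n r≤n s≤n (≰⇒> q) p a h
        -- Now `n = 1` and no block is left to test: distinct singletons are disjoint.
        conclude h (no p) (no q) = lia 6 (λ n s₀ r₀ s r E → con 1 :≤ n :⇒ s₀ :≤ n :⇒ r₀ :≤ n :⇒ s :≤ n :⇒ r :≤ n :⇒ E :< con 1 :⇒ n :≤ con 1 :+ E :⇒
            (s :+ (con 1 :+ E) :≡ s₀ :∨ E :+ s :≡ s₀ :+ n) :⇒ adjForm n s₀ r₀ s r) refl n s₀ r₀ s r E n≥1 s₀≤n r₀≤n s≤n r≤n (≰⇒> q) (≮⇒≥ p) h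

    disjoint⇒adj : CodeAdj n s₀ r₀ s r
    disjoint⇒adj with <-cmp s s₀
    ... | tri< lt _ _ = shifted (s₀ ∸ suc s) (inj₁ (trans (+-suc s _) (m+[n∸m]≡n lt))) (<⇒≢ lt)
          (lia 4 (λ n s s₀ E → s :+ (con 1 :+ E) :≡ s₀ :⇒ s₀ :≤ n :⇒ E :< n) refl n s s₀ (s₀ ∸ suc s) (trans (+-suc s _) (m+[n∸m]≡n lt)) s₀≤n)
    ... | tri> _ ne gt = shifted (s₀ + n ∸ s) (inj₂ (m∸n+n≡m s≤s₀+n)) ne
          (lia 4 (λ n s s₀ E → E :+ s :≡ s₀ :+ n :⇒ s₀ :< s :⇒ E :< n) refl n s s₀ (s₀ + n ∸ s) (m∸n+n≡m s≤s₀+n) gt)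
      where
      s≤s₀+n = ≤-trans s≤n (m≤n+m n s₀)
    -- With the same empty block all other blocks must switch letter, and X stays in front of Y only
    -- if one letter is absent.
    ... | tri≈ _ eq _ with lia 4 (λ n r₀ r m → n :≡ con 1 :+ m :⇒ r₀ :≤ n :⇒ r :≤ n :⇒ oppForm r₀ r (con 0) (con 0) :⇒ oppForm r₀ r m m :⇒
        (r₀ :≡ con 0 :∧ r :≡ n) :∨ (r₀ :≡ n :∧ r :≡ con 0)) refl
        n r₀ r (n ∸ 1) n≡1+m r₀≤n r≤n (same-opp eq 0 n≥1) (same-opp eq (n ∸ 1) (≤-reflexive (sym n≡1+m)))
      where
      n≡1+m : n ≡ 1 + (n ∸ 1)
      n≡1+m = sym (m+[n∸m]≡n n≥1)
    ...   | inj₁ (e , e′) = inj₁ (e , inj₁ e′)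
    ...   | inj₂ (e , e′) = inj₂ (inj₁ (e , inj₁ e′))

-- Stable sets correspond to codes.

module StableSets where

  open import Data.Nat
  open import Data.Nat.Properties
  open import Data.Bool using (Bool; true; false)
  open import Data.Fin using (Fin; zero; suc; toℕ; fromℕ; fromℕ<; inject₁)
  open import Data.Fin.Properties using (toℕ-inject₁; toℕ-fromℕ; toℕ-fromℕ<; toℕ<n)
  open import Data.Fin.Subset using (Subset; _∩_; Empty)
  open import Data.Fin.Subset.Properties using (x∈p∩q⁺; x∈p∩q⁻)
  open import Data.Vec using (tabulate; []; _∷_)
  open import Data.Vec.Properties using (∷-injectiveʳ)
  open import Data.List using (List; []; _∷_; map; lookup)
  open import Data.List.Membership.Propositional renaming (_∈_ to _∈ₗ_)
  open import Data.List.Membership.Propositional.Properties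
  open import Data.List.Relation.Unary.Any as Any using (here)
  open import Data.List.Relation.Unary.Any.Properties using (lookup-index)
  open import Data.List.Relation.Unary.All as All using (All)
  open import Data.List.Relation.Unary.AllPairs using ([]; _∷_)
  open import Data.List.Relation.Unary.Unique.Propositional using (Unique)
  open import Data.List.Relation.Unary.Unique.Propositional.Properties using (map⁺; ++⁺; filter⁺)
  open import Function.Bundles using (_⇔_; mk⇔)
  open import Relation.Binary.Definitions using (tri<; tri≈; tri>)
  open Bits
  open Code
  open Disjointness
  open Lia using (con; _:+_; _:≤_; _:<_; _:≡_; _:∧_; _:∨_; _:⇒_; :¬_; lia)

  does⇒ : ∀ {P : Set} (d : Dec P) → does d ≡ true → P
  does⇒ (yes p) _ = p

  ⇒does : ∀ {P : Set} (d : Dec P) → P → does d ≡ true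
  ⇒does (yes _) _ = refl
  ⇒does (no ¬p) p = ⊥-elim (¬p p)

  does-≡ : ∀ {P : Set} (d : Dec P) b → (b ≡ true → P) → (P → b ≡ true) → b ≡ does d
  does-≡ (yes p) b f g = g p
  does-≡ (no ¬p) true f g = ⊥-elim (¬p (f refl))
  does-≡ (no ¬p) false f g = refl

  dbl≡2* : ∀ n → dbl n ≡ 2 * n
  dbl≡2* zero = refl
  dbl≡2* (suc n) = cong suc (trans (cong suc (dbl≡2* n)) (sym (+-suc n (n + 0))))

  ground : ∀ n → Ground n ≡ suc n * 2
  ground n = cong (λ m → suc (suc m)) (*-comm 2 n)

  module _ (n : ℕ) where

    HasCode : Subset (Ground n) → ℕ → ℕ → Set
    HasCode S s r = ∀ k → k ≤ n → Xb (at S) k ≡ does (isX? n s r k) × Yb (at S) k ≡ does (isY? n s r k)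

    ground-block : ∀ {k} → k ≤ n → suc (dbl k) < Ground n
    ground-block {k} p = subst (suc (dbl k) <_) (sym (ground n)) (dbl-< (s≤s p))

    block-ground : ∀ k → dbl k < Ground n → k ≤ n
    block-ground k p = ≤-pred (dbl-≤ k (suc n) (subst (dbl k <_) (ground n) p))

    module _ (S : Subset (Ground n)) (st : Stable n S) where
      private
        b = at S

      no-adjacent : ∀ j → b j ≡ true → b (suc j) ≡ true → ⊥
      no-adjacent j p q with at-bounded S (suc j) q
      ... | s≤s j< = proj₁ (proj₂ st) i
          (at⇒∈ S (inject₁ i) (trans (cong b (trans (toℕ-inject₁ i) (toℕ-fromℕ< j<))) p) ,
           at⇒∈ S (suc i) (trans (cong (b ∘ suc) (toℕ-fromℕ< j<)) q))
        where
        i = fromℕ< j<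

      not-both-ends : b 0 ≡ true → b (suc (dbl n)) ≡ true → ⊥
      not-both-ends p q = proj₂ (proj₂ st) (at⇒∈ S zero p ,
        at⇒∈ S (fromℕ (suc (2 * n))) (trans (cong b (trans (toℕ-fromℕ (suc (2 * n))) (cong suc (sym (dbl≡2* n))))) q))

      single : ∀ k → Single b k
      single k (p , q) = no-adjacent (dbl k) p q

      -- Counting leaves one block empty. On the way round the cycle from it, Y followed by X would
      -- be two adjacent elements, possibly the pair at the ends. So the X blocks are closed under
      -- stepping back, and `threshold` finds `r`.
      classify : ∃₂ λ s r → s ≤ n × r ≤ n × HasCode S s r
      classify with cnt-emptyAt n b (λ k _ → single k)
                      (trans (cong (cnt b) (sym (ground n))) (trans (sym (card≡cnt S)) (proj₁ st)))
      ... | a , a≤n , xa , ya , occ with threshold n q mono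
        where
        s = n ∸ a
        q : ℕ → Bool
        q e = Xb b (position n s e)
        s≤n = m∸n≤m n a
        a+s : a + s ≡ n
        a+s = m+[n∸m]≡n a≤n
        mono : ∀ e → suc e < n → q (suc e) ≡ true → q e ≡ true
        mono e e<n h with position-spec n s e s≤n (<-trans (n<1+n e) e<n) | position-spec n s (suc e) s≤n e<n
        ... | k≤n , p | k′≤n , p′ with occ (position n s e) k≤n
              (lia 5 (λ n s e k a → a :+ s :≡ n :⇒ k :≤ n :⇒ con 1 :+ e :< n :⇒ posForm n s k e :⇒ :¬ (k :≡ a)) refl
                n s e (position n s e) a a+s k≤n e<n p)
        ...   | inj₁ x = x
        ...   | inj₂ y with lia 5 (λ n s e k k′ → s :≤ n :⇒ k :≤ n :⇒ k′ :≤ n :⇒ con 1 :+ e :< n :⇒ posForm n s k e :⇒ posForm n s k′ (con 1 :+ e) :⇒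
                   k′ :≡ con 1 :+ k :∨ (k :≡ n :∧ k′ :≡ con 0)) refl
                   n s e (position n s e) (position n s (suc e)) s≤n k≤n k′≤n e<n p p′
        ...     | inj₁ eq = ⊥-elim (no-adjacent (suc (dbl (position n s e))) y (subst (λ k → b (dbl k) ≡ true) eq h))
        ...     | inj₂ (eq , eq′) = ⊥-elim (not-both-ends (subst (λ k → b (dbl k) ≡ true) eq′ h) (subst (λ k → b (suc (dbl k)) ≡ true) eq y))
      ... | r , r≤n , spec = s , r , s≤n , r≤n , code
        where
        s = n ∸ a
        s≤n = m∸n≤m n a
        a+s : a + s ≡ n
        a+s = m+[n∸m]≡n a≤n
        code : HasCode S s r
        code k k≤n with k + s ≟ n
        ... | yes eq with +-cancelʳ-≡ s k a (trans eq (sym a+s))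
        ...   | refl = does-≡ (isX? n s r k) _ (λ h → ⊥-elim (true≢false h xa)) (λ h → ⊥-elim (proj₁ (empty-block n s r k eq) h)) ,
                       does-≡ (isY? n s r k) _ (λ h → ⊥-elim (true≢false h ya)) (λ h → ⊥-elim (proj₂ (empty-block n s r k eq) h))
          where
          true≢false : ∀ {x} → x ≡ true → x ≡ false → ⊥
          true≢false refl ()
        code k k≤n | no ne with offset n s k k≤n s≤n ne
        ... | e , e<n , p =
          does-≡ (isX? n s r k) _ (λ h → proj₂ (pos-X n s r k e k≤n s≤n e<n p) (proj₁ (spec e e<n) (trans (cong (Xb b) pos≡k) h)))
                                  (λ h → trans (cong (Xb b) (sym pos≡k)) (proj₂ (spec e e<n) (proj₁ (pos-X n s r k e k≤n s≤n e<n p) h))) ,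
          does-≡ (isY? n s r k) _ (λ h → proj₂ (pos-Y n s r k e k≤n s≤n e<n p) (≮⇒≥ λ e<r → single k (trans (cong (Xb b) (sym pos≡k)) (proj₂ (spec e e<n) e<r) , h)))
                                  (λ h → y-true (proj₁ (pos-Y n s r k e k≤n s≤n e<n p) h))
          where
          pos≡k : position n s e ≡ k
          pos≡k with position-spec n s e s≤n e<n
          ... | k′≤n , p′ = position-unique n s (position n s e) k e k′≤n k≤n e<n p′ p
          y-true : r ≤ e → Yb b k ≡ true
          y-true r≤e with occ k k≤n (λ eq → ne (trans (cong (_+ s) eq) a+s))
          ... | inj₂ y = y
          ... | inj₁ x = ⊥-elim (≤⇒≯ r≤e (proj₁ (spec e e<n) (trans (cong (Xb b) pos≡k) x)))

    HasCode-X : ∀ {S s r k} → HasCode S s r → k ≤ n → (Xb (at S) k ≡ true → IsX n s r k) × (IsX n s r k → Xb (at S) k ≡ true)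
    HasCode-X {s = s} {r} {k} c k≤n = (λ h → does⇒ (isX? n s r k) (trans (sym (proj₁ (c k k≤n))) h)) , λ h → trans (proj₁ (c k k≤n)) (⇒does (isX? n s r k) h)

    HasCode-Y : ∀ {S s r k} → HasCode S s r → k ≤ n → (Yb (at S) k ≡ true → IsY n s r k) × (IsY n s r k → Yb (at S) k ≡ true)
    HasCode-Y {s = s} {r} {k} c k≤n = (λ h → does⇒ (isY? n s r k) (trans (sym (proj₂ (c k k≤n))) h)) , λ h → trans (proj₂ (c k k≤n)) (⇒does (isY? n s r k) h)

    HasCode-determines : ∀ {S S′ s r} → HasCode S s r → HasCode S′ s r → S ≡ S′
    HasCode-determines {S} {S′} c c′ = at-injective S S′ bits
      where
      bits : ∀ j → j < Ground n → at S j ≡ at S′ j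
      bits j j< with half j
      ... | even k = let k≤n = block-ground k j< in trans (proj₁ (c k k≤n)) (sym (proj₁ (c′ k k≤n)))
      ... | odd k = let k≤n = block-ground k (<-trans (n<1+n (dbl k)) j<) in trans (proj₂ (c k k≤n)) (sym (proj₂ (c′ k k≤n)))

    -- The empty block gives the column. If the rows differed, the block at the smaller row's offset
    -- would be X for one code and Y for the other.
    HasCode-unique : ∀ {S s r s′ r′} → s ≤ n → r ≤ n → s′ ≤ n → r′ ≤ n → HasCode S s r → HasCode S s′ r′ → s ≡ s′ × r ≡ r′
    HasCode-unique {S} {s} {r} {s′} {r′} s≤n r≤n s′≤n r′≤n c c′ = s≡s′ , r≡r′
      where
      k = n ∸ s
      k+s : k + s ≡ n
      k+s = m∸n+n≡m s≤n
      s≡s′ : s ≡ s′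
      s≡s′ = +-cancelˡ-≡ k s s′ (trans k+s (sym (nonempty-block n s′ r′ k
        (λ x → proj₁ (empty-block n s r k k+s) (proj₁ (HasCode-X {S} c (m∸n≤m n s)) (proj₂ (HasCode-X {S} c′ (m∸n≤m n s)) x)))
        (λ y → proj₂ (empty-block n s r k k+s) (proj₁ (HasCode-Y {S} c (m∸n≤m n s)) (proj₂ (HasCode-Y {S} c′ (m∸n≤m n s)) y))))))
      separate : ∀ {s s′ r r′} → s ≡ s′ → s ≤ n → r′ ≤ n → HasCode S s r → HasCode S s′ r′ → ¬ r < r′
      separate {s} {_} {r} {r′} refl s≤n r′≤n c c′ r<r′ with position-spec n s r s≤n (<-≤-trans r<r′ r′≤n)
      ... | k≤n , p = <-irrefl refl (proj₁ (pos-X n s r _ r k≤n s≤n r<n p) (proj₁ (HasCode-X {S} c k≤n)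
            (proj₂ (HasCode-X {S} c′ k≤n) (proj₂ (pos-X n s r′ _ r k≤n s≤n r<n p) r<r′))))
        where
        r<n = <-≤-trans r<r′ r′≤n
      r≡r′ : r ≡ r′
      r≡r′ with <-cmp r r′
      ... | tri< lt _ _ = ⊥-elim (separate s≡s′ s≤n r′≤n c c′ lt)
      ... | tri≈ _ eq _ = eq
      ... | tri> _ _ gt = ⊥-elim (separate (sym s≡s′) s′≤n r≤n c′ c gt)

    encodeBit : ℕ → ℕ → ℕ → Bool
    encodeBit s r = interleave (λ k → does (isX? n s r k)) (λ k → does (isY? n s r k))

    encode : ℕ → ℕ → Subset (Ground n)
    encode s r = tabulate (encodeBit s r ∘ toℕ)

    encode-code : ∀ s r → HasCode (encode s r) s r
    encode-code s r k k≤n =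
      trans (at-tabulate (Ground n) (encodeBit s r) (dbl k) (<-trans (n<1+n (dbl k)) (ground-block k≤n))) (interleave-even _ _ k) ,
      trans (at-tabulate (Ground n) (encodeBit s r) (suc (dbl k)) (ground-block k≤n)) (interleave-odd _ _ k)

    module _ (s r : ℕ) (s≤n : s ≤ n) (r≤n : r ≤ n) where
      private
        S = encode s r
        c : HasCode S s r
        c = encode-code s r

      encode-single : ∀ k → k ≤ n → Single (at S) k
      encode-single k k≤n (x , y) = ¬X∧Y n s r k (proj₁ (HasCode-X {S} c k≤n) x , proj₁ (HasCode-Y {S} c k≤n) y)

      encode-empty : EmptyAt (at S) n (n ∸ s)
      encode-empty = m∸n≤m n s ,
        sym (does-≡-false (isX? n s r (n ∸ s)) (proj₁ (c (n ∸ s) (m∸n≤m n s))) (proj₁ (empty-block n s r (n ∸ s) (m∸n+n≡m s≤n)))) ,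
        sym (does-≡-false (isY? n s r (n ∸ s)) (proj₂ (c (n ∸ s) (m∸n≤m n s))) (proj₂ (empty-block n s r (n ∸ s) (m∸n+n≡m s≤n)))) ,
        occupied
        where
        does-≡-false : ∀ {P : Set} {b} (d : Dec P) → b ≡ does d → ¬ P → false ≡ b
        does-≡-false (yes p) e ¬p = ⊥-elim (¬p p)
        does-≡-false (no _) e ¬p = sym e
        occupied : ∀ k → k ≤ n → k ≢ n ∸ s → Occupied (at S) k
        occupied k k≤n ne with isX? n s r k | isY? n s r k
        ... | yes x | _ = inj₁ (proj₂ (HasCode-X {S} c k≤n) x)
        ... | no _ | yes y = inj₂ (proj₂ (HasCode-Y {S} c k≤n) y)
        ... | no ¬x | no ¬y = ⊥-elim (ne (+-cancelʳ-≡ s k (n ∸ s) (trans (nonempty-block n s r k ¬x ¬y) (sym (m∸n+n≡m s≤n)))))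

      encode-no-adjacent : ∀ j → suc j < Ground n → at S j ≡ true → at S (suc j) ≡ true → ⊥
      encode-no-adjacent j j< p q with half j
      ... | even k = encode-single k (block-ground k (<-trans (n<1+n (dbl k)) j<)) (p , q)
      ... | odd k = ¬Y∧X⁺ n s r k s≤n r≤n (block-ground (suc k) j<)
            (proj₁ (HasCode-Y {S} c (block-ground k (<-trans (n<1+n (dbl k)) (<-trans (n<1+n (suc (dbl k))) j<)))) p ,
             proj₁ (HasCode-X {S} c (block-ground (suc k) j<)) q)

      encode-stable : Stable n S
      encode-stable =
        trans (card≡cnt S) (trans (cong (cnt (at S)) (ground n)) (emptyAt-cnt n (at S) (n ∸ s) encode-single encode-empty)) ,
        (λ i (p , q) → encode-no-adjacent (toℕ i) (s≤s (toℕ<n i)) (trans (cong (at S) (sym (toℕ-inject₁ i))) (∈⇒at p)) (∈⇒at q)) ,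
        (λ (p , q) → ¬X₀∧Yₙ n s r s≤n r≤n (proj₁ (HasCode-X {S} c z≤n) (∈⇒at p) ,
          proj₁ (HasCode-Y {S} c ≤-refl) (trans (cong (at S) (trans (cong suc (dbl≡2* n)) (sym (toℕ-fromℕ (suc (2 * n)))))) (∈⇒at q))))

    disjoint⇔ : ∀ {S S′ s r s′ r′} → HasCode S s r → HasCode S′ s′ r′ → Empty (S ∩ S′) ⇔ (∀ k → k ≤ n → DisjointAt n s r s′ r′ k)
    disjoint⇔ {S} {S′} {s} {r} {s′} {r′} c c′ = mk⇔ to from
      where
      meet : ∀ j → Empty (S ∩ S′) → j < Ground n → at S j ≡ true → at S′ j ≡ true → ⊥
      meet j e j< p q = e (fromℕ< j< , x∈p∩q⁺ (at⇒∈ S _ (trans (cong (at S) (toℕ-fromℕ< j<)) p) , at⇒∈ S′ _ (trans (cong (at S′) (toℕ-fromℕ< j<)) q)))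
      to : Empty (S ∩ S′) → ∀ k → k ≤ n → DisjointAt n s r s′ r′ k
      to e k k≤n =
        (λ (x , x′) → meet (dbl k) e (<-trans (n<1+n (dbl k)) (ground-block k≤n)) (proj₂ (HasCode-X {S} c k≤n) x) (proj₂ (HasCode-X {S′} c′ k≤n) x′)) ,
        (λ (y , y′) → meet (suc (dbl k)) e (ground-block k≤n) (proj₂ (HasCode-Y {S} c k≤n) y) (proj₂ (HasCode-Y {S′} c′ k≤n) y′))
      apart : ∀ j → j < Ground n → (∀ k → k ≤ n → DisjointAt n s r s′ r′ k) → at S j ≡ true → at S′ j ≡ true → ⊥
      apart j j< d p q with half j
      ... | even k = let k≤n = block-ground k j< in
            proj₁ (d k k≤n) (proj₁ (HasCode-X {S} c k≤n) p , proj₁ (HasCode-X {S′} c′ k≤n) q)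
      ... | odd k = let k≤n = block-ground k (<-trans (n<1+n (dbl k)) j<) in
            proj₂ (d k k≤n) (proj₁ (HasCode-Y {S} c k≤n) p , proj₁ (HasCode-Y {S′} c′ k≤n) q)
      from : (∀ k → k ≤ n → DisjointAt n s r s′ r′ k) → Empty (S ∩ S′)
      from d (i , i∈) with x∈p∩q⁻ S S′ i∈
      ... | p , q = apart (toℕ i) (toℕ<n i) d (∈⇒at p) (∈⇒at q)

  ∈-allSubsets : ∀ {m} (S : Subset m) → S ∈ₗ allSubsets m
  ∈-allSubsets [] = here refl
  ∈-allSubsets {suc m} (false ∷ S) = ∈-++⁺ˡ (∈-map⁺ (false ∷_) (∈-allSubsets S))
  ∈-allSubsets {suc m} (true ∷ S) = ∈-++⁺ʳ (map (false ∷_) (allSubsets m)) (∈-map⁺ (true ∷_) (∈-allSubsets S))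

  -- Without repetitions in the vertex list an index is determined by its set, as `code-injective`
  -- requires.
  allSubsets-unique : ∀ m → Unique (allSubsets m)
  allSubsets-unique zero = All.[] ∷ []
  allSubsets-unique (suc m) = ++⁺ (map⁺ ∷-injectiveʳ (allSubsets-unique m)) (map⁺ ∷-injectiveʳ (allSubsets-unique m)) disjoint
    where
    disjoint : ∀ {S} → ¬ (S ∈ₗ map (false ∷_) (allSubsets m) × S ∈ₗ map (true ∷_) (allSubsets m))
    disjoint (p , q) with ∈-map⁻ (false ∷_) p | ∈-map⁻ (true ∷_) q
    ... | _ , _ , refl | _ , _ , ()

  lookup-injective : ∀ {A : Set} {xs : List A} → Unique xs → ∀ i j → lookup xs i ≡ lookup xs j → i ≡ j
  lookup-injective (_ ∷ _) zero zero e = refl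
  lookup-injective {xs = x ∷ xs} (p ∷ _) zero (suc j) e = ⊥-elim (All.lookup p (∈-lookup {xs = xs} j) e)
  lookup-injective {xs = x ∷ xs} (p ∷ _) (suc i) zero e = ⊥-elim (All.lookup p (∈-lookup {xs = xs} i) (sym e))
  lookup-injective (_ ∷ u) (suc i) (suc j) e = cong suc (lookup-injective u i j e)

  module Coding (n : ℕ) (n≥1 : 1 ≤ n) where

    vertex-stable : ∀ v → Stable n (SGvertex n v)
    vertex-stable v = proj₂ (∈-filter⁻ (stable? n) {xs = allSubsets (Ground n)} (∈-lookup v))

    col row : Fin (SGsize n) → ℕ
    col v = proj₁ (classify n (SGvertex n v) (vertex-stable v))
    row v = proj₁ (proj₂ (classify n (SGvertex n v) (vertex-stable v)))

    col≤n : ∀ v → col v ≤ n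
    col≤n v = proj₁ (proj₂ (proj₂ (classify n (SGvertex n v) (vertex-stable v))))

    row≤n : ∀ v → row v ≤ n
    row≤n v = proj₁ (proj₂ (proj₂ (proj₂ (classify n (SGvertex n v) (vertex-stable v)))))

    hasCode : ∀ v → HasCode n (SGvertex n v) (col v) (row v)
    hasCode v = proj₂ (proj₂ (proj₂ (proj₂ (classify n (SGvertex n v) (vertex-stable v)))))

    code-injective : ∀ u v → col u ≡ col v → row u ≡ row v → u ≡ v
    code-injective u v p q = lookup-injective (filter⁺ (stable? n) (allSubsets-unique (Ground n))) u v
      (HasCode-determines n (hasCode u) (subst₂ (HasCode n (SGvertex n v)) (sym p) (sym q) (hasCode v)))

    code-surjective : ∀ s r → s ≤ n → r ≤ n → ∃ λ v → col v ≡ s × row v ≡ r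
    code-surjective s r s≤n r≤n = v ,
      HasCode-unique n {S = SGvertex n v} (col≤n v) (row≤n v) s≤n r≤n (hasCode v) (subst (λ S → HasCode n S s r) (lookup-index i) (encode-code n s r))
      where
      i : encode n s r ∈ₗ SGVertices n
      i = ∈-filter⁺ (stable? n) (∈-allSubsets (encode n s r)) (encode-stable n s r s≤n r≤n)
      v = Any.index i

    adj⇔ : ∀ u v → SGAdj n u v ⇔ CodeAdj n (col v) (row v) (col u) (row u)
    adj⇔ u v = mk⇔
      (λ e → disjoint⇒adj n (col v) (row v) (col u) (row u) n≥1 (col≤n v) (row≤n v) (col≤n u) (row≤n u)
        (λ k p → swap-disjoint k (to (disjoint⇔ n (hasCode u) (hasCode v)) e k p)))
      (λ a → from (disjoint⇔ n (hasCode u) (hasCode v)) λ k p →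
        swap-disjoint′ k (adj⇒disjoint n (col v) (row v) (col u) (row u) (col≤n v) (row≤n v) (col≤n u) (row≤n u) n≥1 a k p))
      where
      open Function.Bundles.Equivalence using (to; from)
      swap-disjoint : ∀ k → DisjointAt n (col u) (row u) (col v) (row v) k → DisjointAt n (col v) (row v) (col u) (row u) k
      swap-disjoint k (f , g) = f ∘ swap , g ∘ swap
      swap-disjoint′ : ∀ k → DisjointAt n (col v) (row v) (col u) (row u) k → DisjointAt n (col u) (row u) (col v) (row v) k
      swap-disjoint′ k (f , g) = f ∘ swap , g ∘ swap

-- Collapsing along a matching that toggles one vertex.

module Toggling where

  open import Data.Nat using (ℕ; zero; suc)
  open import Data.Bool using (true; false)
  import Data.Bool.Properties as Bool
  open import Data.Fin using (Fin; zero; suc; _≟_)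
  open import Data.Fin.Subset using (Subset; _∈_; _∉_; _⊆_; _⊂_; _∪_; ⁅_⁆; _-_)
  open import Data.Fin.Subset.Properties
  open import Data.Vec using ([]; _∷_)
  open import Data.Vec.Base using (here; there)
  open import Data.Vec.Properties using (≡-dec; ∷-injectiveʳ)
  open import Data.List using (List; []; _∷_; _++_; map)
  open import Data.List.Membership.Propositional renaming (_∈_ to _∈ₗ_; _∉_ to _∉ₗ_)
  open import Data.List.Membership.Propositional.Properties using (∈-++⁺ˡ; ∈-++⁺ʳ; ∈-map⁺; ∈-map⁻)
  open import Data.List.Relation.Unary.Any using (here; there)
  open import Data.List.Relation.Unary.All as All using (All; []; _∷_)
  open import Data.List.Relation.Unary.AllPairs as AllPairs using (AllPairs; []; _∷_)
  import Data.List.Relation.Unary.AllPairs.Properties as AllPairsₚ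
  open import Function using (case_of_)
  open import Function.Bundles using (_⇔_; mk⇔; Equivalence)

  private
    variable
      N : ℕ
      K L M : Complex N

  -- Complexes are predicates, compared only up to pointwise equivalence, so collapses have to be
  -- transported along such equivalences.
  collapses-resp : (∀ ρ → K ρ ⇔ L ρ) → Collapses L M → Collapses K M
  collapses-resp e (done h) = done λ ρ → mk⇔ (Equivalence.to (h ρ) ∘ Equivalence.to (e ρ)) (Equivalence.from (e ρ) ∘ Equivalence.from (h ρ))
  collapses-resp e (step K′ c cs) = step K′ record
    { σ = σ ; τ = τ ; σ⊂τ = σ⊂τ
    ; σ∈K = Equivalence.from (e σ) σ∈K
    ; τ∈K = Equivalence.from (e τ) τ∈K
    ; free = λ ρ p → free ρ (Equivalence.to (e ρ) p)
    ; rest = λ ρ → mk⇔ (map₁ (Equivalence.from (e ρ)) ∘ Equivalence.to (rest ρ)) (Equivalence.from (rest ρ) ∘ map₁ (Equivalence.to (e ρ)))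
    } cs
    where open ElemCollapse c

  collapses-trans : Collapses K L → Collapses L M → Collapses K M
  collapses-trans (done h) d = collapses-resp h d
  collapses-trans (step K′ c cs) d = step K′ c (collapses-trans cs d)

  -- All subsets, in an order in which supersets come first.
  descending : ∀ N → List (Subset N)
  descending zero = [] ∷ []
  descending (suc N) = map (true ∷_) (descending N) ++ map (false ∷_) (descending N)

  ∈-descending : (S : Subset N) → S ∈ₗ descending N
  ∈-descending [] = here refl
  ∈-descending (true ∷ S) = ∈-++⁺ˡ (∈-map⁺ (true ∷_) (∈-descending S))
  ∈-descending {suc N} (false ∷ S) = ∈-++⁺ʳ (map (true ∷_) (descending N)) (∈-map⁺ (false ∷_) (∈-descending S))

  private
    Earlier : Subset N → Subset N → Set
    Earlier S T = S ≢ T × ¬ S ⊂ T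

  descending-sorted : ∀ N → AllPairs Earlier (descending N)
  descending-sorted zero = [] ∷ []
  descending-sorted (suc N) = AllPairsₚ.++⁺ (blocks true) (blocks false) (All.tabulate λ p → All.tabulate λ q → across p q)
    where
    drop-⊂ : ∀ {N} b {S T : Subset N} → (b ∷ S) ⊂ (b ∷ T) → S ⊂ T
    drop-⊂ b (s⊆ , zero , here , x∉) = ⊥-elim (x∉ here)
    drop-⊂ b (s⊆ , suc x , there x∈ , x∉) = drop-∷-⊆ s⊆ , x , x∈ , λ h → x∉ (there h)
    blocks : ∀ b → AllPairs Earlier (map (b ∷_) (descending N))
    blocks b = AllPairsₚ.map⁺ (AllPairs.map (λ (ne , h) → ne ∘ ∷-injectiveʳ , h ∘ drop-⊂ b) (descending-sorted N))
    across : ∀ {S T} → S ∈ₗ map (true ∷_) (descending N) → T ∈ₗ map (false ∷_) (descending N) → Earlier S T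
    across p q with ∈-map⁻ (true ∷_) p | ∈-map⁻ (false ∷_) q
    ... | _ , _ , refl | _ , _ , refl = (λ ()) , λ (s⊆ , _) → case s⊆ here of λ ()

  _≟ₛ_ : (S T : Subset N) → Dec (S ≡ T)
  _≟ₛ_ = ≡-dec Bool._≟_

  ⊆-≢⇒⊂ : {S T : Subset N} → S ⊆ T → S ≢ T → S ⊂ T
  ⊆-≢⇒⊂ {S = S} {T} s⊆ ne with S ⊂? T
  ... | yes h = h
  ... | no h = ⊥-elim (ne (⊆-antisym s⊆ back))
    where
    back : T ⊆ S
    back {x} x∈T with x ∈? S
    ... | yes p = p
    ... | no p = ⊥-elim (h (s⊆ , x , x∈T , p))

  ∉-remove : {w : Fin N} (F : Subset N) → w ∉ F - w
  ∉-remove {w = zero} (true ∷ F) ()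
  ∉-remove {w = zero} (false ∷ F) ()
  ∉-remove {w = suc w} (b ∷ F) (there h) = ∉-remove F h

  module _ {w : Fin N} where

    remove-⊆ : (F : Subset N) → F - w ⊆ F
    remove-⊆ F = p─q⊆p F ⁅ w ⁆

    remove-keeps : (F : Subset N) → ∀ {x} → x ∈ F → x ≢ w → x ∈ F - w
    remove-keeps F p ne = x∈p∧x≢y⇒x∈p-y p ne

    ∪-remove : (F : Subset N) → w ∈ F → (F - w) ∪ ⁅ w ⁆ ≡ F
    ∪-remove F w∈F = ⊆-antisym to from
      where
      to : (F - w) ∪ ⁅ w ⁆ ⊆ F
      to x∈ with x∈p∪q⁻ (F - w) ⁅ w ⁆ x∈
      ... | inj₁ h = remove-⊆ F h
      ... | inj₂ h = subst (_∈ F) (sym (x∈⁅y⁆⇒x≡y w h)) w∈F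
      from : F ⊆ (F - w) ∪ ⁅ w ⁆
      from {x} x∈ with x ≟ w
      ... | yes refl = x∈p∪q⁺ (inj₂ (x∈⁅x⁆ w))
      ... | no ne = x∈p∪q⁺ (inj₁ (remove-keeps F x∈ ne))

    remove-absent : (F : Subset N) → w ∉ F → F - w ≡ F
    remove-absent F w∉F = ⊆-antisym (remove-⊆ F) λ {x} x∈ → remove-keeps F x∈ λ { refl → w∉F x∈ }

    remove-∪ : (F : Subset N) → w ∉ F → (F ∪ ⁅ w ⁆) - w ≡ F
    remove-∪ F w∉F = ⊆-antisym to from
      where
      to : (F ∪ ⁅ w ⁆) - w ⊆ F
      to {x} x∈ with x∈p∪q⁻ F ⁅ w ⁆ (remove-⊆ (F ∪ ⁅ w ⁆) x∈)
      ... | inj₁ h = h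
      ... | inj₂ h = ⊥-elim (∉-remove (F ∪ ⁅ w ⁆) (subst (_∈ (F ∪ ⁅ w ⁆) - w) (x∈⁅y⁆⇒x≡y w h) x∈))
      from : F ⊆ (F ∪ ⁅ w ⁆) - w
      from {x} x∈ = remove-keeps (F ∪ ⁅ w ⁆) (x∈p∪q⁺ (inj₁ x∈)) λ { refl → w∉F x∈ }

  -- P F w means that the face F is to be removed, and that it is matched with the face obtained by toggling w.
  module _ {N : ℕ} (K : Complex N) (P : Subset N → Fin N → Set)
    (P? : ∀ F → Dec (∃ (P F)))
    (functional : ∀ {F w w′} → P F w → P F w′ → w ≡ w′)
    (upward : ∀ {F G w} → P F w → F ⊆ G → K G → P G w)
    (face : ∀ {F w} → P F w → K F)
    (without : ∀ {F w} → P F w → P (F - w) w)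
    (with-apex : ∀ {F w} → P F w → K (F ∪ ⁅ w ⁆))
    where

    private
      -- A pair is recorded under its lower face `F - w`, so its two faces disappear in the same
      -- step.
      Removed : List (Subset N) → Subset N → Set
      Removed pre F = ∃ λ w → P F w × F - w ∈ₗ pre

      Left : List (Subset N) → Complex N
      Left pre F = K F × ¬ Removed pre F

      Later : List (Subset N) → Set
      Later = AllPairs Earlier

      skip : ∀ pre F₀ → (∀ F w → P F w → F - w ≡ F₀ → ⊥) → ∀ F → Left pre F ⇔ Left (F₀ ∷ pre) F
      skip pre F₀ h F = mk⇔
        (λ (k , nr) → k , λ { (w , p , here e) → h F w p e ; (w , p , there i) → nr (w , p , i) })
        (λ (k , nr) → k , λ (w , p , i) → nr (w , p , there i))

      -- `F₀` is free because of the order: a remaining face `ρ` above it has the same apex by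
      -- `upward`. If `ρ - w` were larger than `F₀`, it would have been processed and `ρ` removed;
      -- so `ρ - w` is `F₀` and `ρ` is `F₀ ∪ ⁅ w ⁆`.
      collapse-pair : ∀ pre F₀ w → P F₀ w → w ∉ F₀ → F₀ ∉ₗ pre → (∀ G → F₀ ⊂ G → G ∈ₗ pre) →
        ElemCollapse (Left pre) (Left (F₀ ∷ pre))
      collapse-pair pre F₀ w p w∉ fresh supersets = record
        { σ = F₀
        ; τ = F₁
        ; σ⊂τ = F₀⊆F₁ , w , x∈p∪q⁺ (inj₂ (x∈⁅x⁆ w)) , w∉
        ; σ∈K = face p , λ (w′ , p′ , i) → fresh (subst (_∈ₗ pre) (trans (cong (F₀ -_) (functional p′ p)) (remove-absent F₀ w∉)) i)
        ; τ∈K = with-apex p , λ (w′ , p′ , i) → fresh (subst (_∈ₗ pre) (trans (cong (F₁ -_) (functional p′ p₁)) (remove-∪ F₀ w∉)) i)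
        ; free = free
        ; rest = λ F → mk⇔ (to F) (from F)
        }
        where
        F₁ = F₀ ∪ ⁅ w ⁆
        F₀⊆F₁ : F₀ ⊆ F₁
        F₀⊆F₁ x∈ = x∈p∪q⁺ (inj₁ x∈)
        p₁ : P F₁ w
        p₁ = upward p F₀⊆F₁ (with-apex p)
        free : ∀ ρ → Left pre ρ → F₀ ⊂ ρ → ρ ≡ F₁
        free ρ (k , nr) (s⊆ , x , x∈ , x∉) with (ρ - w) ≟ₛ F₀
        ... | no ne = ⊥-elim (nr (w , upward p s⊆ k , supersets (ρ - w) (⊆-≢⇒⊂ sub (ne ∘ sym))))
          where
          sub : F₀ ⊆ ρ - w
          sub {y} y∈ = remove-keeps ρ (s⊆ y∈) λ { refl → w∉ y∈ }
        ... | yes eq with w ∈? ρ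
        ...   | yes w∈ = trans (sym (∪-remove ρ w∈)) (cong (_∪ ⁅ w ⁆) eq)
        ...   | no w∉ρ = ⊥-elim (x∉ (subst (x ∈_) (trans (sym (remove-absent ρ w∉ρ)) eq) x∈))
        to : ∀ F → Left (F₀ ∷ pre) F → Left pre F × F ≢ F₀ × F ≢ F₁
        to F (k , nr) = (k , λ (w′ , p′ , i) → nr (w′ , p′ , there i)) ,
          (λ { refl → nr (w , p , here (remove-absent F₀ w∉)) }) , (λ { refl → nr (w , p₁ , here (remove-∪ F₀ w∉)) })
        from : ∀ F → Left pre F × F ≢ F₀ × F ≢ F₁ → Left (F₀ ∷ pre) F
        from F ((k , nr) , ne₀ , ne₁) = k , removed
          where
          removed : ¬ Removed (F₀ ∷ pre) F
          removed (w′ , p′ , there i) = nr (w′ , p′ , i)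
          removed (w′ , p′ , here eq) with functional (subst (λ F → P F w′) eq (without p′)) p
          ... | refl with w ∈? F
          ...   | yes w∈ = ne₁ (trans (sym (∪-remove F w∈)) (cong (_∪ ⁅ w ⁆) eq))
          ...   | no w∉F = ne₀ (trans (sym (remove-absent F w∉F)) eq)

      run : ∀ pre post → (∀ G → G ∈ₗ pre ⊎ G ∈ₗ post) → (∀ {G} → G ∈ₗ pre → G ∉ₗ post) → Later post →
        Collapses (Left pre) (λ F → K F × ¬ ∃ (P F))
      run pre [] all fresh later = done λ F → mk⇔
        (λ (k , nr) → k , λ (w , p) → nr (w , p , processed (F - w)))
        (λ (k , np) → k , λ (w , p , _) → np (w , p))
        where
        processed : ∀ G → G ∈ₗ pre
        processed G with all G
        ... | inj₁ i = i
      run pre (F₀ ∷ post) all fresh (first ∷ later) = go (P? F₀)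
        where
        all′ : ∀ G → G ∈ₗ (F₀ ∷ pre) ⊎ G ∈ₗ post
        all′ G with all G
        ... | inj₁ i = inj₁ (there i)
        ... | inj₂ (here e) = inj₁ (here e)
        ... | inj₂ (there i) = inj₂ i
        supersets : ∀ G → F₀ ⊂ G → G ∈ₗ pre
        supersets G lt with all G
        ... | inj₁ i = i
        ... | inj₂ (here refl) = ⊥-elim (⊂-irref refl lt)
        ... | inj₂ (there i) = ⊥-elim (proj₂ (All.lookup first i) lt)
        F₀∉post : F₀ ∉ₗ post
        F₀∉post i = proj₁ (All.lookup first i) refl
        rest : Collapses (Left (F₀ ∷ pre)) (λ F → K F × ¬ ∃ (P F))
        rest = run (F₀ ∷ pre) post all′ (λ { (here refl) → F₀∉post ; (there i) j → fresh i (there j) }) later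
        go : Dec (∃ (P F₀)) → Collapses (Left pre) (λ F → K F × ¬ ∃ (P F))
        go (no np) = collapses-resp (skip pre F₀ λ F w p e → np (w , subst (λ F → P F w) e (without p))) rest
        go (yes (w , p)) with w ∈? F₀
        ... | no w∉ = step (Left (F₀ ∷ pre)) (collapse-pair pre F₀ w p w∉ (λ i → fresh i (here refl)) supersets) rest
        -- An upper face of a pair: it goes when `F₀ - w` is processed, and no pair has it as its
        -- lower face.
        ... | yes w∈ = collapses-resp (skip pre F₀ λ F w′ p′ e → ∉-remove F (subst₂ _∈_ (functional p (subst (λ F → P F w′) e (without p′))) (sym e) w∈)) rest

    -- By `upward`, all faces of `K` above a removed face are removed with the same apex. This makes
    -- the matching acyclic in the sense of discrete Morse theory.
    toggle-collapse : Collapses K (λ F → K F × ¬ ∃ (P F))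
    toggle-collapse = collapses-resp (λ F → mk⇔ (λ k → k , λ { (_ , _ , ()) }) proj₁)
      (run [] (descending N) (λ G → inj₂ (∈-descending G)) (λ ()) (descending-sorted N))

-- Maximal faces of the neighborhood complex in coordinates.

module FacetCodes where

  open import Data.Nat
  open import Data.Nat.Properties
  open import Data.Vec using ([])
  open Lia using (Exp; con; _:+_; Form; _:≤_; _:<_; _:≡_; :⊥; _:∧_; _:∨_; _:⇒_; :¬_; ⟦_⟧; decide; lia)
  open Code using (predForm; adjTop; adjBot; adjRhomb; adjForm; CodeAdj)

  -- rhomb S C consists of (S , C), (S⁻ , C), (S , C + 1), (S⁻ , C - 1), where S⁻ is the cyclic predecessor of S;
  -- top u is row n with (u , n - 1), and bot u is row 0 with (u , 1).
  data Facet : Set where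
    rhomb : ℕ → ℕ → Facet
    top bot : ℕ → Facet

  rhombOk : ∀ {j} (n S C : Exp j) → Form j
  rhombOk n S C = con 1 :≤ C :∧ C :< n :∧ S :≤ n

  rhombIn : ∀ {j} (n S C s r : Exp j) → Form j
  rhombIn n S C s r = (s :≡ S :∧ (r :≡ C :∨ r :≡ con 1 :+ C)) :∨ (predForm n s S :∧ (r :≡ C :∨ con 1 :+ r :≡ C))

  topIn botIn : ∀ {j} (n u s r : Exp j) → Form j
  topIn n u s r = r :≡ n :∨ (s :≡ u :∧ con 1 :+ r :≡ n)
  botIn n u s r = r :≡ con 0 :∨ (s :≡ u :∧ r :≡ con 1)

  -- Edges of a facet that lie in no other facet; the triangles that are kept avoid them.
  rhombBad : ∀ {j} (n S C s r s′ r′ : Exp j) → Form j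
  rhombBad n S C s r s′ r′ =
    (con 1 :+ s :≡ S :∧ con 1 :+ r :≡ C :∧ s′ :≡ S :∧ r′ :≡ con 1 :+ C) :∨
    (S :≡ con 0 :∧ s :≡ con 0 :∧ r :≡ C :∧ s′ :≡ n :∧ r′ :≡ C)

  topBad botBad : ∀ {j} (n u s r s′ r′ : Exp j) → Form j
  topBad n u s r s′ r′ = s :≡ u :∧ con 1 :+ r :≡ n :∧ r′ :≡ n :∧ :¬ (s′ :≡ u :∨ predForm n u s′)
  botBad n u s r s′ r′ = s :≡ u :∧ r :≡ con 1 :∧ r′ :≡ con 0 :∧ :¬ (s′ :≡ u :∨ predForm n s′ u)

  -- Toggling must preserve bad pairs, so the apex lies in none of them. In a tetrahedron it is an
  -- end of the diagonal that is kept.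
  rhombApex topApex botApex : ∀ {j} (n S C s r : Exp j) → Form j
  rhombApex n S C s r = (con 1 :+ s :≡ S :∧ r :≡ C) :∨ (S :≡ con 0 :∧ s :≡ n :∧ con 1 :+ r :≡ C)
  topApex n u _ s r = s :≡ u :∧ r :≡ n
  botApex n u _ s r = s :≡ u :∧ r :≡ con 0

  -- The non-edges of the fans with centres (n , n) and (0 , 0) that triangulate the last and the first row.
  data Side : Set where
    hi lo : Side

  hiBad loBad : ∀ {j} (n s r s′ r′ : Exp j) → Form j
  hiBad n s r s′ r′ = r :≡ n :∧ r′ :≡ n :∧ con 2 :+ s :≤ s′ :∧ s′ :< n
  loBad n s r s′ r′ = r :≡ con 0 :∧ r′ :≡ con 0 :∧ con 2 :+ s :≤ s′ :∧ con 1 :≤ s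

  module _ (n : ℕ) where

    Ok : Facet → Set
    Ok (rhomb S C) = ⟦ rhombOk (con n) (con S) (con C) ⟧ []
    Ok (top u) = u ≤ n
    Ok (bot u) = u ≤ n

    In : Facet → ℕ → ℕ → Set
    In (rhomb S C) s r = ⟦ rhombIn (con n) (con S) (con C) (con s) (con r) ⟧ []
    In (top u) s r = ⟦ topIn (con n) (con u) (con s) (con r) ⟧ []
    In (bot u) s r = ⟦ botIn (con n) (con u) (con s) (con r) ⟧ []

    Bad : Facet → ℕ → ℕ → ℕ → ℕ → Set
    Bad (rhomb S C) s r s′ r′ = ⟦ rhombBad (con n) (con S) (con C) (con s) (con r) (con s′) (con r′) ⟧ []
    Bad (top u) s r s′ r′ = ⟦ topBad (con n) (con u) (con s) (con r) (con s′) (con r′) ⟧ []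
    Bad (bot u) s r s′ r′ = ⟦ botBad (con n) (con u) (con s) (con r) (con s′) (con r′) ⟧ []

    IsApex : Facet → ℕ → ℕ → Set
    IsApex (rhomb S C) s r = ⟦ rhombApex (con n) (con S) (con C) (con s) (con r) ⟧ []
    IsApex (top u) s r = s ≡ u × r ≡ n
    IsApex (bot u) s r = s ≡ u × r ≡ 0

    SideBad : Side → ℕ → ℕ → ℕ → ℕ → Set
    SideBad hi s r s′ r′ = ⟦ hiBad (con n) (con s) (con r) (con s′) (con r′) ⟧ []
    SideBad lo s r s′ r′ = ⟦ loBad (con n) (con s) (con r) (con s′) (con r′) ⟧ []

    edge : Side → ℕ
    edge hi = n
    edge lo = 0

    in? : ∀ φ s r → Dec (In φ s r)
    in? (rhomb S C) s r = decide (rhombIn (con n) (con S) (con C) (con s) (con r)) []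
    in? (top u) s r = decide (topIn (con n) (con u) (con s) (con r)) []
    in? (bot u) s r = decide (botIn (con n) (con u) (con s) (con r)) []

    bad? : ∀ φ s r s′ r′ → Dec (Bad φ s r s′ r′)
    bad? (rhomb S C) s r s′ r′ = decide (rhombBad (con n) (con S) (con C) (con s) (con r) (con s′) (con r′)) []
    bad? (top u) s r s′ r′ = decide (topBad (con n) (con u) (con s) (con r) (con s′) (con r′)) []
    bad? (bot u) s r s′ r′ = decide (botBad (con n) (con u) (con s) (con r) (con s′) (con r′)) []

    sideBad? : ∀ σ s r s′ r′ → Dec (SideBad σ s r s′ r′)
    sideBad? hi s r s′ r′ = decide (hiBad (con n) (con s) (con r) (con s′) (con r′)) []
    sideBad? lo s r s′ r′ = decide (loBad (con n) (con s) (con r) (con s′) (con r′)) []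

    module _ (n≥1 : 1 ≤ n) where

      -- This lets the facets be collapsed independently: a face with a bad pair has one facet above
      -- it, hence one apex, and the same holds for all larger faces.
      bad-facet-unique : ∀ φ φ′ s r s′ r′ → Ok φ → Ok φ′ → s ≤ n → r ≤ n → s′ ≤ n → r′ ≤ n →
        Bad φ s r s′ r′ → In φ′ s r → In φ′ s′ r′ → φ′ ≡ φ
      bad-facet-unique (rhomb S C) (rhomb S′ C′) s r s′ r′ o o′ a b c d (inj₁ e) f g with
        lia 9 (λ n S C S′ C′ s r s′ r′ → rhombOk n S C :⇒ rhombOk n S′ C′ :⇒
          (con 1 :+ s :≡ S :∧ con 1 :+ r :≡ C :∧ s′ :≡ S :∧ r′ :≡ con 1 :+ C) :⇒ rhombIn n S′ C′ s r :⇒ rhombIn n S′ C′ s′ r′ :⇒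
          S′ :≡ S :∧ C′ :≡ C) refl
          n S C S′ C′ s r s′ r′ o o′ e f g
      ... | refl , refl = refl
      bad-facet-unique (rhomb S C) (rhomb S′ C′) s r s′ r′ o o′ a b c d (inj₂ e) f g with
        lia 9 (λ n S C S′ C′ s r s′ r′ → rhombOk n S C :⇒ rhombOk n S′ C′ :⇒
          (S :≡ con 0 :∧ s :≡ con 0 :∧ r :≡ C :∧ s′ :≡ n :∧ r′ :≡ C) :⇒ rhombIn n S′ C′ s r :⇒ rhombIn n S′ C′ s′ r′ :⇒
          S′ :≡ S :∧ C′ :≡ C) refl
          n S C S′ C′ s r s′ r′ o o′ e f g
      ... | refl , refl = refl
      bad-facet-unique (rhomb S C) (top u) s r s′ r′ o o′ a b c d e f g = ⊥-elim (
        lia 8 (λ n S C u s r s′ r′ → rhombOk n S C :⇒ u :≤ n :⇒ s :≤ n :⇒ r :≤ n :⇒ s′ :≤ n :⇒ r′ :≤ n :⇒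
          rhombBad n S C s r s′ r′ :⇒ topIn n u s r :⇒ topIn n u s′ r′ :⇒ :⊥) refl
          n S C u s r s′ r′ o o′ a b c d e f g)
      bad-facet-unique (rhomb S C) (bot u) s r s′ r′ o o′ a b c d e f g = ⊥-elim (
        lia 8 (λ n S C u s r s′ r′ → rhombOk n S C :⇒ u :≤ n :⇒ s :≤ n :⇒ r :≤ n :⇒ s′ :≤ n :⇒ r′ :≤ n :⇒
          rhombBad n S C s r s′ r′ :⇒ botIn n u s r :⇒ botIn n u s′ r′ :⇒ :⊥) refl
          n S C u s r s′ r′ o o′ a b c d e f g)
      bad-facet-unique (top u) (rhomb S C) s r s′ r′ o o′ a b c d e f g = ⊥-elim (
        lia 8 (λ n S C u s r s′ r′ → rhombOk n S C :⇒ u :≤ n :⇒ s :≤ n :⇒ r :≤ n :⇒ s′ :≤ n :⇒ r′ :≤ n :⇒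
          topBad n u s r s′ r′ :⇒ rhombIn n S C s r :⇒ rhombIn n S C s′ r′ :⇒ :⊥) refl
          n S C u s r s′ r′ o′ o a b c d e f g)
      bad-facet-unique (bot u) (rhomb S C) s r s′ r′ o o′ a b c d e f g = ⊥-elim (
        lia 8 (λ n S C u s r s′ r′ → rhombOk n S C :⇒ u :≤ n :⇒ s :≤ n :⇒ r :≤ n :⇒ s′ :≤ n :⇒ r′ :≤ n :⇒
          botBad n u s r s′ r′ :⇒ rhombIn n S C s r :⇒ rhombIn n S C s′ r′ :⇒ :⊥) refl
          n S C u s r s′ r′ o′ o a b c d e f g)
      bad-facet-unique (top u) (top v) s r s′ r′ o o′ a b c d e f g = cong top
        (lia 7 (λ n u v s r s′ r′ → con 1 :≤ n :⇒ topBad n u s r s′ r′ :⇒ topIn n v s r :⇒ topIn n v s′ r′ :⇒ v :≡ u) refl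
          n u v s r s′ r′ n≥1 e f g)
      bad-facet-unique (bot u) (bot v) s r s′ r′ o o′ a b c d e f g = cong bot
        (lia 7 (λ n u v s r s′ r′ → con 1 :≤ n :⇒ botBad n u s r s′ r′ :⇒ botIn n v s r :⇒ botIn n v s′ r′ :⇒ v :≡ u) refl
          n u v s r s′ r′ n≥1 e f g)
      bad-facet-unique (top u) (bot v) s r s′ r′ o o′ a b c d e f g = ⊥-elim (
        lia 7 (λ n u v s r s′ r′ → con 1 :≤ n :⇒ u :≤ n :⇒ v :≤ n :⇒ s :≤ n :⇒ s′ :≤ n :⇒
          topBad n u s r s′ r′ :⇒ botIn n v s r :⇒ botIn n v s′ r′ :⇒ :⊥) refl
          n u v s r s′ r′ n≥1 o o′ a c e f g)
      bad-facet-unique (bot u) (top v) s r s′ r′ o o′ a b c d e f g = ⊥-elim (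
        lia 7 (λ n u v s r s′ r′ → con 1 :≤ n :⇒ u :≤ n :⇒ v :≤ n :⇒ s :≤ n :⇒ s′ :≤ n :⇒
          botBad n u s r s′ r′ :⇒ topIn n v s r :⇒ topIn n v s′ r′ :⇒ :⊥) refl
          n u v s r s′ r′ n≥1 o o′ a c e f g)

      bad-not-apex : ∀ φ s r s′ r′ x y → Ok φ → Bad φ s r s′ r′ → IsApex φ x y → ¬ (s ≡ x × r ≡ y) × ¬ (s′ ≡ x × r′ ≡ y)
      bad-not-apex (rhomb S C) s r s′ r′ x y o e f =
        lia 9 (λ n S C s r s′ r′ x y → rhombOk n S C :⇒ rhombBad n S C s r s′ r′ :⇒ rhombApex n S C x y :⇒
          :¬ (s :≡ x :∧ r :≡ y) :∧ :¬ (s′ :≡ x :∧ r′ :≡ y)) refl n S C s r s′ r′ x y o e f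
      bad-not-apex (top u) s r s′ r′ x y o e f =
        lia 8 (λ n u s r s′ r′ x y → topBad n u s r s′ r′ :⇒ topApex n u u x y :⇒
          :¬ (s :≡ x :∧ r :≡ y) :∧ :¬ (s′ :≡ x :∧ r′ :≡ y)) refl n u s r s′ r′ x y e f
      bad-not-apex (bot u) s r s′ r′ x y o e f =
        lia 8 (λ n u s r s′ r′ x y → botBad n u s r s′ r′ :⇒ botApex n u u x y :⇒
          :¬ (s :≡ x :∧ r :≡ y) :∧ :¬ (s′ :≡ x :∧ r′ :≡ y)) refl n u s r s′ r′ x y e f

      apex-unique : ∀ φ s r s′ r′ → IsApex φ s r → IsApex φ s′ r′ → s ≡ s′ × r ≡ r′
      apex-unique (rhomb S C) s r s′ r′ e f =
        lia 7 (λ n S C s r s′ r′ → rhombApex n S C s r :⇒ rhombApex n S C s′ r′ :⇒ s :≡ s′ :∧ r :≡ r′) refl n S C s r s′ r′ e f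
      apex-unique (top u) s r s′ r′ (refl , refl) (refl , refl) = refl , refl
      apex-unique (bot u) s r s′ r′ (refl , refl) (refl , refl) = refl , refl

      apex-in : ∀ φ s r → Ok φ → IsApex φ s r → In φ s r
      apex-in (rhomb S C) s r o e = lia 5 (λ n S C s r → rhombOk n S C :⇒ rhombApex n S C s r :⇒ rhombIn n S C s r) refl n S C s r o e
      apex-in (top u) s r o (_ , e) = inj₁ e
      apex-in (bot u) s r o (_ , e) = inj₁ e

      apex-exists : ∀ φ → Ok φ → ∃₂ λ s r → s ≤ n × r ≤ n × IsApex φ s r
      apex-exists (rhomb zero (suc C)) (_ , C<n , _) = n , C , ≤-refl , <⇒≤ (<-trans (n<1+n C) C<n) , inj₂ (refl , refl , refl)
      apex-exists (rhomb (suc S) C) (_ , C<n , S≤n) = S , C , <⇒≤ S≤n , <⇒≤ C<n , inj₁ (refl , refl)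
      apex-exists (top u) u≤n = u , n , u≤n , ≤-refl , refl , refl
      apex-exists (bot u) u≤n = u , 0 , u≤n , z≤n , refl , refl

      -- `top u` and `bot u` have one vertex outside the row, and its good partners in the row lie
      -- in two cyclically consecutive columns. A non-edge of the fan has columns at distance at
      -- least two and avoids the column of the centre, so one of its ends is a bad partner.
      side-bad-neighbour : ∀ σ φ s r s′ r′ x y → Ok φ → s ≤ n → s′ ≤ n → x ≤ n → SideBad σ s r s′ r′ →
        In φ s r → In φ s′ r′ → In φ x y → y ≡ edge σ ⊎ Bad φ x y s r ⊎ Bad φ x y s′ r′
      side-bad-neighbour hi (rhomb S C) s r s′ r′ x y o a b c d e f g = ⊥-elim (
        lia 7 (λ n S C s r s′ r′ → rhombOk n S C :⇒ s :≤ n :⇒ s′ :≤ n :⇒ hiBad n s r s′ r′ :⇒ rhombIn n S C s r :⇒ rhombIn n S C s′ r′ :⇒ :⊥) refl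
          n S C s r s′ r′ o a b d e f)
      side-bad-neighbour lo (rhomb S C) s r s′ r′ x y o a b c d e f g = ⊥-elim (
        lia 7 (λ n S C s r s′ r′ → rhombOk n S C :⇒ s :≤ n :⇒ s′ :≤ n :⇒ loBad n s r s′ r′ :⇒ rhombIn n S C s r :⇒ rhombIn n S C s′ r′ :⇒ :⊥) refl
          n S C s r s′ r′ o a b d e f)
      side-bad-neighbour hi (top u) s r s′ r′ x y o a b c d e f g =
        lia 8 (λ n u s r s′ r′ x y → u :≤ n :⇒ hiBad n s r s′ r′ :⇒ topIn n u x y :⇒ y :≡ n :∨ topBad n u x y s r :∨ topBad n u x y s′ r′) refl
          n u s r s′ r′ x y o d g
      side-bad-neighbour lo (bot u) s r s′ r′ x y o a b c d e f g =
        lia 8 (λ n u s r s′ r′ x y → u :≤ n :⇒ s′ :≤ n :⇒ loBad n s r s′ r′ :⇒ botIn n u x y :⇒ y :≡ con 0 :∨ botBad n u x y s r :∨ botBad n u x y s′ r′) refl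
          n u s r s′ r′ x y o b d g
      side-bad-neighbour hi (bot u) s r s′ r′ x y o a b c d e f g = ⊥-elim (
        lia 6 (λ n u s r s′ r′ → con 1 :≤ n :⇒ u :≤ n :⇒ hiBad n s r s′ r′ :⇒ botIn n u s r :⇒ botIn n u s′ r′ :⇒ :⊥) refl
          n u s r s′ r′ n≥1 o d e f)
      side-bad-neighbour lo (top u) s r s′ r′ x y o a b c d e f g = ⊥-elim (
        lia 6 (λ n u s r s′ r′ → con 1 :≤ n :⇒ u :≤ n :⇒ s′ :≤ n :⇒ loBad n s r s′ r′ :⇒ topIn n u s r :⇒ topIn n u s′ r′ :⇒ :⊥) refl
          n u s r s′ r′ n≥1 o b d e f)

      bad-not-in-edge : ∀ σ φ s r s′ r′ → Ok φ → Bad φ s r s′ r′ → r ≡ edge σ → r′ ≡ edge σ → ⊥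
      bad-not-in-edge hi (rhomb S C) s r s′ r′ o e = lia 7 (λ n S C s r s′ r′ → rhombOk n S C :⇒ rhombBad n S C s r s′ r′ :⇒ r :≡ n :⇒ r′ :≡ n :⇒ :⊥) refl n S C s r s′ r′ o e
      bad-not-in-edge lo (rhomb S C) s r s′ r′ o e = lia 7 (λ n S C s r s′ r′ → rhombOk n S C :⇒ rhombBad n S C s r s′ r′ :⇒ r :≡ con 0 :⇒ r′ :≡ con 0 :⇒ :⊥) refl n S C s r s′ r′ o e
      bad-not-in-edge σ (top u) s r s′ r′ o (_ , e , e′ , _) f g = 1+n≢n (trans e (trans (sym e′) (trans g (sym f))))
      bad-not-in-edge σ (bot u) s r s′ r′ o (_ , e , e′ , _) f g with trans (sym e) (trans f (trans (sym g) e′))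
      ... | ()

      side-bad-not-apex : ∀ σ s r s′ r′ → s ≤ n → SideBad σ s r s′ r′ → s ≢ edge σ × s′ ≢ edge σ
      side-bad-not-apex hi = lia 5 (λ n s r s′ r′ → s :≤ n :⇒ hiBad n s r s′ r′ :⇒ :¬ (s :≡ n) :∧ :¬ (s′ :≡ n)) refl n
      side-bad-not-apex lo = lia 5 (λ n s r s′ r′ → s :≤ n :⇒ loBad n s r s′ r′ :⇒ :¬ (s :≡ con 0) :∧ :¬ (s′ :≡ con 0)) refl n

      predecessor : ∀ s → s ≤ n → ∃ λ u → u ≤ n × (suc u ≡ s ⊎ (u ≡ n × s ≡ 0))
      predecessor zero _ = n , ≤-refl , inj₂ (refl , refl)
      predecessor (suc s) p = s , <⇒≤ p , inj₁ refl

      successor : ∀ s → s ≤ n → ∃ λ u → u ≤ n × (suc s ≡ u ⊎ (s ≡ n × u ≡ 0))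
      successor s p with s ≟ n
      ... | yes refl = 0 , z≤n , inj₂ (refl , refl)
      ... | no ne = suc s , ≤∧≢⇒< p ne , inj₁ refl

      interior : ∀ {s₀ r₀ s r} {P : Set} → r₀ ≢ 0 → r₀ ≢ n →
        (⟦ adjRhomb (con n) (con s₀) (con r₀) (con s) (con r) ⟧ [] → P) → CodeAdj n s₀ r₀ s r → P
      interior ne ne′ f (inj₁ (e , _)) = ⊥-elim (ne e)
      interior ne ne′ f (inj₂ (inj₁ (e , _))) = ⊥-elim (ne′ e)
      interior ne ne′ f (inj₂ (inj₂ a)) = f a

      -- The facet is the neighbourhood of `(s₀ , r₀)`. Row 0 gives `top` at the preceding column,
      -- row `n` gives `bot` at the following one, and any other row gives the rhombus with S = s₀ -
      -- r₀ modulo n + 1 and C = n - r₀.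
      adj⇒facet : ∀ s₀ r₀ → s₀ ≤ n → r₀ ≤ n → ∃ λ φ → Ok φ × (∀ s r → s ≤ n → r ≤ n → CodeAdj n s₀ r₀ s r → In φ s r)
      adj⇒facet s₀ r₀ s₀≤n r₀≤n with r₀ ≟ 0 | r₀ ≟ n
      ... | yes refl | _ with predecessor s₀ s₀≤n
      ...   | u , u≤n , p = top u , u≤n , λ s r s≤n r≤n → lia 5 (λ n s₀ u s r → con 1 :≤ n :⇒ s₀ :≤ n :⇒ s :≤ n :⇒ predForm n u s₀ :⇒
                adjForm n s₀ (con 0) s r :⇒ topIn n u s r) refl n s₀ u s r n≥1 s₀≤n s≤n p
      adj⇒facet s₀ r₀ s₀≤n r₀≤n | no _ | yes refl with successor s₀ s₀≤n
      ...   | u , u≤n , p = bot u , u≤n , λ s r s≤n r≤n → lia 5 (λ n s₀ u s r → con 1 :≤ n :⇒ u :≤ n :⇒ s :≤ n :⇒ predForm n s₀ u :⇒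
                adjForm n s₀ n s r :⇒ botIn n u s r) refl n s₀ u s r n≥1 u≤n s≤n p
      adj⇒facet s₀ r₀ s₀≤n r₀≤n | no ne | no ne′ with r₀ ≤? s₀
      ... | yes p = rhomb (s₀ ∸ r₀) (n ∸ r₀) ,
            lia 5 (λ n s₀ r₀ S C → s₀ :≤ n :⇒ r₀ :≤ n :⇒ :¬ (r₀ :≡ con 0) :⇒ :¬ (r₀ :≡ n) :⇒ S :+ r₀ :≡ s₀ :⇒ C :+ r₀ :≡ n :⇒ rhombOk n S C) refl
              n s₀ r₀ (s₀ ∸ r₀) (n ∸ r₀) s₀≤n r₀≤n ne ne′ (m∸n+n≡m p) (m∸n+n≡m r₀≤n) ,
            λ s r s≤n r≤n → interior ne ne′ λ e → lia 7 (λ n s₀ r₀ S C s r → s₀ :≤ n :⇒ S :+ r₀ :≡ s₀ :⇒ C :+ r₀ :≡ n :⇒ s :≤ n :⇒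
                adjRhomb n s₀ r₀ s r :⇒ rhombIn n S C s r) refl
              n s₀ r₀ (s₀ ∸ r₀) (n ∸ r₀) s r s₀≤n (m∸n+n≡m p) (m∸n+n≡m r₀≤n) s≤n e
      ... | no p = rhomb (s₀ + suc n ∸ r₀) (n ∸ r₀) ,
            lia 5 (λ n s₀ r₀ S C → s₀ :< r₀ :⇒ r₀ :≤ n :⇒ :¬ (r₀ :≡ con 0) :⇒ :¬ (r₀ :≡ n) :⇒ S :+ r₀ :≡ s₀ :+ (con 1 :+ n) :⇒ C :+ r₀ :≡ n :⇒ rhombOk n S C) refl
              n s₀ r₀ (s₀ + suc n ∸ r₀) (n ∸ r₀) (≰⇒> p) r₀≤n ne ne′ (m∸n+n≡m r₀≤) (m∸n+n≡m r₀≤n) ,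
            λ s r s≤n r≤n → interior ne ne′ λ e → lia 7 (λ n s₀ r₀ S C s r → s₀ :< r₀ :⇒ r₀ :≤ n :⇒ S :+ r₀ :≡ s₀ :+ (con 1 :+ n) :⇒ C :+ r₀ :≡ n :⇒ s :≤ n :⇒
                adjRhomb n s₀ r₀ s r :⇒ rhombIn n S C s r) refl
              n s₀ r₀ (s₀ + suc n ∸ r₀) (n ∸ r₀) s r (≰⇒> p) r₀≤n (m∸n+n≡m r₀≤) (m∸n+n≡m r₀≤n) s≤n e
        where
        r₀≤ : r₀ ≤ s₀ + suc n
        r₀≤ = ≤-trans r₀≤n (≤-trans (n≤1+n n) (m≤n+m (suc n) s₀))

      facet⇒adj : ∀ φ → Ok φ → ∃₂ λ s₀ r₀ → s₀ ≤ n × r₀ ≤ n × (∀ s r → s ≤ n → r ≤ n → In φ s r → CodeAdj n s₀ r₀ s r)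
      facet⇒adj (top u) u≤n with successor u u≤n
      ... | s₀ , s₀≤n , p = s₀ , 0 , s₀≤n , z≤n , λ s r s≤n r≤n e → inj₁
        (lia 5 (λ n s₀ u s r → predForm n u s₀ :⇒ topIn n u s r :⇒ adjTop n s₀ (con 0) s r) refl n s₀ u s r p e)
      facet⇒adj (bot u) u≤n with predecessor u u≤n
      ... | s₀ , s₀≤n , p = s₀ , n , s₀≤n , ≤-refl , λ s r s≤n r≤n e → inj₂ (inj₁
        (lia 5 (λ n s₀ u s r → predForm n s₀ u :⇒ botIn n u s r :⇒ adjBot n s₀ n s r) refl n s₀ u s r p e))
      facet⇒adj (rhomb S C) o@(1≤C , C<n , S≤n) with S + (n ∸ C) ≤? n
      ... | yes p = S + (n ∸ C) , n ∸ C , p , m∸n≤m n C , λ s r s≤n r≤n e → inj₂ (inj₂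
        (lia 6 (λ n r₀ S C s r → rhombOk n S C :⇒ r₀ :+ C :≡ n :⇒ rhombIn n S C s r :⇒ adjRhomb n (S :+ r₀) r₀ s r) refl
          n (n ∸ C) S C s r o (m∸n+n≡m (<⇒≤ C<n)) e))
      ... | no p = S + (n ∸ C) ∸ suc n , n ∸ C ,
        lia 5 (λ n r₀ S C s₀ → rhombOk n S C :⇒ r₀ :+ C :≡ n :⇒ s₀ :+ (con 1 :+ n) :≡ S :+ r₀ :⇒ s₀ :≤ n) refl
          n (n ∸ C) S C (S + (n ∸ C) ∸ suc n) o (m∸n+n≡m (<⇒≤ C<n)) (m∸n+n≡m (≰⇒> p)) ,
        m∸n≤m n C , λ s r s≤n r≤n e → inj₂ (inj₂
        (lia 7 (λ n r₀ S C s₀ s r → rhombOk n S C :⇒ r₀ :+ C :≡ n :⇒ s₀ :+ (con 1 :+ n) :≡ S :+ r₀ :⇒ rhombIn n S C s r :⇒ adjRhomb n s₀ r₀ s r) refl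
          n (n ∸ C) S C (S + (n ∸ C) ∸ suc n) s r o (m∸n+n≡m (<⇒≤ C<n)) (m∸n+n≡m (≰⇒> p)) e))

-- Order facts about the rationals.

module Rationals where

  open import Data.Rational
  open import Data.Rational.Properties
  open import Data.Rational.Solver using (module +-*-Solver)

  *-nonneg : ∀ {x y} → 0ℚ ≤ x → 0ℚ ≤ y → 0ℚ ≤ x * y
  *-nonneg {x} {y} p q = nonNegative⁻¹ (x * y) {{nonNeg*nonNeg⇒nonNeg x {{nonNegative p}} y {{nonNegative q}}}}

  *-pos : ∀ {x y} → 0ℚ < x → 0ℚ < y → 0ℚ < x * y
  *-pos {x} {y} p q = positive⁻¹ (x * y) {{pos*pos⇒pos x {{positive p}} y {{positive q}}}}

  +-nonneg : ∀ {x y} → 0ℚ ≤ x → 0ℚ ≤ y → 0ℚ ≤ x + y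
  +-nonneg p q = +-mono-≤ p q

  +-pos-nonneg : ∀ {x y} → 0ℚ < x → 0ℚ ≤ y → 0ℚ < x + y
  +-pos-nonneg p q = +-mono-<-≤ p q

  +-nonneg-pos : ∀ {x y} → 0ℚ ≤ x → 0ℚ < y → 0ℚ < x + y
  +-nonneg-pos p q = +-mono-≤-< p q

  <⇒sub : ∀ {x y} → x < y → 0ℚ < y - x
  <⇒sub {x} {y} p = subst (_< y - x) (+-inverseʳ x) (+-monoˡ-< (- x) p)

  sub⇒< : ∀ {x y} → 0ℚ < y - x → x < y
  sub⇒< {x} {y} p = subst₂ _<_ (+-identityˡ x) (solve 2 (λ x y → (y :- x) :+ x := y) refl x y) (+-monoˡ-< x p)
    where open +-*-Solver

  pos⇒≢ : ∀ {x} → 0ℚ < x → x ≢ 0ℚ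
  pos⇒≢ p refl = <-irrefl refl p

  nonneg∧≢⇒pos : ∀ {x} → 0ℚ ≤ x → x ≢ 0ℚ → 0ℚ < x
  nonneg∧≢⇒pos {x} p ne with 0ℚ <? x
  ... | yes q = q
  ... | no q = ⊥-elim (ne (≤-antisym (≮⇒≥ q) p))

  sum≡0ˡ : ∀ {x y} → 0ℚ ≤ x → 0ℚ ≤ y → x + y ≡ 0ℚ → x ≡ 0ℚ
  sum≡0ˡ {x} {y} p q e with x ≟ 0ℚ
  ... | yes z = z
  ... | no ne = ⊥-elim (pos⇒≢ (+-pos-nonneg (nonneg∧≢⇒pos p ne) q) e)

  sum≡0ʳ : ∀ {x y} → 0ℚ ≤ x → 0ℚ ≤ y → x + y ≡ 0ℚ → y ≡ 0ℚ
  sum≡0ʳ {x} {y} p q e = sum≡0ˡ q p (trans (+-comm y x) e)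

  reciprocal : ∀ c → 0ℚ < c → ∃ λ d → 0ℚ < d × d * c ≡ 1ℚ
  reciprocal c p = (1/ c) {{nz}} , positive⁻¹ ((1/ c) {{nz}}) {{1/pos⇒pos c {{positive p}}}} , *-inverseˡ c {{nz}}
    where
    nz = pos⇒nonZero c {{positive p}}

  *-cancel-≡0 : ∀ c x → 0ℚ < c → c * x ≡ 0ℚ → x ≡ 0ℚ
  *-cancel-≡0 c x p e with reciprocal c p
  ... | d , _ , dc = trans (sym (*-identityˡ x)) (trans (cong (_* x) (sym dc)) (trans (*-assoc d c x) (trans (cong (d *_) e) (*-zeroʳ d))))

  small : ∀ A B → 0ℚ < A → 0ℚ ≤ B → ∃ λ ε → 0ℚ < ε × ε * B < A
  small A B p q with reciprocal (B + 1ℚ) (+-nonneg-pos q (positive⁻¹ 1ℚ))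
  -- Here ε = A / (B + 1), where the added one makes the denominator positive.
  ... | d , d>0 , e = A * d , *-pos p d>0 , subst₂ _<_ (+-identityʳ (A * d * B)) eq (+-monoʳ-< (A * d * B) (*-pos p d>0))
    where
    open +-*-Solver
    eq : A * d * B + A * d ≡ A
    eq = trans (solve 3 (λ A d B → A :* d :* B :+ A :* d := A :* (d :* (B :+ con 1ℚ))) refl A d B) (trans (cong (A *_) e) (*-identityʳ A))

-- Affine functions, cones and simplicial polytopes.

module Polytopes where

  open import Data.Nat as ℕ using (ℕ)
  open import Data.Rational
  open import Data.Rational.Properties
  open import Data.Rational.Solver using (module +-*-Solver)
  open import Data.List using (List)
  open import Data.List.Membership.Propositional using (_∈_)
  open import Relation.Nullary.Decidable using (_⊎-dec_)
  open Rationals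

  -- (b , a) is the affine function x ↦ b - a · x.
  Aff : Set
  Aff = ℚ × ℚ³

  eval : Aff → ℚ³ → ℚ
  eval (b , a) x = b - a · x

  _⊞_ : Aff → Aff → Aff
  (b , a) ⊞ (b′ , a′) = b + b′ , a ⊕ a′

  _⊡_ : ℚ → Aff → Aff
  c ⊡ (b , a) = c * b , c ⊙ a

  infixl 6 _⊞_
  infixr 7 _⊡_

  eval-⊞ : ∀ f g x → eval (f ⊞ g) x ≡ eval f x + eval g x
  eval-⊞ (b , a₁ , a₂ , a₃) (b′ , a₁′ , a₂′ , a₃′) (x , y , z) =
    solve 11 (λ b a₁ a₂ a₃ b′ a₁′ a₂′ a₃′ x y z →
      (b :+ b′) :- (((a₁ :+ a₁′) :* x :+ (a₂ :+ a₂′) :* y) :+ (a₃ :+ a₃′) :* z) :=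
      (b :- ((a₁ :* x :+ a₂ :* y) :+ a₃ :* z)) :+ (b′ :- ((a₁′ :* x :+ a₂′ :* y) :+ a₃′ :* z)))
      refl b a₁ a₂ a₃ b′ a₁′ a₂′ a₃′ x y z
    where open +-*-Solver

  eval-⊡ : ∀ c f x → eval (c ⊡ f) x ≡ c * eval f x
  eval-⊡ c (b , a₁ , a₂ , a₃) (x , y , z) =
    solve 8 (λ c b a₁ a₂ a₃ x y z →
      c :* b :- ((c :* a₁ :* x :+ c :* a₂ :* y) :+ c :* a₃ :* z) := c :* (b :- ((a₁ :* x :+ a₂ :* y) :+ a₃ :* z)))
      refl c b a₁ a₂ a₃ x y z
    where open +-*-Solver

  eval-⊡⊞⊡ : ∀ c f d g x → eval (c ⊡ f ⊞ d ⊡ g) x ≡ c * eval f x + d * eval g x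
  eval-⊡⊞⊡ c f d g x = trans (eval-⊞ (c ⊡ f) (d ⊡ g) x) (cong₂ _+_ (eval-⊡ c f x) (eval-⊡ d g x))

  Triple : Set
  Triple = ℕ × ℕ × ℕ

  _∈₃_ : ℕ → Triple → Set
  v ∈₃ (a , b , c) = v ≡ a ⊎ v ≡ b ⊎ v ≡ c

  _∈₃?_ : ∀ v F → Dec (v ∈₃ F)
  v ∈₃? (a , b , c) = (v ℕ.≟ a) ⊎-dec (v ℕ.≟ b) ⊎-dec (v ℕ.≟ c)

  _≈₃_ : Triple → Triple → Set
  F ≈₃ G = (∀ v → v ∈₃ F → v ∈₃ G) × (∀ v → v ∈₃ G → v ∈₃ F)

  ≈₃-refl : ∀ {F} → F ≈₃ F
  ≈₃-refl = (λ _ p → p) , (λ _ p → p)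

  ≈₃-sym : ∀ {F G} → F ≈₃ G → G ≈₃ F
  ≈₃-sym (a , b) = b , a

  ≈₃-trans : ∀ {F G H} → F ≈₃ G → G ≈₃ H → F ≈₃ H
  ≈₃-trans (a , b) (c , d) = (λ v → c v ∘ a v) , (λ v → b v ∘ d v)

  Facets : Set
  Facets = List (Triple × Aff)

  -- Functions are compared by their values, so conic combinations can be rearranged without
  -- equations between coefficients.
  data Cone (fs : Facets) : Aff → Set where
    nil : ∀ {f} → (∀ x → eval f x ≡ 0ℚ) → Cone fs f
    cons : ∀ {f g F h} c → 0ℚ ≤ c → (F , h) ∈ fs → Cone fs g → (∀ x → eval f x ≡ c * eval h x + eval g x) → Cone fs f

  cone-resp : ∀ {fs f g} → (∀ x → eval f x ≡ eval g x) → Cone fs g → Cone fs f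
  cone-resp e (nil z) = nil λ x → trans (e x) (z x)
  cone-resp e (cons c p i g h) = cons c p i g λ x → trans (e x) (h x)

  cone-mono : ∀ {fs gs f} → (∀ {F h} → (F , h) ∈ fs → (F , h) ∈ gs) → Cone fs f → Cone gs f
  cone-mono s (nil z) = nil z
  cone-mono s (cons c p i g h) = cons c p (s i) (cone-mono s g) h

  cone-⊡ : ∀ {fs} c f → 0ℚ ≤ c → Cone fs f → Cone fs (c ⊡ f)
  cone-⊡ c f p (nil z) = nil λ x → trans (eval-⊡ c f x) (trans (cong (c *_) (z x)) (*-zeroʳ c))
  cone-⊡ c f p (cons {g = g} {h = h} d q i k e) = cons (c * d) (*-nonneg p q) i (cone-⊡ c g p k) λ x →
    trans (eval-⊡ c f x) (trans (cong (c *_) (e x)) (trans (solve 4 (λ c d h g → c :* (d :* h :+ g) := c :* d :* h :+ c :* g) refl c d (eval h x) (eval g x))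
      (cong (c * d * eval h x +_) (sym (eval-⊡ c g x)))))
    where open +-*-Solver

  cone-⊞ : ∀ {fs} f g → Cone fs f → Cone fs g → Cone fs (f ⊞ g)
  cone-⊞ f g (nil z) k = cone-resp (λ x → trans (eval-⊞ f g x) (trans (cong (_+ eval g x) (z x)) (+-identityˡ _))) k
  cone-⊞ f g (cons {g = f′} {h = h} c p i k e) k′ = cons c p i (cone-⊞ f′ g k k′) λ x →
    trans (eval-⊞ f g x) (trans (cong (_+ eval g x) (e x)) (trans (+-assoc (c * eval h x) (eval f′ x) (eval g x)) (cong (c * eval h x +_) (sym (eval-⊞ f′ g x)))))

  cone-generator : ∀ {fs F h} c → 0ℚ ≤ c → (F , h) ∈ fs → Cone fs (c ⊡ h)
  cone-generator {h = h} c p i = cons {g = 0ℚ ⊡ h} c p i (nil λ x → trans (eval-⊡ 0ℚ h x) (*-zeroˡ (eval h x))) λ x →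
    trans (eval-⊡ c h x) (sym (trans (cong (c * eval h x +_) (trans (eval-⊡ 0ℚ h x) (*-zeroˡ (eval h x)))) (+-identityʳ _)))

  cone-nonneg : ∀ {fs f x} → (∀ {F h} → (F , h) ∈ fs → 0ℚ ≤ eval h x) → Cone fs f → 0ℚ ≤ eval f x
  cone-nonneg {x = x} n (nil z) = ≤-reflexive (sym (z x))
  cone-nonneg {x = x} n (cons c p i k e) = subst (0ℚ ≤_) (sym (e x)) (+-nonneg (*-nonneg p (n i)) (cone-nonneg n k))

  -- A simplicial polytope with vertex set V and facets Φ (up to the order in the triples). Each facet comes with an
  -- affine function vanishing on it and positive on the other vertices; `cone` says that these functions generate
  -- the cone of all affine functions that are nonnegative on the polytope.
  record Polytope (V : ℕ → Set) (Φ : Triple → Set) : Set where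
    field
      point : ℕ → ℚ³
      facets : Facets
      sound : ∀ {F h} → (F , h) ∈ facets → ∃ λ F′ → Φ F′ × F ≈₃ F′
      complete : ∀ {F} → Φ F → ∃₂ λ F′ h → (F′ , h) ∈ facets × F ≈₃ F′
      vertices : ∀ {F h v} → (F , h) ∈ facets → v ∈₃ F → V v
      zero-on : ∀ {F h v} → (F , h) ∈ facets → v ∈₃ F → eval h (point v) ≡ 0ℚ
      pos-off : ∀ {F h v} → (F , h) ∈ facets → V v → ¬ v ∈₃ F → 0ℚ < eval h (point v)
      cone : ∀ f → (∀ v → V v → 0ℚ ≤ eval f (point v)) → Cone facets f
      -- Affine independence of the three points of a facet, in dual form.
      rank : ∀ {F h} → (F , h) ∈ facets → ∀ f → (∀ v → v ∈₃ F → eval f (point v) ≡ 0ℚ) →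
        ∃ λ c → ∀ x → eval f x ≡ c * eval h x
      -- `G` is the neighbour of `F` along the edge opposite `v`.
      across : ∀ {F h v} → (F , h) ∈ facets → v ∈₃ F →
        ∃₂ λ G g → (G , g) ∈ facets × ¬ v ∈₃ G × (∀ w → w ∈₃ F → w ≢ v → w ∈₃ G)

    nonneg-on : ∀ {F h v} → (F , h) ∈ facets → V v → 0ℚ ≤ eval h (point v)
    nonneg-on {F} {h} {v} i p with v ∈₃? F
    ... | yes q = ≤-reflexive (sym (zero-on i q))
    ... | no q = <⇒≤ (pos-off i p q)

  relabel : ∀ {V V′ Φ Φ′} → (∀ {v} → V v → V′ v) → (∀ {v} → V′ v → V v) →
    (∀ {F} → Φ F → ∃ λ F′ → Φ′ F′ × F ≈₃ F′) → (∀ {F} → Φ′ F → ∃ λ F′ → Φ F′ × F ≈₃ F′) → Polytope V Φ → Polytope V′ Φ′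
  relabel V→ V← Φ→ Φ← P = record
    { point = point
    ; facets = facets
    ; sound = λ i → let F′ , p , e = sound i
                        F″ , p′ , e′ = Φ→ p in F″ , p′ , ≈₃-trans e e′
    ; complete = λ p → let F′ , p′ , e = Φ← p
                           F″ , h , i , e′ = complete p′ in F″ , h , i , ≈₃-trans e e′
    ; vertices = λ i v∈ → V→ (vertices i v∈)
    ; zero-on = zero-on
    ; pos-off = λ i Vv → pos-off i (V← Vv)
    ; cone = λ f nn → cone f λ v Vv → nn v (V→ Vv)
    ; rank = rank
    ; across = across
    }
    where open Polytope P

-- Subdividing an edge of a simplicial polytope.

module Subdivide where

  open import Data.Nat as ℕ using (ℕ)
  open import Data.Rational
  open import Data.Rational.Properties
  open import Data.Rational.Solver using (module +-*-Solver)
  open import Data.List using ([]; _∷_; filter)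
  open import Data.List.Membership.Propositional using (_∈_)
  open import Data.List.Membership.Propositional.Properties using (∈-filter⁺; ∈-filter⁻)
  open import Data.List.Relation.Unary.Any using (here; there)
  open import Relation.Nullary.Decidable using (_×-dec_; ¬?)
  open Rationals
  open Polytopes

  ·-⊕ : ∀ a p q → a · (p ⊕ q) ≡ a · p + a · q
  ·-⊕ (a , b , c) (x , y , z) (x′ , y′ , z′) =
    solve 9 (λ a b c x y z x′ y′ z′ → (a :* (x :+ x′) :+ b :* (y :+ y′)) :+ c :* (z :+ z′) :=
      ((a :* x :+ b :* y) :+ c :* z) :+ ((a :* x′ :+ b :* y′) :+ c :* z′)) refl a b c x y z x′ y′ z′
    where open +-*-Solver

  ·-⊙ : ∀ a c p → a · (c ⊙ p) ≡ c * (a · p)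
  ·-⊙ (a₁ , a₂ , a₃) c (x , y , z) =
    solve 7 (λ a₁ a₂ a₃ c x y z → (a₁ :* (c :* x) :+ a₂ :* (c :* y)) :+ a₃ :* (c :* z) :=
      c :* ((a₁ :* x :+ a₂ :* y) :+ a₃ :* z)) refl a₁ a₂ a₃ c x y z
    where open +-*-Solver

  -- For α = ½ + ε this is the midpoint of `X` and `W` displaced by ε times (X + W) - (U + Y). The
  -- coefficients then add up to one.
  subdivision : ℚ → ℚ → ℚ³ → ℚ³ → ℚ³ → ℚ³ → ℚ³
  subdivision α ε X W U Y = ((α ⊙ X) ⊕ (α ⊙ W)) ⊕ (((- ε) ⊙ U) ⊕ ((- ε) ⊙ Y))

  eval-subdivision : ∀ α ε X W U Y → (α + α) - (ε + ε) ≡ 1ℚ → ∀ f →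
    eval f (subdivision α ε X W U Y) ≡ α * (eval f X + eval f W) - ε * (eval f U + eval f Y)
  eval-subdivision α ε X W U Y e (b , a) = begin
    b - a · subdivision α ε X W U Y
      ≡⟨ cong (λ t → b - t) (trans (·-⊕ a ((α ⊙ X) ⊕ (α ⊙ W)) _) (cong₂ _+_
           (trans (·-⊕ a (α ⊙ X) (α ⊙ W)) (cong₂ _+_ (·-⊙ a α X) (·-⊙ a α W)))
           (trans (·-⊕ a ((- ε) ⊙ U) ((- ε) ⊙ Y)) (cong₂ _+_ (·-⊙ a (- ε) U) (·-⊙ a (- ε) Y))))) ⟩
    b - ((α * (a · X) + α * (a · W)) + ((- ε) * (a · U) + (- ε) * (a · Y)))
      ≡⟨ cong (λ t → t - ((α * (a · X) + α * (a · W)) + ((- ε) * (a · U) + (- ε) * (a · Y)))) (sym (trans (cong (_* b) e) (*-identityˡ b))) ⟩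
    ((α + α) - (ε + ε)) * b - ((α * (a · X) + α * (a · W)) + ((- ε) * (a · U) + (- ε) * (a · Y)))
      ≡⟨ solve 7 (λ α ε b l m n k → ((α :+ α) :- (ε :+ ε)) :* b :- ((α :* l :+ α :* m) :+ ((:- ε) :* n :+ (:- ε) :* k)) :=
           α :* ((b :- l) :+ (b :- m)) :- ε :* ((b :- n) :+ (b :- k))) refl α ε b (a · X) (a · W) (a · U) (a · Y) ⟩
    α * ((b - a · X) + (b - a · W)) - ε * ((b - a · U) + (b - a · Y)) ∎
    where
    open ≡-Reasoning
    open +-*-Solver

  shrink : ∀ ε ε′ b a → ε ≤ ε′ → 0ℚ ≤ b → ε′ * b < a → ε * b < a
  shrink ε ε′ b a le nn lt = ≤-<-trans {ε * b} {ε′ * b} {a} (*-monoʳ-≤-nonNeg b {{nonNegative nn}} {ε} {ε′} le) lt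

  small-for-all : (fs : Facets) (A B : Aff → ℚ) → (∀ {F h} → (F , h) ∈ fs → 0ℚ < A h × 0ℚ ≤ B h) →
    ∃ λ ε → 0ℚ < ε × (∀ {F h} → (F , h) ∈ fs → ε * B h < A h)
  small-for-all [] A B p = 1ℚ , positive⁻¹ 1ℚ , λ ()
  small-for-all ((F , h) ∷ fs) A B p =
    smaller (small (A h) (B h) (proj₁ (p (here refl))) (proj₂ (p (here refl)))) (small-for-all fs A B (λ i → p (there i)))
    where
    Small : ℚ → Facets → Set
    Small ε fs = ∀ {F′ h′} → (F′ , h′) ∈ fs → ε * B h′ < A h′
    smaller : (∃ λ ε → 0ℚ < ε × ε * B h < A h) → (∃ λ ε → 0ℚ < ε × Small ε fs) → ∃ λ ε → 0ℚ < ε × Small ε ((F , h) ∷ fs)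
    smaller (ε₁ , pos₁ , lt₁) (ε₂ , pos₂ , lt₂) with ≤-total ε₁ ε₂
    ... | inj₁ le = ε₁ , pos₁ , λ { (here refl) → lt₁ ; {F′} {h′} (there i) → shrink ε₁ ε₂ (B h′) (A h′) le (proj₂ (p (there i))) (lt₂ i) }
    ... | inj₂ le = ε₂ , pos₂ , λ { (here refl) → shrink ε₂ ε₁ (B h) (A h) le (proj₂ (p (here refl))) lt₁ ; (there i) → lt₂ i }

  -- The edge `x w` is subdivided by `q`; `u` and `y` are the third vertices of the two facets at
  -- it. The new point lies beyond exactly these two planes: the function of either facet takes
  -- there -ε times its value at the third vertex of the other.
  module Subdivision {V : ℕ → Set} {Φ : Triple → Set} (P : Polytope V Φ) (x w u y q : ℕ) (q∉V : ¬ V q)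
    (visible₁ : ∃₂ λ F h → (F , h) ∈ Polytope.facets P × F ≈₃ (x , w , u))
    (visible₂ : ∃₂ λ F h → (F , h) ∈ Polytope.facets P × F ≈₃ (x , w , y))
    (only : ∀ {F h} → (F , h) ∈ Polytope.facets P → x ∈₃ F → w ∈₃ F → F ≈₃ (x , w , u) ⊎ F ≈₃ (x , w , y))
    (x≢w : x ≢ w) (u≢x : u ≢ x) (u≢w : u ≢ w) (y≢x : y ≢ x) (y≢w : y ≢ w) (u≢y : u ≢ y) where

    open Polytope P

    private
      F₁ F₂ : Triple
      F₁ = proj₁ visible₁
      F₂ = proj₁ visible₂
      h₁ h₂ : Aff
      h₁ = proj₁ (proj₂ visible₁)
      h₂ = proj₁ (proj₂ visible₂)
      i₁ : (F₁ , h₁) ∈ facets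
      i₁ = proj₁ (proj₂ (proj₂ visible₁))
      i₂ : (F₂ , h₂) ∈ facets
      i₂ = proj₁ (proj₂ (proj₂ visible₂))
      ≈₁ : F₁ ≈₃ (x , w , u)
      ≈₁ = proj₂ (proj₂ (proj₂ visible₁))
      ≈₂ : F₂ ≈₃ (x , w , y)
      ≈₂ = proj₂ (proj₂ (proj₂ visible₂))

      Vx : V x
      Vx = vertices i₁ (proj₂ ≈₁ x (inj₁ refl))
      Vw : V w
      Vw = vertices i₁ (proj₂ ≈₁ w (inj₂ (inj₁ refl)))
      Vu : V u
      Vu = vertices i₁ (proj₂ ≈₁ u (inj₂ (inj₂ refl)))
      Vy : V y
      Vy = vertices i₂ (proj₂ ≈₂ y (inj₂ (inj₂ refl)))

      at : Aff → ℕ → ℚ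
      at h v = eval h (point v)

      Kept : Triple × Aff → Set
      Kept (F , _) = ¬ (x ∈₃ F × w ∈₃ F)

      kept? : ∀ p → Dec (Kept p)
      kept? (F , _) = ¬? ((x ∈₃? F) ×-dec (w ∈₃? F))

      kept : Facets
      kept = filter kept? facets

      kept⇒facet : ∀ {F h} → (F , h) ∈ kept → (F , h) ∈ facets × Kept (F , h)
      kept⇒facet i = ∈-filter⁻ kept? i

      -- The value of `h` at the new point is A h - ε B h + ε (h(x) + h(w)). The plane of a kept
      -- facet contains at most one of `x` and `w`, so `A h` is positive and a small ε leaves the
      -- point on the inner side.
      A B : Aff → ℚ
      A h = ½ * (at h x + at h w)
      B h = at h u + at h y

      kept-edge-pos : ∀ {F h} → (F , h) ∈ kept → 0ℚ < at h x + at h w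
      kept-edge-pos {F} {h} i with kept⇒facet i | x ∈₃? F | w ∈₃? F
      ... | j , k | yes p | yes r = ⊥-elim (k (p , r))
      ... | j , k | no p | _ = +-pos-nonneg (pos-off j Vx p) (nonneg-on j Vw)
      ... | j , k | yes _ | no r = +-nonneg-pos (nonneg-on j Vx) (pos-off j Vw r)

    module WithPoint (ε α : ℚ) (ε>0 : 0ℚ < ε) (α>0 : 0ℚ < α) (Q : ℚ³)
      (eval-Q : ∀ f → eval f Q ≡ α * (at f x + at f w) - ε * (at f u + at f y))
      (eval-Q-kept : ∀ {F h} → (F , h) ∈ kept → 0ℚ < eval h Q) where

      -- The facet is `q e₁ o₁`, where `e₁ e₂` is the subdivided edge and `o₁`, `o₂` are opposite to
      -- it. A function that vanishes at `Q`, `e₁` and `o₁` has values at `e₂` and `o₂` in the ratio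
      -- ε : α, and `H` is scaled so that they are exactly `ε` and `α`.
      record NewFacet (e₁ e₂ o₁ o₂ : ℕ) : Set where
        field
          H : Aff
          at-Q : eval H Q ≡ 0ℚ
          at-e₁ : at H e₁ ≡ 0ℚ
          at-o₁ : at H o₁ ≡ 0ℚ
          at-e₂ : at H e₂ ≡ ε
          at-o₂ : at H o₂ ≡ α
          pos-H : ∀ {v} → V v → v ≢ e₁ → v ≢ o₁ → 0ℚ < at H v
          beyond : ∃₂ λ G g → (G , g) ∈ kept × e₁ ∈₃ G × o₁ ∈₃ G

      -- The functional of the facet q e₁ o₁ combines those of the facets on both sides of the edge e₁ o₁.
      new-facet : ∀ e₁ e₂ o₁ o₂ {F h} → (F , h) ∈ facets → F ≈₃ (e₁ , e₂ , o₁) → V o₂ → ¬ o₂ ∈₃ F → e₁ ≢ e₂ → o₁ ≢ e₂ →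
        (∀ {G g} → ¬ e₂ ∈₃ G → Kept (G , g)) →
        (∀ f → eval f Q ≡ α * (at f e₁ + at f e₂) - ε * (at f o₁ + at f o₂)) → NewFacet e₁ e₂ o₁ o₂
      new-facet e₁ e₂ o₁ o₂ {F} {h} i (F⊆ , ⊆F) Vo₂ o₂∉F e₁≢e₂ o₁≢e₂ keep evalQ with across i (⊆F e₂ (inj₂ (inj₁ refl)))
      ... | G , g , j , e₂∉G , rest = record
        { H = c ⊡ H₀
        ; at-Q = trans (eval-⊡ c H₀ Q) (trans (cong (c *_) H₀-Q) (*-zeroʳ c))
        ; at-e₁ = scaled-zero {e₁} H₀-e₁
        ; at-o₁ = scaled-zero {o₁} H₀-o₁
        ; at-e₂ = H-e₂
        ; at-o₂ = H-o₂
        ; pos-H = λ {v} Vv ne ne′ → subst (0ℚ <_) (sym (eval-⊡ c H₀ (point v))) (*-pos c>0 (H₀-pos Vv ne ne′))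
        ; beyond = G , g , j′ , e₁∈G , o₁∈G
        }
        where
        open +-*-Solver
        e₁∈F = ⊆F e₁ (inj₁ refl)
        e₂∈F = ⊆F e₂ (inj₂ (inj₁ refl))
        o₁∈F = ⊆F o₁ (inj₂ (inj₂ refl))
        e₁∈G = rest e₁ e₁∈F e₁≢e₂
        o₁∈G = rest o₁ o₁∈F o₁≢e₂
        Ve₂ = vertices i e₂∈F
        j′ : (G , g) ∈ kept
        j′ = ∈-filter⁺ kept? j (keep {G} {g} e₂∉G)
        -- These weights are g(Q) and -h(Q), the latter positive because `Q` is beyond `F`. Hence a
        -- h + b g vanishes at `Q`, and also at `e₁` and `o₁`, which lie in both facets.
        a b : ℚ
        a = eval g Q
        b = ε * at h o₂
        a>0 : 0ℚ < a
        a>0 = eval-Q-kept j′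
        b>0 : 0ℚ < b
        b>0 = *-pos ε>0 (pos-off i Vo₂ o₂∉F)
        h-Q : eval h Q ≡ - b
        h-Q = trans (evalQ h) (trans (cong₂ (λ s t → α * s - ε * (t + at h o₂)) (cong₂ _+_ (zero-on i e₁∈F) (zero-on i e₂∈F)) (zero-on i o₁∈F))
          (solve 3 (λ α ε z → α :* (con 0ℚ :+ con 0ℚ) :- ε :* (con 0ℚ :+ z) := :- (ε :* z)) refl α ε (at h o₂)))
        H₀ : Aff
        H₀ = a ⊡ h ⊞ b ⊡ g
        H₀-at : ∀ p → eval H₀ p ≡ a * eval h p + b * eval g p
        H₀-at = eval-⊡⊞⊡ a h b g
        H₀-Q : eval H₀ Q ≡ 0ℚ
        H₀-Q = trans (H₀-at Q) (trans (cong (λ t → a * t + b * a) h-Q) (solve 2 (λ a b → a :* (:- b) :+ b :* a := con 0ℚ) refl a b))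
        both-zero : ∀ {v} → v ∈₃ F → v ∈₃ G → at H₀ v ≡ 0ℚ
        both-zero {v} p r = trans (H₀-at (point v)) (trans (cong₂ (λ s t → a * s + b * t) (zero-on i p) (zero-on j r))
          (solve 2 (λ a b → a :* con 0ℚ :+ b :* con 0ℚ := con 0ℚ) refl a b))
        H₀-e₁ = both-zero e₁∈F e₁∈G
        H₀-o₁ = both-zero o₁∈F o₁∈G
        H₀-pos : ∀ {v} → V v → v ≢ e₁ → v ≢ o₁ → 0ℚ < at H₀ v
        H₀-pos {v} Vv ne ne′ with v ∈₃? F
        ... | no v∉F = subst (0ℚ <_) (sym (H₀-at (point v))) (+-pos-nonneg (*-pos a>0 (pos-off i Vv v∉F)) (*-nonneg (<⇒≤ b>0) (nonneg-on j Vv)))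
        ... | yes v∈F with F⊆ v v∈F
        ...   | inj₁ e = ⊥-elim (ne e)
        ...   | inj₂ (inj₂ e) = ⊥-elim (ne′ e)
        ...   | inj₂ (inj₁ refl) = subst (0ℚ <_) (sym (H₀-at (point v))) (+-nonneg-pos (*-nonneg (<⇒≤ a>0) (nonneg-on i Vv)) (*-pos b>0 (pos-off j Vv e₂∉G)))
        H₀e₂>0 : 0ℚ < at H₀ e₂
        H₀e₂>0 = H₀-pos Ve₂ (e₁≢e₂ ∘ sym) (o₁≢e₂ ∘ sym)
        r = reciprocal (at H₀ e₂) H₀e₂>0
        c : ℚ
        c = ε * proj₁ r
        c>0 : 0ℚ < c
        c>0 = *-pos ε>0 (proj₁ (proj₂ r))
        scaled-zero : ∀ {v} → at H₀ v ≡ 0ℚ → at (c ⊡ H₀) v ≡ 0ℚ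
        scaled-zero {v} e = trans (eval-⊡ c H₀ (point v)) (trans (cong (c *_) e) (*-zeroʳ c))
        H-e₂ : at (c ⊡ H₀) e₂ ≡ ε
        H-e₂ = trans (eval-⊡ c H₀ (point e₂)) (trans (*-assoc ε (proj₁ r) (at H₀ e₂)) (trans (cong (ε *_) (proj₂ (proj₂ r))) (*-identityʳ ε)))
        H-o₂ : at (c ⊡ H₀) o₂ ≡ α
        H-o₂ = sym (trans (sym (+-identityʳ α)) (trans (cong (α +_) (sym (*-cancel-≡0 ε (at (c ⊡ H₀) o₂ - α) ε>0 (trans
            (solve 3 (λ α ε z → ε :* (z :- α) := :- (α :* (con 0ℚ :+ ε) :- ε :* (con 0ℚ :+ z))) refl α ε (at (c ⊡ H₀) o₂))
            (cong -_ (trans (sym (trans (evalQ (c ⊡ H₀)) (cong₂ (λ s t → α * s - ε * (t + at (c ⊡ H₀) o₂)) (cong₂ _+_ (scaled-zero {e₁} H₀-e₁) H-e₂) (scaled-zero {o₁} H₀-o₁))))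
                            (trans (eval-⊡ c H₀ Q) (trans (cong (c *_) H₀-Q) (*-zeroʳ c)))))))))
          (solve 2 (λ α z → α :+ (z :- α) := z) refl α (at (c ⊡ H₀) o₂))))

      u∉F₂ : ¬ u ∈₃ F₂
      u∉F₂ p with proj₁ ≈₂ u p
      ... | inj₁ e = u≢x e
      ... | inj₂ (inj₁ e) = u≢w e
      ... | inj₂ (inj₂ e) = u≢y e

      y∉F₁ : ¬ y ∈₃ F₁
      y∉F₁ p with proj₁ ≈₁ y p
      ... | inj₁ e = y≢x e
      ... | inj₂ (inj₁ e) = y≢w e
      ... | inj₂ (inj₂ e) = u≢y (sym e)

      swap₃ : ∀ {a b c} → (a , b , c) ≈₃ (b , a , c)
      swap₃ = (λ { _ (inj₁ e) → inj₂ (inj₁ e) ; _ (inj₂ (inj₁ e)) → inj₁ e ; _ (inj₂ (inj₂ e)) → inj₂ (inj₂ e) }) ,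
              (λ { _ (inj₁ e) → inj₂ (inj₁ e) ; _ (inj₂ (inj₁ e)) → inj₁ e ; _ (inj₂ (inj₂ e)) → inj₂ (inj₂ e) })

      nf₁ : NewFacet x w u y
      nf₁ = new-facet x w u y i₁ ≈₁ Vy y∉F₁ x≢w u≢w (λ n (_ , p) → n p) eval-Q
      nf₂ : NewFacet w x u y
      nf₂ = new-facet w x u y i₁ (≈₃-trans ≈₁ swap₃) Vy y∉F₁ (x≢w ∘ sym) u≢x (λ n (p , _) → n p)
        λ f → trans (eval-Q f) (cong (λ s → α * s - ε * (at f u + at f y)) (+-comm (at f x) (at f w)))
      nf₃ : NewFacet x w y u
      nf₃ = new-facet x w y u i₂ ≈₂ Vu u∉F₂ x≢w y≢w (λ n (_ , p) → n p)
        λ f → trans (eval-Q f) (cong (λ s → α * (at f x + at f w) - ε * s) (+-comm (at f u) (at f y)))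
      nf₄ : NewFacet w x y u
      nf₄ = new-facet w x y u i₂ (≈₃-trans ≈₂ swap₃) Vu u∉F₂ (x≢w ∘ sym) y≢x (λ n (p , _) → n p)
        λ f → trans (eval-Q f) (cong₂ (λ s t → α * s - ε * t) (+-comm (at f x) (at f w)) (+-comm (at f u) (at f y)))

      -- By `rank`, a function vanishing at `x`, `w` and `u` is a multiple of `h₁`, and `y` lies off
      -- that plane, so its value there kills the factor. Apply this to the difference.
      determined : ∀ f g → at f x ≡ at g x → at f w ≡ at g w → at f u ≡ at g u → at f y ≡ at g y → ∀ p → eval f p ≡ eval g p
      determined f g ex ew eu ey p = minus-zero (eval f p) (eval g p) (trans (sym (k-at p)) (k-zero p))
        where
        k : Aff
        k = 1ℚ ⊡ f ⊞ (- 1ℚ) ⊡ g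
        k-at : ∀ p → eval k p ≡ 1ℚ * eval f p + (- 1ℚ) * eval g p
        k-at = eval-⊡⊞⊡ 1ℚ f (- 1ℚ) g
        minus-zero : ∀ s t → 1ℚ * s + (- 1ℚ) * t ≡ 0ℚ → s ≡ t
        minus-zero s t e = trans (sym (solve 2 (λ s t → (con 1ℚ :* s :+ (:- con 1ℚ) :* t) :+ t := s) refl s t)) (trans (cong (_+ t) e) (+-identityˡ t))
          where open +-*-Solver
        vanish : ∀ {v} → at f v ≡ at g v → at k v ≡ 0ℚ
        vanish {v} e = trans (k-at (point v)) (trans (cong (λ s → 1ℚ * s + (- 1ℚ) * at g v) e)
          (solve 1 (λ t → con 1ℚ :* t :+ (:- con 1ℚ) :* t := con 0ℚ) refl (at g v)))
          where open +-*-Solver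
        on-F₁ : ∀ v → v ∈₃ F₁ → at k v ≡ 0ℚ
        on-F₁ v i with proj₁ ≈₁ v i
        ... | inj₁ refl = vanish {x} ex
        ... | inj₂ (inj₁ refl) = vanish {w} ew
        ... | inj₂ (inj₂ refl) = vanish {u} eu
        multiple : ∃ λ c → ∀ p → eval k p ≡ c * eval h₁ p
        multiple = rank i₁ k on-F₁
        c = proj₁ multiple
        c≡0 : c ≡ 0ℚ
        c≡0 = *-cancel-≡0 (at h₁ y) c (pos-off i₁ Vy y∉F₁) (trans (*-comm (at h₁ y) c) (trans (sym (proj₂ multiple (point y))) (vanish {y} ey)))
        k-zero : ∀ p → eval k p ≡ 0ℚ
        k-zero p = trans (proj₂ multiple p) (trans (cong (_* eval h₁ p) c≡0) (*-zeroˡ (eval h₁ p)))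

      module WithFacets (nf₁ : NewFacet x w u y) (nf₂ : NewFacet w x u y) (nf₃ : NewFacet x w y u) (nf₄ : NewFacet w x y u) where

        private
          H₁ H₂ H₃ H₄ : Aff
          H₁ = NewFacet.H nf₁
          H₂ = NewFacet.H nf₂
          H₃ = NewFacet.H nf₃
          H₄ = NewFacet.H nf₄

        facets′ : Facets
        facets′ = ((q , x , u) , H₁) ∷ ((q , w , u) , H₂) ∷ ((q , x , y) , H₃) ∷ ((q , w , y) , H₄) ∷ kept

        -- With a, c, b, d the values at x, w, u, y and τ = ε (b + d) = α (a + c), the function τ g is
        -- c d H₁ + a d H₂ + c b H₃ + a b H₄.
        cone-at-Q : ∀ g → eval g Q ≡ 0ℚ → (∀ v → V v → 0ℚ ≤ at g v) → Cone facets′ g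
        cone-at-Q g gQ nn = by-cases (τ ≟ 0ℚ)
          where
          open +-*-Solver
          a c b d τ : ℚ
          a = at g x
          c = at g w
          b = at g u
          d = at g y
          τ = ε * (b + d)
          a≥0 = nn x Vx
          c≥0 = nn w Vw
          b≥0 = nn u Vu
          d≥0 = nn y Vy
          balance : α * (a + c) ≡ τ
          balance = trans (solve 2 (λ s t → s := (s :- t) :+ t) refl (α * (a + c)) τ) (trans (cong (_+ τ) (trans (sym (eval-Q g)) gQ)) (+-identityˡ τ))
          K K₁ K₂ : Aff
          K₁ = (c * d) ⊡ H₁ ⊞ (a * d) ⊡ H₂
          K₂ = (c * b) ⊡ H₃ ⊞ (a * b) ⊡ H₄
          K = K₁ ⊞ K₂
          K-at : ∀ p {s t m n} → eval H₁ p ≡ s → eval H₂ p ≡ t → eval H₃ p ≡ m → eval H₄ p ≡ n →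
            eval K p ≡ (c * d * s + a * d * t) + (c * b * m + a * b * n)
          K-at p e₁ e₂ e₃ e₄ = trans (eval-⊞ K₁ K₂ p) (cong₂ _+_
            (trans (eval-⊡⊞⊡ (c * d) H₁ (a * d) H₂ p) (cong₂ (λ s t → c * d * s + a * d * t) e₁ e₂))
            (trans (eval-⊡⊞⊡ (c * b) H₃ (a * b) H₄ p) (cong₂ (λ s t → c * b * s + a * b * t) e₃ e₄)))
          open NewFacet
          τg≗K : ∀ p → eval (τ ⊡ g) p ≡ eval K p
          τg≗K = determined (τ ⊡ g) K
            (trans (eval-⊡ τ g (point x)) (trans (solve 5 (λ e a b c d → e :* (b :+ d) :* a := (c :* d :* con 0ℚ :+ a :* d :* e) :+ (c :* b :* con 0ℚ :+ a :* b :* e)) refl ε a b c d)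
              (sym (K-at (point x) (at-e₁ nf₁) (at-e₂ nf₂) (at-e₁ nf₃) (at-e₂ nf₄)))))
            (trans (eval-⊡ τ g (point w)) (trans (solve 5 (λ e a b c d → e :* (b :+ d) :* c := (c :* d :* e :+ a :* d :* con 0ℚ) :+ (c :* b :* e :+ a :* b :* con 0ℚ)) refl ε a b c d)
              (sym (K-at (point w) (at-e₂ nf₁) (at-e₁ nf₂) (at-e₂ nf₃) (at-e₁ nf₄)))))
            (trans (eval-⊡ τ g (point u)) (trans (cong (_* b) (sym balance)) (trans (solve 5 (λ e a b c d → e :* (a :+ c) :* b := (c :* d :* con 0ℚ :+ a :* d :* con 0ℚ) :+ (c :* b :* e :+ a :* b :* e)) refl α a b c d)
              (sym (K-at (point u) (at-o₁ nf₁) (at-o₁ nf₂) (at-o₂ nf₃) (at-o₂ nf₄))))))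
            (trans (eval-⊡ τ g (point y)) (trans (cong (_* d) (sym balance)) (trans (solve 5 (λ e a b c d → e :* (a :+ c) :* d := (c :* d :* e :+ a :* d :* e) :+ (c :* b :* con 0ℚ :+ a :* b :* con 0ℚ)) refl α a b c d)
              (sym (K-at (point y) (at-o₂ nf₁) (at-o₂ nf₂) (at-o₁ nf₃) (at-o₁ nf₄))))))
          K-cone : Cone facets′ K
          K-cone = cone-⊞ K₁ K₂
            (cone-⊞ ((c * d) ⊡ H₁) ((a * d) ⊡ H₂) (cone-generator (c * d) (*-nonneg c≥0 d≥0) (here refl)) (cone-generator (a * d) (*-nonneg a≥0 d≥0) (there (here refl))))
            (cone-⊞ ((c * b) ⊡ H₃) ((a * b) ⊡ H₄) (cone-generator (c * b) (*-nonneg c≥0 b≥0) (there (there (here refl)))) (cone-generator (a * b) (*-nonneg a≥0 b≥0) (there (there (there (here refl))))))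
          by-cases : Dec (τ ≡ 0ℚ) → Cone facets′ g
          -- The four values are nonnegative and τ = ε (b + d) = α (a + c), so here all of them
          -- vanish and `g` is zero.
          by-cases (yes τ≡0) = nil λ p → trans (determined g (0ℚ ⊡ g) (to-zero {x} a≡0) (to-zero {w} c≡0) (to-zero {u} b≡0) (to-zero {y} d≡0) p) (trans (eval-⊡ 0ℚ g p) (*-zeroˡ (eval g p)))
            where
            to-zero : ∀ {v} → at g v ≡ 0ℚ → at g v ≡ at (0ℚ ⊡ g) v
            to-zero {v} e = trans e (sym (trans (eval-⊡ 0ℚ g (point v)) (*-zeroˡ (at g v))))
            b+d≡0 : b + d ≡ 0ℚ
            b+d≡0 = *-cancel-≡0 ε (b + d) ε>0 τ≡0
            a+c≡0 : a + c ≡ 0ℚ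
            a+c≡0 = *-cancel-≡0 α (a + c) α>0 (trans balance τ≡0)
            a≡0 = sum≡0ˡ {a} {c} a≥0 c≥0 a+c≡0
            c≡0 = sum≡0ʳ {a} {c} a≥0 c≥0 a+c≡0
            b≡0 = sum≡0ˡ {b} {d} b≥0 d≥0 b+d≡0
            d≡0 = sum≡0ʳ {b} {d} b≥0 d≥0 b+d≡0
          by-cases (no τ≢0) with reciprocal τ (nonneg∧≢⇒pos (*-nonneg (<⇒≤ ε>0) (+-nonneg b≥0 d≥0)) τ≢0)
          ... | r , r>0 , rτ = cone-resp {g = r ⊡ K} (λ p → sym (trans (eval-⊡ r K p) (trans (cong (r *_) (trans (sym (τg≗K p)) (eval-⊡ τ g p)))
                  (trans (sym (*-assoc r τ (eval g p))) (trans (cong (_* eval g p) rτ) (*-identityˡ (eval g p))))))) (cone-⊡ r K (<⇒≤ r>0) K-cone)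

        -- `f₁` collects the summands from the two facets at the edge, which vanish at `x` and `w`,
        -- and `R` those from the kept facets.
        Split : Aff → Set
        Split f = ∃₂ λ f₁ R → at f₁ x ≡ 0ℚ × at f₁ w ≡ 0ℚ × (∀ v → V v → 0ℚ ≤ at f₁ v) × Cone kept R × (∀ p → eval f p ≡ eval f₁ p + eval R p)

        split : ∀ {f} → Cone facets f → Split f
        split {f} (nil z) = f , f , z (point x) , z (point w) , (λ v _ → ≤-reflexive (sym (z (point v)))) , nil z ,
          λ p → trans (z p) (sym (cong₂ _+_ (z p) (z p)))
        split {f} (cons {F = F} {h} c c≥0 i k e) with split k | kept? (F , h)
        ... | f₁ , R , zx , zw , nn , kR , e′ | yes kp =
          f₁ , c ⊡ h ⊞ R , zx , zw , nn , cone-⊞ (c ⊡ h) R (cone-generator c c≥0 (∈-filter⁺ kept? i kp)) kR ,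
          λ p → trans (e p) (trans (cong (c * eval h p +_) (e′ p)) (trans (solve 3 (λ s t r → s :+ (t :+ r) := t :+ (s :+ r)) refl (c * eval h p) (eval f₁ p) (eval R p))
            (cong (eval f₁ p +_) (sym (trans (eval-⊞ (c ⊡ h) R p) (cong (_+ eval R p) (eval-⊡ c h p)))))))
          where open +-*-Solver
        ... | f₁ , R , zx , zw , nn , kR , e′ | no ¬kp =
          c ⊡ h ⊞ f₁ , R , zero-at {x} x∈F zx , zero-at {w} w∈F zw ,
          (λ v Vv → subst (0ℚ ≤_) (sym (at-v v)) (+-nonneg (*-nonneg c≥0 (nonneg-on i Vv)) (nn v Vv))) , kR ,
          λ p → trans (e p) (trans (cong (c * eval h p +_) (e′ p)) (trans (sym (+-assoc (c * eval h p) (eval f₁ p) (eval R p)))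
            (cong (_+ eval R p) (sym (trans (eval-⊞ (c ⊡ h) f₁ p) (cong (_+ eval f₁ p) (eval-⊡ c h p)))))))
          where
          both : x ∈₃ F × w ∈₃ F
          both with x ∈₃? F | w ∈₃? F
          ... | yes s | yes t = s , t
          ... | no s | _ = ⊥-elim (¬kp (s ∘ proj₁))
          ... | _ | no t = ⊥-elim (¬kp (t ∘ proj₂))
          x∈F = proj₁ both
          w∈F = proj₂ both
          at-v : ∀ v → at (c ⊡ h ⊞ f₁) v ≡ c * at h v + at f₁ v
          at-v v = trans (eval-⊞ (c ⊡ h) f₁ (point v)) (cong (_+ at f₁ v) (eval-⊡ c h (point v)))
          zero-at : ∀ {v} → v ∈₃ F → at f₁ v ≡ 0ℚ → at (c ⊡ h ⊞ f₁) v ≡ 0ℚ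
          zero-at {v} p z = trans (at-v v) (trans (cong₂ _+_ (trans (cong (c *_) (zero-on i p)) (*-zeroʳ c)) z) (+-identityʳ 0ℚ))

        kept⊆facets′ : ∀ {F h} → (F , h) ∈ kept → (F , h) ∈ facets′
        kept⊆facets′ i = there (there (there (there i)))

        -- In f = f₁ + R only f₁ involves the two facets that disappear. Moving from f along R to the function
        -- ρ f₁ + t R, which vanishes at Q, leaves a nonnegative multiple of R.
        cone′ : ∀ f → (∀ v → V v → 0ℚ ≤ at f v) → 0ℚ ≤ eval f Q → Cone facets′ f
        cone′ f nn nQ with split (cone f nn)
        ... | f₁ , R , zx , zw , nn₁ , kR , e = by-cases (t ≟ 0ℚ)
          where
          open +-*-Solver
          t ρ φ : ℚ
          t = ε * (at f₁ u + at f₁ y)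
          ρ = eval R Q
          φ = eval f Q
          t≥0 : 0ℚ ≤ t
          t≥0 = *-nonneg (<⇒≤ ε>0) (+-nonneg (nn₁ u Vu) (nn₁ y Vy))
          f₁-Q : eval f₁ Q ≡ - t
          f₁-Q = trans (eval-Q f₁) (trans (cong₂ (λ a b → α * (a + b) - t) zx zw) (solve 2 (λ α t → α :* (con 0ℚ :+ con 0ℚ) :- t := :- t) refl α t))
          ρ≡ : ρ ≡ φ + t
          ρ≡ = sym (trans (cong (_+ t) (trans (e Q) (cong (_+ ρ) f₁-Q))) (solve 2 (λ t r → ((:- t) :+ r) :+ t := r) refl t ρ))
          R≥0 : ∀ v → V v → 0ℚ ≤ at R v
          R≥0 v Vv = cone-nonneg {f = R} (λ i → nonneg-on (proj₁ (kept⇒facet i)) Vv) kR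
          by-cases : Dec (t ≡ 0ℚ) → Cone facets′ f
          by-cases (yes t≡0) = cone-resp {g = R} (λ p → trans (e p) (trans (cong (_+ eval R p) (f₁≗0 p)) (+-identityˡ (eval R p)))) (cone-mono kept⊆facets′ kR)
            where
            s≡0 : at f₁ u + at f₁ y ≡ 0ℚ
            s≡0 = *-cancel-≡0 ε (at f₁ u + at f₁ y) ε>0 t≡0
            to-zero : ∀ {v} → at f₁ v ≡ 0ℚ → at f₁ v ≡ at (0ℚ ⊡ f₁) v
            to-zero {v} z = trans z (sym (trans (eval-⊡ 0ℚ f₁ (point v)) (*-zeroˡ (at f₁ v))))
            f₁≗0 : ∀ p → eval f₁ p ≡ 0ℚ
            f₁≗0 p = trans (determined f₁ (0ℚ ⊡ f₁) (to-zero {x} zx) (to-zero {w} zw)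
              (to-zero {u} (sum≡0ˡ {at f₁ u} {at f₁ y} (nn₁ u Vu) (nn₁ y Vy) s≡0)) (to-zero {y} (sum≡0ʳ {at f₁ u} {at f₁ y} (nn₁ u Vu) (nn₁ y Vy) s≡0)) p)
              (trans (eval-⊡ 0ℚ f₁ p) (*-zeroˡ (eval f₁ p)))
          -- Since ρ = φ + t, ρ f = ρ f₁ + ρ R = g + φ R. Here φ = f(Q) is nonnegative, and it
          -- remains to divide by ρ > 0.
          by-cases (no t≢0) = cone-resp {g = r ⊡ K} same (cone-⊡ r K (<⇒≤ (proj₁ (proj₂ rec))) (cone-⊞ g (φ ⊡ R) g-cone (cone-⊡ φ R nQ (cone-mono kept⊆facets′ kR))))
            where
            ρ>0 : 0ℚ < ρ
            ρ>0 = subst (0ℚ <_) (sym ρ≡) (+-nonneg-pos nQ (nonneg∧≢⇒pos t≥0 t≢0))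
            rec = reciprocal ρ ρ>0
            r = proj₁ rec
            g K : Aff
            g = ρ ⊡ f₁ ⊞ t ⊡ R
            K = g ⊞ φ ⊡ R
            g-at : ∀ p → eval g p ≡ ρ * eval f₁ p + t * eval R p
            g-at = eval-⊡⊞⊡ ρ f₁ t R
            g-cone : Cone facets′ g
            g-cone = cone-at-Q g (trans (g-at Q) (trans (cong (λ s → ρ * s + t * ρ) f₁-Q) (solve 2 (λ r t → r :* (:- t) :+ t :* r := con 0ℚ) refl ρ t)))
              λ v Vv → subst (0ℚ ≤_) (sym (g-at (point v))) (+-nonneg (*-nonneg (<⇒≤ ρ>0) (nn₁ v Vv)) (*-nonneg t≥0 (R≥0 v Vv)))
            K-at : ∀ p → eval K p ≡ ρ * eval f p
            K-at p = trans (eval-⊞ g (φ ⊡ R) p) (trans (cong₂ _+_ (g-at p) (eval-⊡ φ R p)) (trans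
              (solve 5 (λ r f t R φ → (r :* f :+ t :* R) :+ φ :* R := r :* f :+ (φ :+ t) :* R) refl ρ (eval f₁ p) t (eval R p) φ)
              (trans (cong (λ s → ρ * eval f₁ p + s * eval R p) (sym ρ≡)) (trans (sym (*-distribˡ-+ ρ (eval f₁ p) (eval R p))) (cong (ρ *_) (sym (e p)))))))
            same : ∀ p → eval f p ≡ eval (r ⊡ K) p
            same p = sym (trans (eval-⊡ r K p) (trans (cong (r *_) (K-at p)) (trans (sym (*-assoc r ρ (eval f p))) (trans (cong (_* eval f p) (proj₂ (proj₂ rec))) (*-identityˡ (eval f p))))))

        Agree : (e₁ e₂ o₁ o₂ : ℕ) → Aff → Aff → Set
        Agree e₁ e₂ o₁ o₂ f g = at f e₁ ≡ at g e₁ × at f e₂ ≡ at g e₂ × at f o₁ ≡ at g o₁ × at f o₂ ≡ at g o₂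

        -- The four new facets differ only in the roles of `x`, `w`, `u`, `y`. The view exposes
        -- these roles, with the two neighbours at `q`, so that each property is proved once for all
        -- four.
        data View : Triple → Aff → Set where
          old : ∀ {F h} → (F , h) ∈ kept → View F h
          new : ∀ {e₁ e₂ o₁ o₂} (nf : NewFacet e₁ e₂ o₁ o₂) →
            (∃ λ h → ((q , e₂ , o₁) , h) ∈ facets′) → (∃ λ h → ((q , e₁ , o₂) , h) ∈ facets′) →
            V e₁ → V o₁ → e₁ ≢ e₂ → o₁ ≢ o₂ → e₁ ≢ o₁ → e₁ ≢ o₂ → o₁ ≢ e₂ →
            (∀ f → eval f Q ≡ α * (at f e₁ + at f e₂) - ε * (at f o₁ + at f o₂)) →
            (∀ f g → Agree e₁ e₂ o₁ o₂ f g → ∀ p → eval f p ≡ eval g p) →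
            View (q , e₁ , o₁) (NewFacet.H nf)

        view : ∀ {F h} → (F , h) ∈ facets′ → View F h
        view (here refl) = new nf₁ (H₂ , there (here refl)) (H₃ , there (there (here refl))) Vx Vu x≢w u≢y (u≢x ∘ sym) (y≢x ∘ sym) u≢w eval-Q
          λ f g (a , b , c , d) → determined f g a b c d
        view (there (here refl)) = new nf₂ (H₁ , here refl) (H₄ , there (there (there (here refl)))) Vw Vu (x≢w ∘ sym) u≢y (u≢w ∘ sym) (y≢w ∘ sym) u≢x
          (λ f → trans (eval-Q f) (cong (λ s → α * s - ε * (at f u + at f y)) (+-comm (at f x) (at f w))))
          λ f g (a , b , c , d) → determined f g b a c d
        view (there (there (here refl))) = new nf₃ (H₄ , there (there (there (here refl)))) (H₁ , here refl) Vx Vy x≢w (u≢y ∘ sym) (y≢x ∘ sym) (u≢x ∘ sym) y≢w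
          (λ f → trans (eval-Q f) (cong (λ s → α * (at f x + at f w) - ε * s) (+-comm (at f u) (at f y))))
          λ f g (a , b , c , d) → determined f g a b d c
        view (there (there (there (here refl)))) = new nf₄ (H₃ , there (there (here refl))) (H₂ , there (here refl)) Vw Vy (x≢w ∘ sym) (u≢y ∘ sym) (y≢w ∘ sym) (u≢w ∘ sym) y≢x
          (λ f → trans (eval-Q f) (cong₂ (λ s t → α * s - ε * t) (+-comm (at f x) (at f w)) (+-comm (at f u) (at f y))))
          λ f g (a , b , c , d) → determined f g b a d c
        view (there (there (there (there i)))) = old i

        point′ : ℕ → ℚ³
        point′ v with v ℕ.≟ q
        ... | yes _ = Q
        ... | no _ = point v

        point′-old : ∀ {v} → V v → point′ v ≡ point v
        point′-old {v} Vv with v ℕ.≟ q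
        ... | yes refl = ⊥-elim (q∉V Vv)
        ... | no _ = refl

        point′-q : point′ q ≡ Q
        point′-q with q ℕ.≟ q
        ... | yes _ = refl
        ... | no ne = ⊥-elim (ne refl)

        V≢q : ∀ {v} → V v → v ≢ q
        V≢q Vv refl = q∉V Vv

        V′ : ℕ → Set
        V′ v = V v ⊎ v ≡ q

        zero-on′ : ∀ {F h v} → (F , h) ∈ facets′ → v ∈₃ F → eval h (point′ v) ≡ 0ℚ
        zero-on′ {h = h} {v} i v∈ with view i
        ... | old j = trans (cong (eval h) (point′-old (vertices (proj₁ (kept⇒facet j)) v∈))) (zero-on (proj₁ (kept⇒facet j)) v∈)
        ... | new {e₁} {_} {o₁} nf _ _ Ve Vo _ _ _ _ _ _ _ = on v∈
          where
          on : v ∈₃ (q , e₁ , o₁) → eval h (point′ v) ≡ 0ℚ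
          on (inj₁ refl) = trans (cong (eval h) point′-q) (NewFacet.at-Q nf)
          on (inj₂ (inj₁ refl)) = trans (cong (eval h) (point′-old Ve)) (NewFacet.at-e₁ nf)
          on (inj₂ (inj₂ refl)) = trans (cong (eval h) (point′-old Vo)) (NewFacet.at-o₁ nf)

        pos-off′ : ∀ {F h v} → (F , h) ∈ facets′ → V′ v → ¬ v ∈₃ F → 0ℚ < eval h (point′ v)
        pos-off′ {h = h} {v} i Vv v∉ with view i | Vv
        ... | old j | inj₁ Vv = subst (λ p → 0ℚ < eval h p) (sym (point′-old Vv)) (pos-off (proj₁ (kept⇒facet j)) Vv v∉)
        ... | old j | inj₂ refl = subst (λ p → 0ℚ < eval h p) (sym point′-q) (eval-Q-kept j)
        ... | new nf _ _ _ _ _ _ _ _ _ _ _ | inj₁ Vv =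
          subst (λ p → 0ℚ < eval h p) (sym (point′-old Vv)) (NewFacet.pos-H nf Vv (v∉ ∘ inj₂ ∘ inj₁) (v∉ ∘ inj₂ ∘ inj₂))
        ... | new nf _ _ _ _ _ _ _ _ _ _ _ | inj₂ refl = ⊥-elim (v∉ (inj₁ refl))

        vertices′ : ∀ {F h v} → (F , h) ∈ facets′ → v ∈₃ F → V′ v
        vertices′ {v = v} i v∈ with view i
        ... | old j = inj₁ (vertices (proj₁ (kept⇒facet j)) v∈)
        ... | new {e₁} {_} {o₁} nf _ _ Ve Vo _ _ _ _ _ _ _ = on v∈
          where
          on : v ∈₃ (q , e₁ , o₁) → V′ v
          on (inj₁ e) = inj₂ e
          on (inj₂ (inj₁ refl)) = inj₁ Ve
          on (inj₂ (inj₂ refl)) = inj₁ Vo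

        rank′ : ∀ {F h} → (F , h) ∈ facets′ → ∀ f → (∀ v → v ∈₃ F → eval f (point′ v) ≡ 0ℚ) → ∃ λ c → ∀ x → eval f x ≡ c * eval h x
        rank′ {F} {h} i f z with view i
        ... | old j = rank (proj₁ (kept⇒facet j)) f λ v v∈ →
          trans (cong (eval f) (sym (point′-old (vertices (proj₁ (kept⇒facet j)) v∈)))) (z v v∈)
        ... | new {e₁} {e₂} {o₁} {o₂} nf _ _ Ve Vo _ _ _ _ _ evalQ det = c , λ p → trans (det f (c ⊡ h) agree p) (eval-⊡ c h p)
          where
          open +-*-Solver
          rec = reciprocal ε ε>0
          r c : ℚ
          r = proj₁ rec
          -- Forced by the value `ε` of `h` at `e₂`. The values at `o₂` then agree because both
          -- functions vanish at `Q`, `e₁` and `o₁`.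
          c = r * at f e₂
          f-e₁ : at f e₁ ≡ 0ℚ
          f-e₁ = trans (cong (eval f) (sym (point′-old Ve))) (z e₁ (inj₂ (inj₁ refl)))
          f-o₁ : at f o₁ ≡ 0ℚ
          f-o₁ = trans (cong (eval f) (sym (point′-old Vo))) (z o₁ (inj₂ (inj₂ refl)))
          f-Q : α * (0ℚ + at f e₂) - ε * (0ℚ + at f o₂) ≡ 0ℚ
          f-Q = trans (cong₂ (λ s t → α * (s + at f e₂) - ε * (t + at f o₂)) (sym f-e₁) (sym f-o₁))
            (trans (sym (evalQ f)) (trans (cong (eval f) (sym point′-q)) (z q (inj₁ refl))))
          scaled : ∀ {v s} → at h v ≡ s → at (c ⊡ h) v ≡ c * s
          scaled {v} e = trans (eval-⊡ c h (point v)) (cong (c *_) e)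
          εf : ε * at f o₂ ≡ α * at f e₂
          εf = trans (solve 4 (λ a b s t → b :* t := a :* s :- (a :* (con 0ℚ :+ s) :- b :* (con 0ℚ :+ t))) refl α ε (at f e₂) (at f o₂))
            (trans (cong (λ s → α * at f e₂ - s) f-Q) (+-identityʳ (α * at f e₂)))
          agree : Agree e₁ e₂ o₁ o₂ f (c ⊡ h)
          agree = trans f-e₁ (sym (trans (scaled {e₁} (NewFacet.at-e₁ nf)) (*-zeroʳ c))) ,
            sym (trans (scaled {e₂} (NewFacet.at-e₂ nf)) (trans (solve 3 (λ r s e → r :* s :* e := r :* e :* s) refl r (at f e₂) ε)
              (trans (cong (_* at f e₂) (proj₂ (proj₂ rec))) (*-identityˡ (at f e₂))))) ,
            trans f-o₁ (sym (trans (scaled {o₁} (NewFacet.at-o₁ nf)) (*-zeroʳ c))) ,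
            sym (trans (scaled {o₂} (NewFacet.at-o₂ nf)) (trans (solve 3 (λ r s a → r :* s :* a := r :* (a :* s)) refl r (at f e₂) α)
              (trans (cong (r *_) (sym εf)) (trans (sym (*-assoc r ε (at f o₂))) (trans (cong (_* at f o₂) (proj₂ (proj₂ rec))) (*-identityˡ (at f o₂)))))))

        Across′ : Triple → ℕ → Set
        Across′ F v = ∃₂ λ G g → (G , g) ∈ facets′ × ¬ v ∈₃ G × (∀ w → w ∈₃ F → w ≢ v → w ∈₃ G)

        not-in : ∀ {v a b c} → v ≢ a → v ≢ b → v ≢ c → ¬ v ∈₃ (a , b , c)
        not-in na nb nc (inj₁ e) = na e
        not-in na nb nc (inj₂ (inj₁ e)) = nb e
        not-in na nb nc (inj₂ (inj₂ e)) = nc e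

        -- A facet on the other side of an edge of F was removed; F contains at most one of x and w.
        across-removed : ∀ {F G v z} → ¬ (x ∈₃ F × w ∈₃ F) → V v → G ≈₃ (x , w , z) → ¬ v ∈₃ G → (∀ t → t ∈₃ F → t ≢ v → t ∈₃ G) →
          (∃ λ h → ((q , x , z) , h) ∈ facets′) → (∃ λ h → ((q , w , z) , h) ∈ facets′) → Across′ F v
        across-removed {F} {G} {v} {z} k Vv (G⊆ , ⊆G) v∉G rest (hx , ix) (hw , iw) with x ∈₃? F
        ... | yes x∈F = (q , x , z) , hx , ix ,
            not-in (V≢q Vv) (λ { refl → v∉G (⊆G x (inj₁ refl)) }) (λ { refl → v∉G (⊆G z (inj₂ (inj₂ refl))) }) , into
          where
          into : ∀ t → t ∈₃ F → t ≢ v → t ∈₃ (q , x , z)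
          into t t∈ ne with G⊆ t (rest t t∈ ne)
          ... | inj₁ e = inj₂ (inj₁ e)
          ... | inj₂ (inj₁ refl) = ⊥-elim (k (x∈F , t∈))
          ... | inj₂ (inj₂ e) = inj₂ (inj₂ e)
        ... | no x∉F = (q , w , z) , hw , iw ,
            not-in (V≢q Vv) (λ { refl → v∉G (⊆G w (inj₂ (inj₁ refl))) }) (λ { refl → v∉G (⊆G z (inj₂ (inj₂ refl))) }) , into
          where
          into : ∀ t → t ∈₃ F → t ≢ v → t ∈₃ (q , w , z)
          into t t∈ ne with G⊆ t (rest t t∈ ne)
          ... | inj₁ refl = ⊥-elim (x∉F t∈)
          ... | inj₂ (inj₁ e) = inj₂ (inj₁ e)
          ... | inj₂ (inj₂ e) = inj₂ (inj₂ e)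

        across′ : ∀ {F h v} → (F , h) ∈ facets′ → v ∈₃ F → Across′ F v
        across′ {v = v} i v∈ with view i
        across′ {F} {h} {v} i v∈ | old j with across (proj₁ (kept⇒facet j)) v∈
        ... | G , g , l , v∉G , rest with kept? (G , g)
        ...   | yes kG = G , g , kept⊆facets′ (∈-filter⁺ kept? l kG) , v∉G , rest
        ...   | no ¬kG with only l x∈G w∈G
          where
          both : x ∈₃ G × w ∈₃ G
          both with x ∈₃? G | w ∈₃? G
          ... | yes s | yes t = s , t
          ... | no s | _ = ⊥-elim (¬kG (s ∘ proj₁))
          ... | _ | no t = ⊥-elim (¬kG (t ∘ proj₂))
          x∈G = proj₁ both
          w∈G = proj₂ both
        ...     | inj₁ e = across-removed {F} {G} {v} {u} (proj₂ (kept⇒facet j)) (vertices (proj₁ (kept⇒facet j)) v∈) e v∉G rest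
                    (H₁ , here refl) (H₂ , there (here refl))
        ...     | inj₂ e = across-removed {F} {G} {v} {y} (proj₂ (kept⇒facet j)) (vertices (proj₁ (kept⇒facet j)) v∈) e v∉G rest
                    (H₃ , there (there (here refl))) (H₄ , there (there (there (here refl))))
        across′ i (inj₁ refl) | new nf _ _ _ _ _ _ _ _ _ _ _ with NewFacet.beyond nf
        ... | G , g , j , e∈ , o∈ = G , g , kept⊆facets′ j , (λ q∈ → q∉V (vertices (proj₁ (kept⇒facet j)) q∈)) ,
          λ { t (inj₁ e) ne → ⊥-elim (ne e) ; t (inj₂ (inj₁ refl)) ne → e∈ ; t (inj₂ (inj₂ refl)) ne → o∈ }
        across′ i (inj₂ (inj₁ refl)) | new nf (h , j) _ Ve Vo e≢e o≢o e≢o e≢o₂ o≢e _ _ = _ , h , j , not-in (V≢q Ve) e≢e e≢o ,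
          λ { t (inj₁ e) ne → inj₁ e ; t (inj₂ (inj₁ e)) ne → ⊥-elim (ne e) ; t (inj₂ (inj₂ e)) ne → inj₂ (inj₂ e) }
        across′ i (inj₂ (inj₂ refl)) | new nf _ (h , j) Ve Vo e≢e o≢o e≢o e≢o₂ o≢e _ _ = _ , h , j , not-in (V≢q Vo) (e≢o ∘ sym) o≢o ,
          λ { t (inj₁ e) ne → inj₁ e ; t (inj₂ (inj₁ e)) ne → inj₂ (inj₁ e) ; t (inj₂ (inj₂ e)) ne → ⊥-elim (ne e) }

        New : Triple → Set
        New F = F ≈₃ (q , x , u) ⊎ F ≈₃ (q , w , u) ⊎ F ≈₃ (q , x , y) ⊎ F ≈₃ (q , w , y)

        module Result (V⁺ : ℕ → Set) (Φ⁺ : Triple → Set)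
          (to-V : ∀ {v} → V⁺ v → V′ v) (from-V : ∀ {v} → V′ v → V⁺ v)
          (keep : ∀ {F} → Φ F → ¬ (x ∈₃ F × w ∈₃ F) → Φ⁺ F)
          (new⁺ : ∃ (λ F → Φ⁺ F × F ≈₃ (q , x , u)) × ∃ (λ F → Φ⁺ F × F ≈₃ (q , w , u)) ×
                  ∃ (λ F → Φ⁺ F × F ≈₃ (q , x , y)) × ∃ (λ F → Φ⁺ F × F ≈₃ (q , w , y)))
          (back : ∀ {F} → Φ⁺ F → New F ⊎ (Φ F × ¬ (x ∈₃ F × w ∈₃ F))) where

          sound⁺ : ∀ {F h} → (F , h) ∈ facets′ → ∃ λ F′ → Φ⁺ F′ × F ≈₃ F′
          sound⁺ (here refl) = let (F , p , e) , _ = new⁺ in F , p , ≈₃-sym e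
          sound⁺ (there (here refl)) = let _ , (F , p , e) , _ = new⁺ in F , p , ≈₃-sym e
          sound⁺ (there (there (here refl))) = let _ , _ , (F , p , e) , _ = new⁺ in F , p , ≈₃-sym e
          sound⁺ (there (there (there (here refl)))) = let _ , _ , _ , (F , p , e) = new⁺ in F , p , ≈₃-sym e
          sound⁺ (there (there (there (there j)))) with sound (proj₁ (kept⇒facet j))
          ... | F′ , p , e = F′ , keep p (λ (s , t) → proj₂ (kept⇒facet j) (proj₂ e x s , proj₂ e w t)) , e

          complete⁺ : ∀ {F} → Φ⁺ F → ∃₂ λ F′ h → (F′ , h) ∈ facets′ × F ≈₃ F′
          complete⁺ p with back p
          ... | inj₁ (inj₁ e) = _ , _ , here refl , e
          ... | inj₁ (inj₂ (inj₁ e)) = _ , _ , there (here refl) , e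
          ... | inj₁ (inj₂ (inj₂ (inj₁ e))) = _ , _ , there (there (here refl)) , e
          ... | inj₁ (inj₂ (inj₂ (inj₂ e))) = _ , _ , there (there (there (here refl))) , e
          ... | inj₂ (p′ , k) with complete p′
          ...   | F′ , h , j , e = F′ , h , kept⊆facets′ (∈-filter⁺ kept? j (λ (s , t) → k (proj₂ e x s , proj₂ e w t))) , e

          polytope⁺ : Polytope V⁺ Φ⁺
          polytope⁺ = record
            { point = point′
            ; facets = facets′
            ; sound = sound⁺
            ; complete = complete⁺
            ; vertices = λ i v∈ → from-V (vertices′ i v∈)
            ; zero-on = zero-on′
            ; pos-off = λ i Vv → pos-off′ i (to-V Vv)
            ; cone = λ f nn → cone′ f (λ v Vv → subst (λ p → 0ℚ ≤ eval f p) (point′-old Vv) (nn v (from-V (inj₁ Vv))))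
                (subst (λ p → 0ℚ ≤ eval f p) point′-q (nn q (from-V (inj₂ refl))))
            ; rank = rank′
            ; across = across′
            }

      open WithFacets nf₁ nf₂ nf₃ nf₄ public using (New; module Result)

    private
      chosen : ∃ λ ε → 0ℚ < ε × (∀ {F h} → (F , h) ∈ kept → ε * B h < A h)
      chosen = small-for-all kept A B λ i → *-pos (positive⁻¹ ½) (kept-edge-pos i) ,
        +-nonneg (nonneg-on (proj₁ (kept⇒facet i)) Vu) (nonneg-on (proj₁ (kept⇒facet i)) Vy)

      ε α : ℚ
      ε = proj₁ chosen
      α = ½ + ε
      ε>0 : 0ℚ < ε
      ε>0 = proj₁ (proj₂ chosen)
      α>0 : 0ℚ < α
      α>0 = +-pos-nonneg (positive⁻¹ ½) (<⇒≤ ε>0)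

      Q : ℚ³
      Q = subdivision α ε (point x) (point w) (point u) (point y)

      eval-Q : ∀ f → eval f Q ≡ α * (at f x + at f w) - ε * (at f u + at f y)
      eval-Q = eval-subdivision α ε (point x) (point w) (point u) (point y)
        (solve 1 (λ e → ((con ½ :+ e) :+ (con ½ :+ e)) :- (e :+ e) := con 1ℚ) refl ε)
        where open +-*-Solver

      eval-Q-kept : ∀ {F h} → (F , h) ∈ kept → 0ℚ < eval h Q
      eval-Q-kept {h = h} i = subst (0ℚ <_) (sym (trans (eval-Q h) identity))
        (+-pos-nonneg (<⇒sub (proj₂ (proj₂ chosen) i)) (*-nonneg (<⇒≤ ε>0) (<⇒≤ (kept-edge-pos i))))
        where
        open +-*-Solver
        identity : α * (at h x + at h w) - ε * B h ≡ (A h - ε * B h) + ε * (at h x + at h w)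
        identity = solve 4 (λ c e s b → (c :+ e) :* s :- e :* b := (c :* s :- e :* b) :+ e :* s) refl ½ ε (at h x + at h w) (B h)

    open WithPoint ε α ε>0 α>0 Q eval-Q eval-Q-kept public using (New; module Result)

-- Subdivision steps that build the helix.

module Helix where

  open import Data.Nat as ℕ using (ℕ; suc; _+_; _≤_; _<_; z≤n; s≤s)
  import Data.Nat.Properties as ℕ
  open import Data.List.Membership.Propositional using (_∈_)
  open Lia using (Exp; con; Form; lia) renaming (_:+_ to _⊹_; _:≤_ to _≼_; _:<_ to _≺_; _:≡_ to _≐_; _:∨_ to _∨′_; _:⇒_ to _⇒′_; :¬_ to ¬′_)
  open Polytopes
  open Subdivide using (module Subdivision)

  rotate : ∀ {a b c} → (a , b , c) ≈₃ (b , c , a)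
  rotate = (λ { _ (inj₁ e) → inj₂ (inj₂ e) ; _ (inj₂ (inj₁ e)) → inj₁ e ; _ (inj₂ (inj₂ e)) → inj₂ (inj₁ e) }) ,
           (λ { _ (inj₁ e) → inj₂ (inj₁ e) ; _ (inj₂ (inj₁ e)) → inj₂ (inj₂ e) ; _ (inj₂ (inj₂ e)) → inj₁ e })

  exchange : ∀ {a b c} → (a , b , c) ≈₃ (b , a , c)
  exchange = (λ { _ (inj₁ e) → inj₂ (inj₁ e) ; _ (inj₂ (inj₁ e)) → inj₁ e ; _ (inj₂ (inj₂ e)) → inj₂ (inj₂ e) }) ,
             (λ { _ (inj₁ e) → inj₂ (inj₁ e) ; _ (inj₂ (inj₁ e)) → inj₁ e ; _ (inj₂ (inj₂ e)) → inj₂ (inj₂ e) })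

  reverse : ∀ {a b c} → (a , b , c) ≈₃ (c , b , a)
  reverse = ≈₃-trans rotate exchange′
    where
    exchange′ : ∀ {a b c} → (b , c , a) ≈₃ (c , b , a)
    exchange′ = exchange

  subdivide : ∀ {V Φ V⁺ Φ⁺} → Polytope V Φ → (x w u y q : ℕ) → ¬ V q →
    ∃ (λ F → Φ F × F ≈₃ (x , w , u)) → ∃ (λ F → Φ F × F ≈₃ (x , w , y)) →
    (∀ {F} → Φ F → x ∈₃ F → w ∈₃ F → F ≈₃ (x , w , u) ⊎ F ≈₃ (x , w , y)) →
    x ≢ w → u ≢ x → u ≢ w → y ≢ x → y ≢ w → u ≢ y →
    (∀ {v} → V⁺ v → V v ⊎ v ≡ q) → (∀ {v} → V v ⊎ v ≡ q → V⁺ v) →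
    (∀ {F} → Φ F → ¬ (x ∈₃ F × w ∈₃ F) → Φ⁺ F) →
    (∃ (λ F → Φ⁺ F × F ≈₃ (q , x , u)) × ∃ (λ F → Φ⁺ F × F ≈₃ (q , w , u)) ×
     ∃ (λ F → Φ⁺ F × F ≈₃ (q , x , y)) × ∃ (λ F → Φ⁺ F × F ≈₃ (q , w , y))) →
    (∀ {F} → Φ⁺ F → (F ≈₃ (q , x , u) ⊎ F ≈₃ (q , w , u) ⊎ F ≈₃ (q , x , y) ⊎ F ≈₃ (q , w , y)) ⊎ (Φ F × ¬ (x ∈₃ F × w ∈₃ F))) →
    Polytope V⁺ Φ⁺
  subdivide {V} {Φ} {V⁺} {Φ⁺} P x w u y q q∉V (G₁ , p₁ , e₁) (G₂ , p₂ , e₂) only d₁ d₂ d₃ d₄ d₅ d₆ toV fromV keep new back =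
    Subdivision.Result.polytope⁺ P x w u y q q∉V (vis p₁ e₁) (vis p₂ e₂) only′ d₁ d₂ d₃ d₄ d₅ d₆ V⁺ Φ⁺ toV fromV keep new back
    where
    open Polytope P
    vis : ∀ {G T} → Φ G → G ≈₃ T → ∃₂ λ F h → (F , h) ∈ facets × F ≈₃ T
    vis p e with complete p
    ... | F , h , i , e′ = F , h , i , ≈₃-trans (≈₃-sym e′) e
    only′ : ∀ {F h} → (F , h) ∈ facets → x ∈₃ F → w ∈₃ F → F ≈₃ (x , w , u) ⊎ F ≈₃ (x , w , y)
    only′ i xF wF with sound i
    ... | F′ , p , e with only p (proj₁ e x xF) (proj₁ e w wF)
    ...   | inj₁ e′ = inj₁ (≈₃-trans e e′)
    ...   | inj₂ e′ = inj₂ (≈₃-trans e e′)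

  ∈₃-form : ∀ {j} (v a b c : Exp j) → Form j
  ∈₃-form v a b c = v ≐ a ∨′ v ≐ b ∨′ v ≐ c

  -- The double cone with apexes 0 and z over the path 1, …, k, N, completed by the triangles 0 1 z and 0 N z.
  data Pre (N z k : ℕ) : Triple → Set where
    lo : ∀ i → 1 ≤ i → i < k → Pre N z k (0 , i , suc i)
    hi : ∀ i → 1 ≤ i → i < k → Pre N z k (z , i , suc i)
    lo-end : Pre N z k (0 , k , N)
    hi-end : Pre N z k (z , k , N)
    first : Pre N z k (0 , 1 , z)
    last : Pre N z k (0 , N , z)

  PreV : ℕ → ℕ → ℕ → ℕ → Set
  PreV N z k v = v ≤ k ⊎ v ≡ N ⊎ v ≡ z

  -- The vertex k + 1 subdivides the edge from `k` to `N`, whose opposite vertices are the apexes 0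
  -- and `z`.
  pre-step : ∀ N z k → 1 ≤ k → suc k < N → N < z → Polytope (PreV N z k) (Pre N z k) → Polytope (PreV N z (suc k)) (Pre N z (suc k))
  pre-step N z k 1≤k k<N N<z P = subdivide P k N 0 z (suc k)
    (lia 3 (λ N z k → con 1 ⊹ k ≺ N ⇒′ N ≺ z ⇒′ ¬′ (con 1 ⊹ k ≼ k ∨′ con 1 ⊹ k ≐ N ∨′ con 1 ⊹ k ≐ z)) refl N z k k<N N<z)
    (_ , lo-end , rotate) (_ , hi-end , rotate) only
    (ℕ.<⇒≢ (ℕ.<-trans (ℕ.n<1+n k) k<N)) (ℕ.<⇒≢ 1≤k) (ℕ.<⇒≢ (ℕ.≤-trans (s≤s z≤n) k<N))
    (ℕ.>⇒≢ (ℕ.<-trans (ℕ.<-trans (ℕ.n<1+n k) k<N) N<z)) (ℕ.>⇒≢ N<z) (ℕ.<⇒≢ (ℕ.≤-trans (s≤s z≤n) N<z))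
    (λ {v} → lia 4 (λ N z k v → (v ≼ con 1 ⊹ k ∨′ v ≐ N ∨′ v ≐ z) ⇒′ ((v ≼ k ∨′ v ≐ N ∨′ v ≐ z) ∨′ v ≐ con 1 ⊹ k)) refl N z k v)
    (λ {v} → lia 4 (λ N z k v → ((v ≼ k ∨′ v ≐ N ∨′ v ≐ z) ∨′ v ≐ con 1 ⊹ k) ⇒′ (v ≼ con 1 ⊹ k ∨′ v ≐ N ∨′ v ≐ z)) refl N z k v)
    keep
    ((_ , lo k 1≤k ℕ.≤-refl , reverse) , (_ , lo-end , rotate) , (_ , hi k 1≤k ℕ.≤-refl , reverse) , (_ , hi-end , rotate))
    back
    where
    N∉path : ∀ i → 1 ≤ i → i < k → ∀ c → c < N → ¬ N ∈₃ (c , i , suc i)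
    N∉path i 1≤i i<k c c<N = lia 4 (λ N k i c → con 1 ⊹ k ≺ N ⇒′ i ≺ k ⇒′ c ≺ N ⇒′ ¬′ ∈₃-form N c i (con 1 ⊹ i)) refl N k i c k<N i<k c<N
    N∉path-z : ∀ i → 1 ≤ i → i < k → ¬ N ∈₃ (z , i , suc i)
    N∉path-z i 1≤i i<k = lia 4 (λ N k i z → con 1 ⊹ k ≺ N ⇒′ i ≺ k ⇒′ N ≺ z ⇒′ ¬′ ∈₃-form N z i (con 1 ⊹ i)) refl N k i z k<N i<k N<z
    0<N : 0 < N
    0<N = ℕ.≤-trans (s≤s z≤n) k<N
    N∉first : ¬ N ∈₃ (0 , 1 , z)
    N∉first = lia 3 (λ N k z → con 1 ≼ k ⇒′ con 1 ⊹ k ≺ N ⇒′ N ≺ z ⇒′ ¬′ ∈₃-form N (con 0) (con 1) z) refl N k z 1≤k k<N N<z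
    k∉last : ¬ k ∈₃ (0 , N , z)
    k∉last = lia 3 (λ N k z → con 1 ≼ k ⇒′ con 1 ⊹ k ≺ N ⇒′ N ≺ z ⇒′ ¬′ ∈₃-form k (con 0) N z) refl N k z 1≤k k<N N<z
    only : ∀ {F} → Pre N z k F → k ∈₃ F → N ∈₃ F → F ≈₃ (k , N , 0) ⊎ F ≈₃ (k , N , z)
    only (lo i 1≤i i<k) _ N∈ = ⊥-elim (N∉path i 1≤i i<k 0 0<N N∈)
    only (hi i 1≤i i<k) _ N∈ = ⊥-elim (N∉path-z i 1≤i i<k N∈)
    only lo-end _ _ = inj₁ rotate
    only hi-end _ _ = inj₂ rotate
    only first _ N∈ = ⊥-elim (N∉first N∈)
    only last k∈ _ = ⊥-elim (k∉last k∈)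
    keep : ∀ {F} → Pre N z k F → ¬ (k ∈₃ F × N ∈₃ F) → Pre N z (suc k) F
    keep (lo i 1≤i i<k) _ = lo i 1≤i (ℕ.m<n⇒m<1+n i<k)
    keep (hi i 1≤i i<k) _ = hi i 1≤i (ℕ.m<n⇒m<1+n i<k)
    keep lo-end n = ⊥-elim (n (inj₂ (inj₁ refl) , inj₂ (inj₂ refl)))
    keep hi-end n = ⊥-elim (n (inj₂ (inj₁ refl) , inj₂ (inj₂ refl)))
    keep first _ = first
    keep last _ = last
    back : ∀ {F} → Pre N z (suc k) F →
      (F ≈₃ (suc k , k , 0) ⊎ F ≈₃ (suc k , N , 0) ⊎ F ≈₃ (suc k , k , z) ⊎ F ≈₃ (suc k , N , z)) ⊎ (Pre N z k F × ¬ (k ∈₃ F × N ∈₃ F))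
    back (lo i 1≤i i<1+k) with i ℕ.≟ k
    ... | yes refl = inj₁ (inj₁ reverse)
    ... | no ne = let i<k = ℕ.≤∧≢⇒< (ℕ.≤-pred i<1+k) ne in inj₂ (lo i 1≤i i<k , N∉path i 1≤i i<k 0 0<N ∘ proj₂)
    back (hi i 1≤i i<1+k) with i ℕ.≟ k
    ... | yes refl = inj₁ (inj₂ (inj₂ (inj₁ reverse)))
    ... | no ne = let i<k = ℕ.≤∧≢⇒< (ℕ.≤-pred i<1+k) ne in inj₂ (hi i 1≤i i<k , N∉path-z i 1≤i i<k ∘ proj₂)
    back lo-end = inj₁ (inj₂ (inj₁ rotate))
    back hi-end = inj₁ (inj₂ (inj₂ (inj₂ rotate)))
    back first = inj₂ (first , N∉first ∘ proj₂)
    back last = inj₂ (last , k∉last ∘ proj₁)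

  -- The helix 0, 1, …, t - 1, in which a is joined to a + 1, a + N and a + N + 1, together with z, which is joined to
  -- the last N + 1 of these vertices.
  data Helix (N z t : ℕ) : Triple → Set where
    lower : ∀ a → suc (a + N) < t → Helix N z t (a , suc a , suc (a + N))
    upper : ∀ a → suc (a + N) < t → Helix N z t (a , a + N , suc (a + N))
    bottom : ∀ k → 1 ≤ k → k < N → Helix N z t (0 , k , suc k)
    top : ∀ k → t ≤ suc (k + N) → suc (suc k) ≤ t → Helix N z t (k , suc k , z)
    closing : ∀ a → suc (a + N) ≡ t → Helix N z t (a + N , a , z)

  HelixV : ℕ → ℕ → ℕ → Set
  HelixV z t v = v < t ⊎ v ≡ z

  -- The vertex t = a + N + 1 subdivides the edge from `z` to its oldest neighbour `a`, with
  -- opposite vertices a + 1 and a + N. Thus `a` leaves the link of `z`, and `t` acquires just the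
  -- neighbours that the helix prescribes.
  helix-step : ∀ N z a → 2 ≤ N → suc (a + N) < z →
    Polytope (HelixV z (suc (a + N))) (Helix N z (suc (a + N))) → Polytope (HelixV z (suc (suc (a + N)))) (Helix N z (suc (suc (a + N))))
  helix-step N z a 2≤N t<z P = subdivide P z a (suc a) (a + N) t
    (lia 2 (λ t z → t ≺ z ⇒′ ¬′ (t ≺ t ∨′ t ≐ z)) refl t z t<z)
    (_ , top a ℕ.≤-refl 2+a≤t , reverse-z) (_ , closing a refl , reverse) only
    (lia 3 (λ z a N → con 1 ⊹ (a ⊹ N) ≺ z ⇒′ ¬′ (z ≐ a)) refl z a N t<z)
    (lia 3 (λ z a N → con 1 ⊹ (a ⊹ N) ≺ z ⇒′ ¬′ (con 1 ⊹ a ≐ z)) refl z a N t<z)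
    (lia 1 (λ a → ¬′ (con 1 ⊹ a ≐ a)) refl a)
    (lia 3 (λ z a N → con 1 ⊹ (a ⊹ N) ≺ z ⇒′ ¬′ (a ⊹ N ≐ z)) refl z a N t<z)
    (lia 2 (λ a N → con 2 ≼ N ⇒′ ¬′ (a ⊹ N ≐ a)) refl a N 2≤N)
    (lia 2 (λ a N → con 2 ≼ N ⇒′ ¬′ (con 1 ⊹ a ≐ a ⊹ N)) refl a N 2≤N)
    (λ {v} → lia 3 (λ t z v → (v ≺ con 1 ⊹ t ∨′ v ≐ z) ⇒′ ((v ≺ t ∨′ v ≐ z) ∨′ v ≐ t)) refl t z v)
    (λ {v} → lia 3 (λ t z v → ((v ≺ t ∨′ v ≐ z) ∨′ v ≐ t) ⇒′ (v ≺ con 1 ⊹ t ∨′ v ≐ z)) refl t z v)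
    keep
    ((_ , closing (suc a) refl , ≈₃-trans rotate reverse) , (_ , lower a ℕ.≤-refl , ≈₃-sym rotate) ,
     (_ , top (a + N) (ℕ.s≤s (lia 2 (λ a N → con 2 ≼ N ⇒′ con 1 ⊹ (a ⊹ N) ≼ a ⊹ N ⊹ N) refl a N 2≤N)) ℕ.≤-refl , rotate) ,
     (_ , upper a ℕ.≤-refl , ≈₃-sym rotate))
    back
    where
    t = suc (a + N)
    rotate′ : ∀ {a b c} → (a , b , c) ≈₃ (c , a , b)
    rotate′ = ≈₃-trans rotate rotate
    reverse-z : (a , suc a , z) ≈₃ (z , a , suc a)
    reverse-z = rotate′
    2+a≤t : suc (suc a) ≤ t
    2+a≤t = lia 2 (λ a N → con 2 ≼ N ⇒′ con 2 ⊹ a ≼ con 1 ⊹ (a ⊹ N)) refl a N 2≤N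
    z∉lower : ∀ b → suc (b + N) < suc t → ¬ z ∈₃ (b , suc b , suc (b + N))
    z∉lower b lt = lia 4 (λ N z t b → t ≺ z ⇒′ con 2 ⊹ (b ⊹ N) ≼ con 1 ⊹ t ⇒′ ¬′ ∈₃-form z b (con 1 ⊹ b) (con 1 ⊹ (b ⊹ N))) refl N z t b t<z lt
    z∉upper : ∀ b → suc (b + N) < suc t → ¬ z ∈₃ (b , b + N , suc (b + N))
    z∉upper b lt = lia 4 (λ N z t b → t ≺ z ⇒′ con 2 ⊹ (b ⊹ N) ≼ con 1 ⊹ t ⇒′ ¬′ ∈₃-form z b (b ⊹ N) (con 1 ⊹ (b ⊹ N))) refl N z t b t<z lt
    z∉bottom : ∀ k → k < N → ¬ z ∈₃ (0 , k , suc k)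
    z∉bottom k lt = lia 4 (λ N z a k → con 1 ⊹ (a ⊹ N) ≺ z ⇒′ k ≺ N ⇒′ ¬′ ∈₃-form z (con 0) k (con 1 ⊹ k)) refl N z a k t<z lt
    only : ∀ {F} → Helix N z t F → z ∈₃ F → a ∈₃ F → F ≈₃ (z , a , suc a) ⊎ F ≈₃ (z , a , a + N)
    only (lower b lt) z∈ _ = ⊥-elim (z∉lower b (ℕ.m<n⇒m<1+n lt) z∈)
    only (upper b lt) z∈ _ = ⊥-elim (z∉upper b (ℕ.m<n⇒m<1+n lt) z∈)
    only (bottom k _ lt) z∈ _ = ⊥-elim (z∉bottom k lt z∈)
    only (top k le le′) _ a∈ with lia 4 (λ N z a k → con 1 ⊹ (a ⊹ N) ≺ z ⇒′ con 1 ⊹ (a ⊹ N) ≼ con 1 ⊹ (k ⊹ N) ⇒′ ∈₃-form a k (con 1 ⊹ k) z ⇒′ k ≐ a) refl N z a k t<z le a∈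
    ... | refl = inj₁ rotate′
    only (closing b e) _ _ with ℕ.+-cancelʳ-≡ N b a (ℕ.suc-injective e)
    ... | refl = inj₂ reverse
    keep : ∀ {F} → Helix N z t F → ¬ (z ∈₃ F × a ∈₃ F) → Helix N z (suc t) F
    keep (lower b lt) _ = lower b (ℕ.m<n⇒m<1+n lt)
    keep (upper b lt) _ = upper b (ℕ.m<n⇒m<1+n lt)
    keep (bottom k p lt) _ = bottom k p lt
    keep (top k le le′) n = top k (lia 3 (λ N a k → con 1 ⊹ (a ⊹ N) ≼ con 1 ⊹ (k ⊹ N) ⇒′ ¬′ (a ≐ k) ⇒′ con 2 ⊹ (a ⊹ N) ≼ con 1 ⊹ (k ⊹ N)) refl N a k le
      (λ e → n (inj₂ (inj₂ refl) , inj₁ e))) (ℕ.m≤n⇒m≤1+n le′)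
    keep (closing b e) n with ℕ.+-cancelʳ-≡ N b a (ℕ.suc-injective e)
    ... | refl = ⊥-elim (n (inj₂ (inj₂ refl) , inj₂ (inj₁ refl)))
    back : ∀ {F} → Helix N z (suc t) F →
      (F ≈₃ (t , z , suc a) ⊎ F ≈₃ (t , a , suc a) ⊎ F ≈₃ (t , z , a + N) ⊎ F ≈₃ (t , a , a + N)) ⊎ (Helix N z t F × ¬ (z ∈₃ F × a ∈₃ F))
    back (lower b lt) with b ℕ.≟ a
    ... | yes refl = inj₁ (inj₂ (inj₁ rotate′))
    ... | no ne = inj₂ (lower b (lia 3 (λ N a b → con 2 ⊹ (b ⊹ N) ≼ con 2 ⊹ (a ⊹ N) ⇒′ ¬′ (b ≐ a) ⇒′ con 2 ⊹ (b ⊹ N) ≼ con 1 ⊹ (a ⊹ N)) refl N a b lt ne) , z∉lower b lt ∘ proj₁)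
    back (upper b lt) with b ℕ.≟ a
    ... | yes refl = inj₁ (inj₂ (inj₂ (inj₂ rotate′)))
    ... | no ne = inj₂ (upper b (lia 3 (λ N a b → con 2 ⊹ (b ⊹ N) ≼ con 2 ⊹ (a ⊹ N) ⇒′ ¬′ (b ≐ a) ⇒′ con 2 ⊹ (b ⊹ N) ≼ con 1 ⊹ (a ⊹ N)) refl N a b lt ne) , z∉upper b lt ∘ proj₁)
    back (bottom k p lt) = inj₂ (bottom k p lt , z∉bottom k lt ∘ proj₁)
    back (top k le le′) with k ℕ.≟ a + N
    ... | yes refl = inj₁ (inj₂ (inj₂ (inj₁ rotate)))
    ... | no ne = inj₂ (top k (ℕ.<⇒≤ le) (ℕ.≤∧≢⇒< (ℕ.≤-pred le′) (ne ∘ ℕ.suc-injective)) ,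
          λ (_ , a∈) → lia 4 (λ N z a k → con 1 ⊹ (a ⊹ N) ≺ z ⇒′ con 2 ⊹ (a ⊹ N) ≼ con 1 ⊹ (k ⊹ N) ⇒′ ¬′ ∈₃-form a k (con 1 ⊹ k) z) refl N z a k t<z le a∈)
    back (closing b e) with ℕ.+-cancelʳ-≡ N b (suc a) (ℕ.suc-injective e)
    ... | refl = inj₁ (inj₁ (≈₃-trans rotate reverse))

-- Helix polytopes, starting from a tetrahedron.

module HelixPolytope where

  open import Data.Nat as ℕ using (ℕ; zero; suc; _+_; _≤_; _<_; z≤n; s≤s)
  import Data.Nat.Properties as ℕ
  open import Data.Rational as ℚ using (ℚ; 0ℚ; 1ℚ)
  import Data.Rational.Properties as ℚ
  open import Data.Rational.Solver using (module +-*-Solver)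
  open import Data.List using ([]; _∷_)
  open import Data.List.Membership.Propositional using (_∈_)
  open import Data.List.Relation.Unary.Any using (here; there)
  open Lia using (con; lia) renaming (_:+_ to _⊹_; _:≤_ to _≼_; _:<_ to _≺_; _:≡_ to _≐_; _:∨_ to _∨′_; _:⇒_ to _⇒′_; :¬_ to ¬′_)
  open Polytopes
  open Helix

  O E₁ E₂ E₃ : ℚ³
  O = 0ℚ , 0ℚ , 0ℚ
  E₁ = 1ℚ , 0ℚ , 0ℚ
  E₂ = 0ℚ , 1ℚ , 0ℚ
  E₃ = 0ℚ , 0ℚ , 1ℚ

  hO h₁ h₂ h₃ : Aff
  hO = 1ℚ , 1ℚ , 1ℚ , 1ℚ
  h₁ = 0ℚ , ℚ.- 1ℚ , 0ℚ , 0ℚ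
  h₂ = 0ℚ , 0ℚ , ℚ.- 1ℚ , 0ℚ
  h₃ = 0ℚ , 0ℚ , 0ℚ , ℚ.- 1ℚ

  -- `hO`, `h₁`, `h₂`, `h₃` are the barycentric coordinates of the tetrahedron, so this is
  -- interpolation at its four vertices. Both `cone` and `rank` are read off from it.
  barycentric : ∀ f p → eval f p ≡
    (eval f O ℚ.* eval hO p ℚ.+ eval f E₁ ℚ.* eval h₁ p) ℚ.+ (eval f E₂ ℚ.* eval h₂ p ℚ.+ eval f E₃ ℚ.* eval h₃ p)
  barycentric (b , a₁ , a₂ , a₃) (x , y , z) = solve 7 (λ b a₁ a₂ a₃ x y z →
      let 𝟘 = con 0ℚ
          𝟙 = con 1ℚ
          ev = λ b a₁ a₂ a₃ x y z → b :- ((a₁ :* x :+ a₂ :* y) :+ a₃ :* z)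
          f = ev b a₁ a₂ a₃
      in f x y z :=
        (f 𝟘 𝟘 𝟘 :* ev 𝟙 𝟙 𝟙 𝟙 x y z :+ f 𝟙 𝟘 𝟘 :* ev 𝟘 (:- 𝟙) 𝟘 𝟘 x y z) :+
        (f 𝟘 𝟙 𝟘 :* ev 𝟘 𝟘 (:- 𝟙) 𝟘 x y z :+ f 𝟘 𝟘 𝟙 :* ev 𝟘 𝟘 𝟘 (:- 𝟙) x y z)) refl b a₁ a₂ a₃ x y z
    where open +-*-Solver

  -- The standard tetrahedron, with its vertices labelled 0, 1, N and (anything else).
  tetraPoint : ℕ → ℕ → ℚ³
  tetraPoint N zero = O
  tetraPoint N (suc zero) = E₁
  tetraPoint N v@(suc (suc _)) with v ℕ.≟ N
  ... | yes _ = E₂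
  ... | no _ = E₃

  module _ (N z : ℕ) (2≤N : 2 ≤ N) (N<z : N < z) where

    private
      pt : ℕ → ℚ³
      pt = tetraPoint N

      pt-N : pt N ≡ E₂
      pt-N = go N 2≤N refl
        where
        go : ∀ v → 2 ≤ v → v ≡ N → pt v ≡ E₂
        go (suc (suc v)) (s≤s (s≤s _)) e with suc (suc v) ℕ.≟ N
        ... | yes _ = refl
        ... | no ne = ⊥-elim (ne e)

      pt-z : pt z ≡ E₃
      pt-z = go z (ℕ.≤-trans 2≤N (ℕ.<⇒≤ N<z)) (ℕ.>⇒≢ N<z)
        where
        go : ∀ v → 2 ≤ v → v ≢ N → pt v ≡ E₃
        go (suc (suc v)) (s≤s (s≤s _)) ne with suc (suc v) ℕ.≟ N
        ... | yes e = ⊥-elim (ne e)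
        ... | no _ = refl

      fs : Facets
      fs = ((0 , 1 , N) , h₃) ∷ ((z , 1 , N) , hO) ∷ ((0 , 1 , z) , h₂) ∷ ((0 , N , z) , h₁) ∷ []

      sound : ∀ {F h} → (F , h) ∈ fs → ∃ λ F′ → Pre N z 1 F′ × F ≈₃ F′
      sound (here refl) = _ , lo-end , ≈₃-refl
      sound (there (here refl)) = _ , hi-end , ≈₃-refl
      sound (there (there (here refl))) = _ , first , ≈₃-refl
      sound (there (there (there (here refl)))) = _ , last , ≈₃-refl

      complete : ∀ {F} → Pre N z 1 F → ∃₂ λ F′ h → (F′ , h) ∈ fs × F ≈₃ F′
      complete (lo i 1≤i i<1) = ⊥-elim (ℕ.<⇒≱ i<1 1≤i)
      complete (hi i 1≤i i<1) = ⊥-elim (ℕ.<⇒≱ i<1 1≤i)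
      complete lo-end = _ , _ , here refl , ≈₃-refl
      complete hi-end = _ , _ , there (here refl) , ≈₃-refl
      complete first = _ , _ , there (there (here refl)) , ≈₃-refl
      complete last = _ , _ , there (there (there (here refl))) , ≈₃-refl

      V0 : PreV N z 1 0
      V0 = inj₁ z≤n
      V1 : PreV N z 1 1
      V1 = inj₁ ℕ.≤-refl
      VN : PreV N z 1 N
      VN = inj₂ (inj₁ refl)
      Vz : PreV N z 1 z
      Vz = inj₂ (inj₂ refl)

      each : ∀ {a b c v} {P : ℕ → Set} → P a → P b → P c → v ∈₃ (a , b , c) → P v
      each p q r (inj₁ refl) = p
      each p q r (inj₂ (inj₁ refl)) = q
      each p q r (inj₂ (inj₂ refl)) = r

      vertices : ∀ {F h v} → (F , h) ∈ fs → v ∈₃ F → PreV N z 1 v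
      vertices (here refl) = each V0 V1 VN
      vertices (there (here refl)) = each Vz V1 VN
      vertices (there (there (here refl))) = each V0 V1 Vz
      vertices (there (there (there (here refl)))) = each V0 VN Vz

      at-N : ∀ {h s} → eval h E₂ ≡ s → eval h (pt N) ≡ s
      at-N {h} e = trans (cong (eval h) pt-N) e

      at-z : ∀ {h s} → eval h E₃ ≡ s → eval h (pt z) ≡ s
      at-z {h} e = trans (cong (eval h) pt-z) e

      zero-on : ∀ {F h v} → (F , h) ∈ fs → v ∈₃ F → eval h (pt v) ≡ 0ℚ
      zero-on (here refl) = each {P = λ v → eval h₃ (pt v) ≡ 0ℚ} refl refl (at-N {h₃} refl)
      zero-on (there (here refl)) = each {P = λ v → eval hO (pt v) ≡ 0ℚ} (at-z {hO} refl) refl (at-N {hO} refl)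
      zero-on (there (there (here refl))) = each {P = λ v → eval h₂ (pt v) ≡ 0ℚ} refl refl (at-z {h₂} refl)
      zero-on (there (there (there (here refl)))) = each {P = λ v → eval h₁ (pt v) ≡ 0ℚ} refl (at-N {h₁} refl) (at-z {h₁} refl)

      0<1 : ∀ {s} → s ≡ 1ℚ → 0ℚ ℚ.< s
      0<1 refl = ℚ.positive⁻¹ 1ℚ

      pos-off : ∀ {F h v} → (F , h) ∈ fs → PreV N z 1 v → ¬ v ∈₃ F → 0ℚ ℚ.< eval h (pt v)
      pos-off (here refl) (inj₂ (inj₂ refl)) n = 0<1 (at-z {h₃} refl)
      pos-off (here refl) (inj₁ z≤n) n = ⊥-elim (n (inj₁ refl))
      pos-off (here refl) (inj₁ (s≤s z≤n)) n = ⊥-elim (n (inj₂ (inj₁ refl)))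
      pos-off (here refl) (inj₂ (inj₁ e)) n = ⊥-elim (n (inj₂ (inj₂ e)))
      pos-off (there (here refl)) (inj₁ z≤n) n = 0<1 refl
      pos-off (there (here refl)) (inj₁ (s≤s z≤n)) n = ⊥-elim (n (inj₂ (inj₁ refl)))
      pos-off (there (here refl)) (inj₂ (inj₁ e)) n = ⊥-elim (n (inj₂ (inj₂ e)))
      pos-off (there (here refl)) (inj₂ (inj₂ e)) n = ⊥-elim (n (inj₁ e))
      pos-off (there (there (here refl))) (inj₂ (inj₁ refl)) n = 0<1 (at-N {h₂} refl)
      pos-off (there (there (here refl))) (inj₁ z≤n) n = ⊥-elim (n (inj₁ refl))
      pos-off (there (there (here refl))) (inj₁ (s≤s z≤n)) n = ⊥-elim (n (inj₂ (inj₁ refl)))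
      pos-off (there (there (here refl))) (inj₂ (inj₂ e)) n = ⊥-elim (n (inj₂ (inj₂ e)))
      pos-off (there (there (there (here refl)))) (inj₁ (s≤s z≤n)) n = 0<1 refl
      pos-off (there (there (there (here refl)))) (inj₁ z≤n) n = ⊥-elim (n (inj₁ refl))
      pos-off (there (there (there (here refl)))) (inj₂ (inj₁ e)) n = ⊥-elim (n (inj₂ (inj₁ e)))
      pos-off (there (there (there (here refl)))) (inj₂ (inj₂ e)) n = ⊥-elim (n (inj₂ (inj₂ e)))

      cone : ∀ f → (∀ v → PreV N z 1 v → 0ℚ ℚ.≤ eval f (pt v)) → Cone fs f
      cone f nn = cone-resp {g = K₁ ⊞ K₂} (λ p → trans (barycentric f p) (sym (trans (eval-⊞ K₁ K₂ p)
          (cong₂ ℚ._+_ (eval-⊡⊞⊡ (eval f O) hO (eval f E₁) h₁ p) (eval-⊡⊞⊡ (eval f E₂) h₂ (eval f E₃) h₃ p)))))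
        (cone-⊞ K₁ K₂
          (cone-⊞ (eval f O ⊡ hO) (eval f E₁ ⊡ h₁) (cone-generator (eval f O) (nn 0 V0) (there (here refl))) (cone-generator (eval f E₁) (nn 1 V1) (there (there (there (here refl))))))
          (cone-⊞ (eval f E₂ ⊡ h₂) (eval f E₃ ⊡ h₃)
            (cone-generator (eval f E₂) (subst (λ p → 0ℚ ℚ.≤ eval f p) pt-N (nn N VN)) (there (there (here refl))))
            (cone-generator (eval f E₃) (subst (λ p → 0ℚ ℚ.≤ eval f p) pt-z (nn z Vz)) (here refl))))
        where
        K₁ K₂ : Aff
        K₁ = eval f O ⊡ hO ⊞ eval f E₁ ⊡ h₁
        K₂ = eval f E₂ ⊡ h₂ ⊞ eval f E₃ ⊡ h₃

      rank : ∀ {F h} → (F , h) ∈ fs → ∀ f → (∀ v → v ∈₃ F → eval f (pt v) ≡ 0ℚ) → ∃ λ c → ∀ x → eval f x ≡ c ℚ.* eval h x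
      rank (here refl) f zr = eval f E₃ , λ p → trans (barycentric f p) (trans
        (cong₂ ℚ._+_ (cong₂ (λ s t → s ℚ.* eval hO p ℚ.+ t ℚ.* eval h₁ p) (zr 0 (inj₁ refl)) (zr 1 (inj₂ (inj₁ refl))))
          (cong (λ s → s ℚ.* eval h₂ p ℚ.+ eval f E₃ ℚ.* eval h₃ p) (trans (cong (eval f) (sym pt-N)) (zr N (inj₂ (inj₂ refl))))))
        (solve 5 (λ a b c d e → (con 0ℚ :* a :+ con 0ℚ :* b) :+ (con 0ℚ :* c :+ d :* e) := d :* e) refl (eval hO p) (eval h₁ p) (eval h₂ p) (eval f E₃) (eval h₃ p)))
        where open +-*-Solver
      rank (there (here refl)) f zr = eval f O , λ p → trans (barycentric f p) (trans
        (cong₂ ℚ._+_ (cong (λ t → eval f O ℚ.* eval hO p ℚ.+ t ℚ.* eval h₁ p) (zr 1 (inj₂ (inj₁ refl))))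
          (cong₂ (λ s t → s ℚ.* eval h₂ p ℚ.+ t ℚ.* eval h₃ p) (trans (cong (eval f) (sym pt-N)) (zr N (inj₂ (inj₂ refl)))) (trans (cong (eval f) (sym pt-z)) (zr z (inj₁ refl)))))
        (solve 5 (λ a b c d e → (d :* e :+ con 0ℚ :* a) :+ (con 0ℚ :* b :+ con 0ℚ :* c) := d :* e) refl (eval h₁ p) (eval h₂ p) (eval h₃ p) (eval f O) (eval hO p)))
        where open +-*-Solver
      rank (there (there (here refl))) f zr = eval f E₂ , λ p → trans (barycentric f p) (trans
        (cong₂ ℚ._+_ (cong₂ (λ s t → s ℚ.* eval hO p ℚ.+ t ℚ.* eval h₁ p) (zr 0 (inj₁ refl)) (zr 1 (inj₂ (inj₁ refl))))
          (cong (λ t → eval f E₂ ℚ.* eval h₂ p ℚ.+ t ℚ.* eval h₃ p) (trans (cong (eval f) (sym pt-z)) (zr z (inj₂ (inj₂ refl))))))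
        (solve 5 (λ a b c d e → (con 0ℚ :* a :+ con 0ℚ :* b) :+ (d :* e :+ con 0ℚ :* c) := d :* e) refl (eval hO p) (eval h₁ p) (eval h₃ p) (eval f E₂) (eval h₂ p)))
        where open +-*-Solver
      rank (there (there (there (here refl)))) f zr = eval f E₁ , λ p → trans (barycentric f p) (trans
        (cong₂ ℚ._+_ (cong (λ s → s ℚ.* eval hO p ℚ.+ eval f E₁ ℚ.* eval h₁ p) (zr 0 (inj₁ refl)))
          (cong₂ (λ s t → s ℚ.* eval h₂ p ℚ.+ t ℚ.* eval h₃ p) (trans (cong (eval f) (sym pt-N)) (zr N (inj₂ (inj₁ refl)))) (trans (cong (eval f) (sym pt-z)) (zr z (inj₂ (inj₂ refl))))))
        (solve 5 (λ a b c d e → (con 0ℚ :* a :+ d :* e) :+ (con 0ℚ :* b :+ con 0ℚ :* c) := d :* e) refl (eval hO p) (eval h₂ p) (eval h₃ p) (eval f E₁) (eval h₁ p)))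
        where open +-*-Solver

      Across : Triple → ℕ → Set
      Across F v = ∃₂ λ G g → (G , g) ∈ fs × ¬ v ∈₃ G × (∀ w → w ∈₃ F → w ≢ v → w ∈₃ G)

      others : ∀ {a b c v G} → (a ≢ v → a ∈₃ G) → (b ≢ v → b ∈₃ G) → (c ≢ v → c ∈₃ G) → ∀ w → w ∈₃ (a , b , c) → w ≢ v → w ∈₃ G
      others p q r w (inj₁ refl) = p
      others p q r w (inj₂ (inj₁ refl)) = q
      others p q r w (inj₂ (inj₂ refl)) = r

      absurd : ∀ {a : ℕ} {A : Set} → a ≢ a → A
      absurd n = ⊥-elim (n refl)

      1st : ∀ {a b c : ℕ} → a ∈₃ (a , b , c)
      1st = inj₁ refl
      2nd : ∀ {a b c : ℕ} → b ∈₃ (a , b , c)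
      2nd = inj₂ (inj₁ refl)
      3rd : ∀ {a b c : ℕ} → c ∈₃ (a , b , c)
      3rd = inj₂ (inj₂ refl)

      0∉ : ¬ 0 ∈₃ (z , 1 , N)
      0∉ = lia 2 (λ N z → con 2 ≼ N ⇒′ N ≺ z ⇒′ ¬′ ∈₃-form (con 0) z (con 1) N) refl N z 2≤N N<z
      1∉ : ¬ 1 ∈₃ (0 , N , z)
      1∉ = lia 2 (λ N z → con 2 ≼ N ⇒′ N ≺ z ⇒′ ¬′ ∈₃-form (con 1) (con 0) N z) refl N z 2≤N N<z
      N∉ : ¬ N ∈₃ (0 , 1 , z)
      N∉ = lia 2 (λ N z → con 2 ≼ N ⇒′ N ≺ z ⇒′ ¬′ ∈₃-form N (con 0) (con 1) z) refl N z 2≤N N<z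
      z∉ : ¬ z ∈₃ (0 , 1 , N)
      z∉ = lia 2 (λ N z → con 2 ≼ N ⇒′ N ≺ z ⇒′ ¬′ ∈₃-form z (con 0) (con 1) N) refl N z 2≤N N<z

      across : ∀ {F h v} → (F , h) ∈ fs → v ∈₃ F → Across F v
      across (here refl) (inj₁ refl) = _ , _ , there (here refl) , 0∉ , others absurd (λ _ → 2nd) (λ _ → 3rd)
      across (here refl) (inj₂ (inj₁ refl)) = _ , _ , there (there (there (here refl))) , 1∉ , others (λ _ → 1st) absurd (λ _ → 2nd)
      across (here refl) (inj₂ (inj₂ refl)) = _ , _ , there (there (here refl)) , N∉ , others (λ _ → 1st) (λ _ → 2nd) absurd
      across (there (here refl)) (inj₁ refl) = _ , _ , here refl , z∉ , others absurd (λ _ → 2nd) (λ _ → 3rd)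
      across (there (here refl)) (inj₂ (inj₁ refl)) = _ , _ , there (there (there (here refl))) , 1∉ , others (λ _ → 3rd) absurd (λ _ → 2nd)
      across (there (here refl)) (inj₂ (inj₂ refl)) = _ , _ , there (there (here refl)) , N∉ , others (λ _ → 3rd) (λ _ → 2nd) absurd
      across (there (there (here refl))) (inj₁ refl) = _ , _ , there (here refl) , 0∉ , others absurd (λ _ → 2nd) (λ _ → 1st)
      across (there (there (here refl))) (inj₂ (inj₁ refl)) = _ , _ , there (there (there (here refl))) , 1∉ , others (λ _ → 1st) absurd (λ _ → 3rd)
      across (there (there (here refl))) (inj₂ (inj₂ refl)) = _ , _ , here refl , z∉ , others (λ _ → 1st) (λ _ → 2nd) absurd
      across (there (there (there (here refl)))) (inj₁ refl) = _ , _ , there (here refl) , 0∉ , others absurd (λ _ → 3rd) (λ _ → 1st)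
      across (there (there (there (here refl)))) (inj₂ (inj₁ refl)) = _ , _ , there (there (here refl)) , N∉ , others (λ _ → 1st) absurd (λ _ → 3rd)
      across (there (there (there (here refl)))) (inj₂ (inj₂ refl)) = _ , _ , here refl , z∉ , others (λ _ → 1st) (λ _ → 3rd) absurd

    tetrahedron : Polytope (PreV N z 1) (Pre N z 1)
    tetrahedron = record
      { point = pt ; facets = fs ; sound = sound ; complete = complete ; vertices = vertices
      ; zero-on = zero-on ; pos-off = pos-off ; cone = cone ; rank = rank ; across = across }

    pre-polytope : ∀ k → 1 ≤ k → k < N → Polytope (PreV N z k) (Pre N z k)
    pre-polytope (suc zero) _ _ = tetrahedron
    pre-polytope (suc (suc k)) _ lt = pre-step N z (suc k) (s≤s z≤n) lt N<z (pre-polytope (suc k) (s≤s z≤n) (ℕ.<-trans (ℕ.n<1+n (suc k)) lt))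

  -- With N = m + 2, the double cone over 1, …, N is the helix with t = N + 1.
  pre⇒helix : ∀ m z → suc (suc m) < z → Polytope (PreV (suc (suc m)) z (suc m)) (Pre (suc (suc m)) z (suc m)) →
    Polytope (HelixV z (suc (suc (suc m)))) (Helix (suc (suc m)) z (suc (suc (suc m))))
  pre⇒helix m z N<z = relabel
    (λ {v} → lia 3 (λ m z v → (v ≼ con 1 ⊹ m ∨′ v ≐ con 2 ⊹ m ∨′ v ≐ z) ⇒′ (v ≺ con 3 ⊹ m ∨′ v ≐ z)) refl m z v)
    (λ {v} → lia 3 (λ m z v → (v ≺ con 3 ⊹ m ∨′ v ≐ z) ⇒′ (v ≼ con 1 ⊹ m ∨′ v ≐ con 2 ⊹ m ∨′ v ≐ z)) refl m z v)
    to from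
    where
    N = suc (suc m)
    t = suc N
    to : ∀ {F} → Pre N z (suc m) F → ∃ λ F′ → Helix N z t F′ × F ≈₃ F′
    to (lo i 1≤i lt) = _ , bottom i 1≤i (ℕ.m<n⇒m<1+n lt) , ≈₃-refl
    to (hi i 1≤i lt) = _ , top i (s≤s (ℕ.m≤n+m N i)) (s≤s (s≤s (ℕ.<⇒≤ lt))) , rotate
    to lo-end = _ , bottom (suc m) (s≤s z≤n) ℕ.≤-refl , ≈₃-refl
    to hi-end = _ , top (suc m) (s≤s (ℕ.m≤n+m N (suc m))) ℕ.≤-refl , rotate
    to first = _ , top 0 ℕ.≤-refl (s≤s (s≤s z≤n)) , ≈₃-refl
    to last = _ , closing 0 refl , exchange
    from : ∀ {F} → Helix N z t F → ∃ λ F′ → Pre N z (suc m) F′ × F ≈₃ F′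
    from (lower a lt) = ⊥-elim (lia 2 (λ a m → ¬′ (con 2 ⊹ (a ⊹ (con 2 ⊹ m)) ≼ con 3 ⊹ m)) refl a m lt)
    from (upper a lt) = ⊥-elim (lia 2 (λ a m → ¬′ (con 2 ⊹ (a ⊹ (con 2 ⊹ m)) ≼ con 3 ⊹ m)) refl a m lt)
    from (bottom k 1≤k lt) with k ℕ.≟ suc m
    ... | yes refl = _ , lo-end , ≈₃-refl
    ... | no ne = _ , lo k 1≤k (ℕ.≤∧≢⇒< (ℕ.≤-pred lt) ne) , ≈₃-refl
    from (top zero _ _) = _ , first , ≈₃-refl
    from (top (suc k) _ le) with suc k ℕ.≟ suc m
    ... | yes refl = _ , hi-end , ≈₃-sym rotate
    ... | no ne = _ , hi (suc k) (s≤s z≤n) (ℕ.≤∧≢⇒< (ℕ.≤-pred (ℕ.≤-pred le)) ne) , ≈₃-sym rotate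
    from (closing a e) with ℕ.+-cancelʳ-≡ N a 0 (ℕ.suc-injective e)
    ... | refl = _ , last , exchange

  -- `z` keeps its label throughout the induction on `t`. The theorem takes t = z, where the labels
  -- are 0, ..., z without gaps.
  helix-polytope : ∀ N z → 2 ≤ N → ∀ t → N < t → t ≤ z → Polytope (HelixV z t) (Helix N z t)
  helix-polytope (suc (suc m)) z 2≤N@(s≤s (s≤s _)) t N<t t≤z = go t N<t t≤z
    where
    N = suc (suc m)
    N<z = ℕ.<-≤-trans N<t t≤z
    go : ∀ t → N < t → t ≤ z → Polytope (HelixV z t) (Helix N z t)
    go (suc t) (s≤s N≤t) t<z with t ℕ.≟ N
    ... | yes refl = pre⇒helix m z N<z (pre-polytope N z 2≤N N<z (suc m) (s≤s z≤n) ℕ.≤-refl)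
    ... | no ne with go t (ℕ.≤∧≢⇒< N≤t (ne ∘ sym)) (ℕ.<⇒≤ t<z)
    ...   | P = subst (λ s → Polytope (HelixV z (suc s)) (Helix N z (suc s))) eq
              (helix-step N z a 2≤N (subst (_< z) (sym eq) t<z) (subst (λ s → Polytope (HelixV z s) (Helix N z s)) (sym eq) P))
      where
      a = t ℕ.∸ suc N
      eq : suc (a + N) ≡ t
      eq = trans (sym (ℕ.+-suc a N)) (ℕ.m∸n+n≡m (ℕ.≤∧≢⇒< N≤t (ne ∘ sym)))

-- From facets to the faces cut out by supporting planes.

module Realizations where

  open import Data.Nat as ℕ using (ℕ)
  import Data.Nat.Properties as ℕ
  open import Data.Fin using (Fin; zero; suc; toℕ; fromℕ<)
  open import Data.Fin.Properties using (toℕ-injective; toℕ-fromℕ<; toℕ<n)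
  open import Data.Fin.Subset using (Subset; _∈_; _∉_; ⁅_⁆)
  open import Data.Fin.Subset.Properties using (_∈?_; x∈⁅y⁆⇒x≡y; nonempty?)
  open import Data.Rational
  open import Data.Rational.Properties
  open import Data.Rational.Solver using (module +-*-Solver)
  open import Data.List.Membership.Propositional using () renaming (_∈_ to _∈ₗ_)
  open Rationals
  open Polytopes
  open Subdivide using (·-⊕; ·-⊙)

  ·-0³ : ∀ a → a · 0³ ≡ 0ℚ
  ·-0³ (a , b , c) = solve 3 (λ a b c → (a :* con 0ℚ :+ b :* con 0ℚ) :+ c :* con 0ℚ := con 0ℚ) refl a b c
    where open +-*-Solver

  0³-· : ∀ x → 0³ · x ≡ 0ℚ
  0³-· (x , y , z) = solve 3 (λ a b c → (con 0ℚ :* a :+ con 0ℚ :* b) :+ con 0ℚ :* c := con 0ℚ) refl x y z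
    where open +-*-Solver

  eval-nonconstant : ∀ f x y → eval f x ≢ eval f y → proj₂ f ≢ 0³
  eval-nonconstant (b , a) x y ne refl = ne (cong (λ t → b - t) (trans (0³-· x) (sym (0³-· y))))

  eval-vanishing : ∀ f → (∀ x → eval f x ≡ 0ℚ) → proj₂ f ≡ 0³
  eval-vanishing (b , a₁ , a₂ , a₃) z = cong₂ _,_ (trans (at₁ b a₁ a₂ a₃) (difference (1ℚ , 0ℚ , 0ℚ)))
    (cong₂ _,_ (trans (at₂ b a₁ a₂ a₃) (difference (0ℚ , 1ℚ , 0ℚ))) (trans (at₃ b a₁ a₂ a₃) (difference (0ℚ , 0ℚ , 1ℚ))))
    where
    open +-*-Solver
    f : Aff
    f = b , a₁ , a₂ , a₃
    difference : ∀ x → eval f 0³ - eval f x ≡ 0ℚ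
    difference x = cong₂ _-_ (z 0³) (z x)
    ev : Polynomial 4 → Polynomial 4 → Polynomial 4 → Polynomial 4 → Polynomial 4 → Polynomial 4 → Polynomial 4 → Polynomial 4
    ev b a₁ a₂ a₃ x y z = b :- ((a₁ :* x :+ a₂ :* y) :+ a₃ :* z)
    at₁ : ∀ b a₁ a₂ a₃ → a₁ ≡ eval (b , a₁ , a₂ , a₃) 0³ - eval (b , a₁ , a₂ , a₃) (1ℚ , 0ℚ , 0ℚ)
    at₁ = solve 4 (λ b a₁ a₂ a₃ → a₁ := ev b a₁ a₂ a₃ (con 0ℚ) (con 0ℚ) (con 0ℚ) :- ev b a₁ a₂ a₃ (con 1ℚ) (con 0ℚ) (con 0ℚ)) refl
    at₂ : ∀ b a₁ a₂ a₃ → a₂ ≡ eval (b , a₁ , a₂ , a₃) 0³ - eval (b , a₁ , a₂ , a₃) (0ℚ , 1ℚ , 0ℚ)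
    at₂ = solve 4 (λ b a₁ a₂ a₃ → a₂ := ev b a₁ a₂ a₃ (con 0ℚ) (con 0ℚ) (con 0ℚ) :- ev b a₁ a₂ a₃ (con 0ℚ) (con 1ℚ) (con 0ℚ)) refl
    at₃ : ∀ b a₁ a₂ a₃ → a₃ ≡ eval (b , a₁ , a₂ , a₃) 0³ - eval (b , a₁ , a₂ , a₃) (0ℚ , 0ℚ , 1ℚ)
    at₃ = solve 4 (λ b a₁ a₂ a₃ → a₃ := ev b a₁ a₂ a₃ (con 0ℚ) (con 0ℚ) (con 0ℚ) :- ev b a₁ a₂ a₃ (con 0ℚ) (con 0ℚ) (con 1ℚ)) refl

  sum-eval : ∀ {m} b a (c : Fin m → ℚ) (p : Fin m → ℚ³) →
    sumℚ (λ i → c i * eval (b , a) (p i)) ≡ b * sumℚ c - a · sumℚ³ (λ i → c i ⊙ p i)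
  sum-eval {ℕ.zero} b a c p = sym (trans (cong₂ (λ s t → s - t) (*-zeroʳ b) (·-0³ a)) refl)
  sum-eval {ℕ.suc m} b a c p = trans (cong (c zero * eval (b , a) (p zero) +_) (sum-eval b a (c ∘ suc) (p ∘ suc)))
    (trans (solve 5 (λ c b l s t → c :* (b :- l) :+ (b :* s :- t) := b :* (c :+ s) :- (c :* l :+ t)) refl
        (c zero) b (a · p zero) (sumℚ (c ∘ suc)) (a · sumℚ³ (λ i → c (suc i) ⊙ p (suc i))))
      (cong (λ t → b * (c zero + sumℚ (c ∘ suc)) - t)
        (sym (trans (·-⊕ a (c zero ⊙ p zero) _) (cong (_+ a · sumℚ³ (λ i → c (suc i) ⊙ p (suc i))) (·-⊙ a (c zero) (p zero)))))))
    where open +-*-Solver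

  sum-zero : ∀ {m} (f : Fin m → ℚ) → (∀ i → f i ≡ 0ℚ) → sumℚ f ≡ 0ℚ
  sum-zero {ℕ.zero} f z = refl
  sum-zero {ℕ.suc m} f z = trans (cong₂ _+_ (z zero) (sum-zero (f ∘ suc) (z ∘ suc))) (+-identityˡ 0ℚ)

  sum-single : ∀ {m} (f : Fin m → ℚ) j → (∀ i → i ≢ j → f i ≡ 0ℚ) → sumℚ f ≡ f j
  sum-single {ℕ.suc m} f zero z = trans (cong (f zero +_) (sum-zero (f ∘ suc) λ i → z (suc i) λ ())) (+-identityʳ (f zero))
  sum-single {ℕ.suc m} f (suc j) z = trans (cong₂ _+_ (z zero λ ()) (sum-single (f ∘ suc) j λ i ne → z (suc i) λ { refl → ne refl })) (+-identityˡ (f (suc j)))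

  module Realization {V : ℕ → Set} {Φ : Triple → Set} (P : Polytope V Φ) (m : ℕ) (V⇒< : ∀ {v} → V v → v ℕ.< m) (<⇒V : ∀ {v} → v ℕ.< m → V v)
    (covered : ∀ v → v ℕ.< m → ∃ λ F → Φ F × v ∈₃ F)
    (some-facet : ∃ Φ)
    (outside : ∀ F → ∃ λ v → v ℕ.< m × ¬ v ∈₃ F) where

    open Polytope P

    p : Fin m → ℚ³
    p j = point (toℕ j)

    Within : Subset m → Triple → Set
    Within T F = ∀ j → j ∈ T → toℕ j ∈₃ F

    private
      Vj : ∀ (j : Fin m) → V (toℕ j)
      Vj j = <⇒V (toℕ<n j)

      polyFace : ∀ {T} f → proj₂ f ≢ 0³ → (∀ j → j ∈ T → eval f (p j) ≡ 0ℚ) → (∀ j → j ∉ T → 0ℚ < eval f (p j)) → PolyFace p T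
      polyFace (b , a) ne z pos = a , b , ne , λ j →
        (λ j∈ → trans (solve 2 (λ b l → l := b :- (b :- l)) refl b (a · p j)) (trans (cong (λ t → b - t) (z j j∈)) (+-identityʳ b))) ,
        (λ j∉ → sub⇒< (pos j j∉))
        where open +-*-Solver

    module _ {F : Triple} {h : Aff} (i : (F , h) ∈ₗ facets) (T : Subset m) (T⊆F : Within T F) where

      private
        a b c : ℕ
        a = proj₁ F
        b = proj₁ (proj₂ F)
        c = proj₂ (proj₂ F)

        Cut : ℕ → Set
        Cut v = ∃ λ g → (∀ u → V u → 0ℚ ≤ eval g (point u)) × (∀ j → j ∈ T → eval g (p j) ≡ 0ℚ) ×
          (∀ j → j ∉ T → toℕ j ≡ v → 0ℚ < eval g (point v))

        -- If `v` is not in `T`, the facet across the edge opposite `v` contains all of `T`. If it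
        -- is, nothing is asked at `v` and the zero function serves.
        cut : ∀ v → v ∈₃ F → Cut v
        cut v v∈ with fromℕ< (V⇒< (vertices i v∈)) ∈? T
        ... | yes v∈T = 0ℚ ⊡ h , (λ u _ → ≤-reflexive (sym (zero-at (point u)))) , (λ j _ → zero-at (p j)) ,
              λ j j∉ e → ⊥-elim (j∉ (subst (_∈ T) (toℕ-injective (trans (toℕ-fromℕ< (V⇒< (vertices i v∈))) (sym e))) v∈T))
          where
          zero-at : ∀ x → eval (0ℚ ⊡ h) x ≡ 0ℚ
          zero-at x = trans (eval-⊡ 0ℚ h x) (*-zeroˡ (eval h x))
        ... | no v∉T with across i v∈
        ...   | G , g , i′ , v∉G , rest = g , (λ u → nonneg-on i′) ,
                (λ j j∈ → zero-on i′ (rest (toℕ j) (T⊆F j j∈) λ { refl →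
                  v∉T (subst (_∈ T) (toℕ-injective (sym (toℕ-fromℕ< (V⇒< (vertices i v∈))))) j∈) })) ,
                λ j _ _ → pos-off i′ (vertices i v∈) v∉G

        cut-a : Cut a
        cut-a = cut a (inj₁ refl)
        cut-b : Cut b
        cut-b = cut b (inj₂ (inj₁ refl))
        cut-c : Cut c
        cut-c = cut c (inj₂ (inj₂ refl))

        -- `h` is positive off `F`, and each cut is positive at its vertex of `F` unless that vertex
        -- is in `T`. The sum exposes exactly `T`.
        support : Aff
        support = (h ⊞ proj₁ cut-a) ⊞ (proj₁ cut-b ⊞ proj₁ cut-c)

        support-at : ∀ x → eval support x ≡ (eval h x + eval (proj₁ cut-a) x) + (eval (proj₁ cut-b) x + eval (proj₁ cut-c) x)
        support-at x = trans (eval-⊞ (h ⊞ proj₁ cut-a) (proj₁ cut-b ⊞ proj₁ cut-c) x) (cong₂ _+_ (eval-⊞ h (proj₁ cut-a) x) (eval-⊞ (proj₁ cut-b) (proj₁ cut-c) x))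

        nonneg-cut : ∀ {v} (k : Cut v) j → 0ℚ ≤ eval (proj₁ k) (p j)
        nonneg-cut k j = proj₁ (proj₂ k) (toℕ j) (Vj j)

        support-zero : ∀ j → j ∈ T → eval support (p j) ≡ 0ℚ
        support-zero j j∈ = trans (support-at (p j)) (cong₂ _+_
          (cong₂ _+_ (zero-on i (T⊆F j j∈)) (proj₁ (proj₂ (proj₂ cut-a)) j j∈))
          (cong₂ _+_ (proj₁ (proj₂ (proj₂ cut-b)) j j∈) (proj₁ (proj₂ (proj₂ cut-c)) j j∈)))

        support-pos : ∀ j → j ∉ T → 0ℚ < eval support (p j)
        support-pos j j∉ = subst (0ℚ <_) (sym (support-at (p j))) (positive-part (toℕ j ∈₃? F))
          where
          positive-part : Dec (toℕ j ∈₃ F) → 0ℚ < (eval h (p j) + eval (proj₁ cut-a) (p j)) + (eval (proj₁ cut-b) (p j) + eval (proj₁ cut-c) (p j))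
          positive-part (no n) = +-pos-nonneg (+-pos-nonneg (pos-off i (Vj j) n) (nonneg-cut cut-a j)) (+-nonneg (nonneg-cut cut-b j) (nonneg-cut cut-c j))
          positive-part (yes (inj₁ e)) = +-pos-nonneg (+-nonneg-pos (nonneg-on i (Vj j)) (subst (λ v → 0ℚ < eval (proj₁ cut-a) (point v)) (sym e) (proj₂ (proj₂ (proj₂ cut-a)) j j∉ e)))
            (+-nonneg (nonneg-cut cut-b j) (nonneg-cut cut-c j))
          positive-part (yes (inj₂ (inj₁ e))) = +-nonneg-pos (+-nonneg (nonneg-on i (Vj j)) (nonneg-cut cut-a j))
            (+-pos-nonneg (subst (λ v → 0ℚ < eval (proj₁ cut-b) (point v)) (sym e) (proj₂ (proj₂ (proj₂ cut-b)) j j∉ e)) (nonneg-cut cut-c j))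
          positive-part (yes (inj₂ (inj₂ e))) = +-nonneg-pos (+-nonneg (nonneg-on i (Vj j)) (nonneg-cut cut-a j))
            (+-nonneg-pos (nonneg-cut cut-b j) (subst (λ v → 0ℚ < eval (proj₁ cut-c) (point v)) (sym e) (proj₂ (proj₂ (proj₂ cut-c)) j j∉ e)))

        out : ∃ λ v → v ℕ.< m × ¬ v ∈₃ F
        out = outside F

        o : Fin m
        o = fromℕ< (proj₁ (proj₂ out))

        o∉F : ¬ toℕ o ∈₃ F
        o∉F = subst (λ v → ¬ v ∈₃ F) (sym (toℕ-fromℕ< (proj₁ (proj₂ out)))) (proj₂ (proj₂ out))

        h-nonconstant : proj₂ h ≢ 0³
        h-nonconstant = eval-nonconstant h (point a) (p o) λ e →
          pos⇒≢ (pos-off i (Vj o) o∉F) (trans (sym e) (zero-on i (inj₁ refl)))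

      within⇒face : PolyFace p T
      within⇒face with nonempty? T
      ... | yes (t , t∈) = polyFace support (eval-nonconstant support (p t) (p o) λ e →
              pos⇒≢ (support-pos o (o∉F ∘ T⊆F o)) (trans (sym e) (support-zero t t∈))) support-zero support-pos
      -- For empty `T` the plane of `F` is moved off the polytope by raising its constant by one.
      ... | no empty = polyFace (1ℚ + proj₁ h , proj₂ h) h-nonconstant (λ j j∈ → ⊥-elim (empty (j , j∈)))
              λ j _ → subst (0ℚ <_) (sym (solve 2 (λ b l → (con 1ℚ :+ b) :- l := con 1ℚ :+ (b :- l)) refl (proj₁ h) (proj₂ h · p j)))
                (+-pos-nonneg (positive⁻¹ 1ℚ) (nonneg-on i (Vj j)))
        where open +-*-Solver

    -- In a conic combination with value 0 at the points of T, every function with a positive coefficient vanishes on T.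
    cone⇒within : ∀ {f} (T : Subset m) → (∀ j → j ∈ T → eval f (p j) ≡ 0ℚ) → Cone facets f →
      (∀ x → eval f x ≡ 0ℚ) ⊎ ∃₂ λ F h → (F , h) ∈ₗ facets × Within T F
    cone⇒within T z (nil e) = inj₁ e
    cone⇒within {f} T z (cons {g = g} {F} {h} c c≥0 i k e) with c ≟ 0ℚ
    ... | yes c≡0 with cone⇒within {g} T (λ j j∈ → trans (sym (f≗g (p j))) (z j j∈)) k
      where
      f≗g : ∀ x → eval f x ≡ eval g x
      f≗g x = trans (e x) (trans (cong (λ t → t * eval h x + eval g x) c≡0) (trans (cong (_+ eval g x) (*-zeroˡ (eval h x))) (+-identityˡ (eval g x))))
    ...   | inj₁ g≗0 = inj₁ λ x → trans (e x) (trans (cong₂ _+_ (trans (cong (_* eval h x) c≡0) (*-zeroˡ (eval h x))) (g≗0 x)) (+-identityʳ 0ℚ))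
    ...   | inj₂ found = inj₂ found
    cone⇒within {f} T z (cons {g = g} {F} {h} c c≥0 i k e) | no c≢0 = inj₂ (F , h , i , within)
      where
      c>0 : 0ℚ < c
      c>0 = nonneg∧≢⇒pos c≥0 c≢0
      within : Within T F
      within j j∈ with toℕ j ∈₃? F
      ... | yes q = q
      ... | no n = ⊥-elim (pos⇒≢ (+-pos-nonneg (*-pos c>0 (pos-off i (Vj j) n)) (cone-nonneg {f = g} (λ l → nonneg-on l (Vj j)) k))
              (trans (sym (e (p j))) (z j j∈)))

    face⇒within : ∀ T → PolyFace p T → ∃₂ λ F h → (F , h) ∈ₗ facets × Within T F
    face⇒within T (a , b , a≢0 , f) with cone⇒within T zero-T (cone (b , a) nonneg)
      where
      open +-*-Solver
      eval-0 : ∀ x → a · x ≡ b → eval (b , a) x ≡ 0ℚ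
      eval-0 x e = trans (cong (λ t → b - t) e) (+-inverseʳ b)
      zero-T : ∀ j → j ∈ T → eval (b , a) (p j) ≡ 0ℚ
      zero-T j j∈ = eval-0 (p j) (proj₁ (f j) j∈)
      nonneg : ∀ v → V v → 0ℚ ≤ eval (b , a) (point v)
      nonneg v Vv with fromℕ< (V⇒< Vv) ∈? T
      ... | yes j∈ = subst (λ v → 0ℚ ≤ eval (b , a) (point v)) (toℕ-fromℕ< (V⇒< Vv)) (≤-reflexive (sym (zero-T _ j∈)))
      ... | no j∉ = subst (λ v → 0ℚ ≤ eval (b , a) (point v)) (toℕ-fromℕ< (V⇒< Vv)) (<⇒≤ (<⇒sub (proj₂ (f _) j∉)))
    ... | inj₁ z = ⊥-elim (a≢0 (eval-vanishing (b , a) z))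
    ... | inj₂ found = found

    -- Evaluate the dependency with the function of the facet across from `j`: it vanishes at the
    -- other points of `T`, so only the term of `j` is left.
    independent : ∀ T → PolyFace p T → AffinelyIndependent p T
    independent T face c supp Σc Σcp j with j ∈? T | face⇒within T face
    ... | no j∉ | _ = supp j j∉
    ... | yes j∈ | F , h , i , T⊆F with across i (T⊆F j j∈)
    ...   | G , (b , a) , i′ , j∉G , rest = *-cancel-≡0 (eval (b , a) (p j)) (c j) (pos-off i′ (Vj j) j∉G)
            (trans (*-comm (eval (b , a) (p j)) (c j)) (trans (sym (sum-single (λ k → c k * eval (b , a) (p k)) j others))
              (trans (sum-eval b a c p) (trans (cong₂ (λ s t → b * s - a · t) Σc Σcp) (trans (cong₂ (λ s t → s - t) (*-zeroʳ b) (·-0³ a)) refl)))))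
      where
      others : ∀ k → k ≢ j → c k * eval (b , a) (p k) ≡ 0ℚ
      others k ne with k ∈? T
      ... | no k∉ = trans (cong (_* eval (b , a) (p k)) (supp k k∉)) (*-zeroˡ (eval (b , a) (p k)))
      ... | yes k∈ = trans (cong (c k *_) (zero-on i′ (rest (toℕ k) (T⊆F k k∈) (ne ∘ toℕ-injective)))) (*-zeroʳ (c k))

    -- By `rank`, a function vanishing at all vertices is a multiple of `h`, and a vertex outside
    -- `F` makes the factor zero.
    full-dimensional : ∀ a b → a ≢ 0³ → ¬ (∀ j → a · p j ≡ b)
    full-dimensional a b a≢0 on-plane with complete (proj₂ some-facet)
    ... | F , h , i , _ with outside F
    ...   | v , v<m , v∉F with rank i (b , a) (λ u u∈ → zero-at (V⇒< (vertices i u∈)))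
      where
      zero-at : ∀ {u} → u ℕ.< m → eval (b , a) (point u) ≡ 0ℚ
      zero-at lt = trans (cong (λ v → eval (b , a) (point v)) (sym (toℕ-fromℕ< lt))) (trans (cong (λ t → b - t) (on-plane (fromℕ< lt))) (+-inverseʳ b))
    ...     | c , e = a≢0 (eval-vanishing (b , a) λ x → trans (e x) (trans (cong (_* eval h x) c≡0) (*-zeroˡ (eval h x))))
      where
      c≡0 : c ≡ 0ℚ
      c≡0 = *-cancel-≡0 (eval h (point v)) c (pos-off i (<⇒V v<m) v∉F) (trans (*-comm (eval h (point v)) c) (trans (sym (e (point v)))
        (trans (cong (λ v → eval (b , a) (point v)) (sym (toℕ-fromℕ< v<m))) (trans (cong (λ t → b - t) (on-plane (fromℕ< v<m))) (+-inverseʳ b)))))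

    simplicial : IsSimplicial3PolytopeVertices p
    simplicial = vertex , full-dimensional , independent
      where
      vertex : ∀ j → PolyFace p ⁅ j ⁆
      vertex j with covered (toℕ j) (toℕ<n j)
      ... | F , φ , j∈ with complete φ
      ...   | F′ , h , i , e = within⇒face i ⁅ j ⁆ λ k k∈ → subst (λ k → toℕ k ∈₃ F′) (sym (x∈⁅y⁆⇒x≡y j k∈)) (proj₁ e (toℕ j) j∈)

    within-Φ⇒face : ∀ {F} T → Φ F → Within T F → PolyFace p T
    within-Φ⇒face T φ T⊆F with complete φ
    ... | F′ , h , i , e = within⇒face i T λ j j∈ → proj₁ e (toℕ j) (T⊆F j j∈)

    face⇒within-Φ : ∀ T → PolyFace p T → ∃ λ F → Φ F × Within T F
    face⇒within-Φ T face with face⇒within T face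
    ... | F , h , i , T⊆F with sound i
    ...   | F′ , φ , e = F′ , φ , λ j j∈ → proj₁ e (toℕ j) (T⊆F j j∈)

-- Helix triangles in grid coordinates.

module TriangleCodes where

  open import Data.Nat
  open import Data.Nat.Properties
  open import Data.Nat.DivMod using (_/_; _%_; m≡m%n+[m/n]*n; m%n<n)
  open import Relation.Binary.Definitions using (tri<; tri≈; tri>)
  open Lia using (Exp; con; _:+_; Form; _:≤_; _:<_; _:≡_; :⊥; _:∧_; _:∨_; _:⇒_; :¬_; lia)
  open FacetCodes
  open Polytopes using (Triple; _∈₃_)
  open Helix using (Helix; lower; upper; bottom; top; closing)

  -- How r * N depends on C * N, N = n + 1, when r is C, C - 1 or C + 1.
  rowForm : ∀ {j} (n r C rN CN : Exp j) → Form j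
  rowForm n r C rN CN = (r :≡ C :⇒ rN :≡ CN) :∧ (con 1 :+ r :≡ C :⇒ rN :+ (con 1 :+ n) :≡ CN) :∧ (r :≡ con 1 :+ C :⇒ rN :≡ CN :+ (con 1 :+ n))

  pointsForm : ∀ {j} (s r S₁ C₁ S₂ C₂ S₃ C₃ : Exp j) → Form j
  pointsForm s r S₁ C₁ S₂ C₂ S₃ C₃ = (s :≡ S₁ :∧ r :≡ C₁) :∨ (s :≡ S₂ :∧ r :≡ C₂) :∨ (s :≡ S₃ :∧ r :≡ C₃)

  module _ (n : ℕ) (n≥1 : 1 ≤ n) where

    private
      N M : ℕ
      N = suc n
      M = n * N + n

    label : ℕ → ℕ → ℕ
    label s r = r * N + s

    rows : ∀ r C → (r ≡ C → r * N ≡ C * N) × (suc r ≡ C → r * N + N ≡ C * N) × (r ≡ suc C → r * N ≡ C * N + N)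
    rows r C = cong (_* N) , (λ { refl → +-comm (r * N) N }) , (λ { refl → +-comm N (C * N) })

    row-<  : ∀ {r C} → r < C → r * N + N ≤ C * N
    row-< {r} {C} lt = ≤-trans (≤-reflexive (+-comm (r * N) N)) (*-monoˡ-≤ N lt)

    label-injective : ∀ s r S C → s ≤ n → S ≤ n → label s r ≡ label S C → s ≡ S × r ≡ C
    label-injective s r S C s≤n S≤n e with <-cmp r C
    ... | tri< lt _ _ = ⊥-elim (lia 5 (λ n s S rN CN → s :≤ n :⇒ rN :+ (con 1 :+ n) :≤ CN :⇒ rN :+ s :≡ CN :+ S :⇒ :⊥) refl n s S (r * N) (C * N) s≤n (row-< lt) e)
    ... | tri≈ _ refl _ = +-cancelˡ-≡ (r * N) s S e , refl
    ... | tri> _ _ gt = ⊥-elim (lia 5 (λ n s S rN CN → S :≤ n :⇒ CN :+ (con 1 :+ n) :≤ rN :⇒ rN :+ s :≡ CN :+ S :⇒ :⊥) refl n s S (r * N) (C * N) S≤n (row-< gt) e)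

    column-row : ∀ a → ∃₂ λ S C → S ≤ n × a ≡ label S C
    column-row a = a % N , a / N , ≤-pred (m%n<n a N) , trans (m≡m%n+[m/n]*n a N) (+-comm (a % N) (a / N * N))

    -- `M` is the label of the last vertex `(n , n)`, which acts as `z`; the helix proper consists
    -- of the labels below it.
    Tri : Triple → Set
    Tri = Helix N M M

    private
      IncludedIn : Triple → Set
      IncludedIn T = ∃ λ T′ → Tri T′ × (∀ v → v ∈₃ T → v ∈₃ T′)

    -- When a + N + 1 reaches `M`, the triangle contains `z` and is listed as `top`, or as `closing`
    -- in the case of `upper-tri`.
    lower-tri : ∀ a → suc (a + N) ≤ M → IncludedIn (a , suc a , suc (a + N))
    lower-tri a le with suc (a + N) ≟ M
    ... | no ne = _ , lower a (≤∧≢⇒< le ne) , λ _ i → i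
    ... | yes e = _ , top a (≤-reflexive (sym e)) (≤-trans (s≤s (lia 2 (λ a n → con 1 :≤ n :⇒ con 1 :+ a :≤ a :+ (con 1 :+ n)) refl a n n≥1)) le) ,
          λ { v (inj₁ i) → inj₁ i ; v (inj₂ (inj₁ i)) → inj₂ (inj₁ i) ; v (inj₂ (inj₂ i)) → inj₂ (inj₂ (trans i e)) }

    upper-tri : ∀ a → suc (a + N) ≤ M → IncludedIn (a , a + N , suc (a + N))
    upper-tri a le with suc (a + N) ≟ M
    ... | no ne = _ , upper a (≤∧≢⇒< le ne) , λ _ i → i
    ... | yes e = _ , closing a e ,
          λ { v (inj₁ i) → inj₂ (inj₁ i) ; v (inj₂ (inj₁ i)) → inj₁ i ; v (inj₂ (inj₂ i)) → inj₂ (inj₂ (trans i e)) }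

    top-tri : ∀ k → M ≤ suc (k + N) → suc (suc k) ≤ M → IncludedIn (k , suc k , M)
    top-tri k p q = _ , top k p q , λ _ i → i

    bottom-tri : ∀ k → 1 ≤ k → k ≤ n → IncludedIn (0 , k , suc k)
    bottom-tri k p q = _ , bottom k p (s≤s q) , λ _ i → i

    Points : (S₁ C₁ S₂ C₂ S₃ C₃ s r : ℕ) → Set
    Points S₁ C₁ S₂ C₂ S₃ C₃ s r = (s ≡ S₁ × r ≡ C₁) ⊎ (s ≡ S₂ × r ≡ C₂) ⊎ (s ≡ S₃ × r ≡ C₃)

    decode : ∀ {S₁ C₁ S₂ C₂ S₃ C₃ a b c} → S₁ ≤ n → S₂ ≤ n → S₃ ≤ n → a ≡ label S₁ C₁ → b ≡ label S₂ C₂ → c ≡ label S₃ C₃ →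
      ∀ s r → s ≤ n → label s r ∈₃ (a , b , c) → Points S₁ C₁ S₂ C₂ S₃ C₃ s r
    decode {S₁} {C₁} p₁ p₂ p₃ e₁ e₂ e₃ s r s≤n (inj₁ e) = inj₁ (label-injective s r S₁ C₁ s≤n p₁ (trans e e₁))
    decode {S₂ = S₂} {C₂} p₁ p₂ p₃ e₁ e₂ e₃ s r s≤n (inj₂ (inj₁ e)) = inj₂ (inj₁ (label-injective s r S₂ C₂ s≤n p₂ (trans e e₂)))
    decode {S₃ = S₃} {C₃} p₁ p₂ p₃ e₁ e₂ e₃ s r s≤n (inj₂ (inj₂ e)) = inj₂ (inj₂ (label-injective s r S₃ C₃ s≤n p₃ (trans e e₃)))

    -- Evidence that a triangle survives both collapses: it lies in a facet and contains neither a
    -- bad pair of that facet nor a non-edge of a fan.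
    record Clean (T : Triple) : Set where
      field
        φ : Facet
        ok : Ok n φ
        inside : ∀ s r → s ≤ n → label s r ∈₃ T → In n φ s r
        good : ∀ s r s′ r′ → s ≤ n → s′ ≤ n → label s r ∈₃ T → label s′ r′ ∈₃ T → ¬ Bad n φ s r s′ r′
        side-good : ∀ σ s r s′ r′ → s ≤ n → s′ ≤ n → label s r ∈₃ T → label s′ r′ ∈₃ T → ¬ SideBad n σ s r s′ r′

    clean : ∀ {S₁ C₁ S₂ C₂ S₃ C₃ a b c} φ → Ok n φ → S₁ ≤ n → S₂ ≤ n → S₃ ≤ n → a ≡ label S₁ C₁ → b ≡ label S₂ C₂ → c ≡ label S₃ C₃ →
      (∀ s r s′ r′ → Points S₁ C₁ S₂ C₂ S₃ C₃ s r → Points S₁ C₁ S₂ C₂ S₃ C₃ s′ r′ →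
        In n φ s r × ¬ Bad n φ s r s′ r′ × ¬ SideBad n hi s r s′ r′ × ¬ SideBad n lo s r s′ r′) →
      Clean (a , b , c)
    clean {S₁} {C₁} {S₂} {C₂} {S₃} {C₃} φ ok p₁ p₂ p₃ e₁ e₂ e₃ h = record
      { φ = φ ; ok = ok
      ; inside = λ s r s≤n i → proj₁ (h s r s r (dec s r s≤n i) (dec s r s≤n i))
      ; good = λ s r s′ r′ s≤n s′≤n i i′ → proj₁ (proj₂ (h s r s′ r′ (dec s r s≤n i) (dec s′ r′ s′≤n i′)))
      ; side-good = λ { hi s r s′ r′ s≤n s′≤n i i′ → proj₁ (proj₂ (proj₂ (h s r s′ r′ (dec s r s≤n i) (dec s′ r′ s′≤n i′))))
                      ; lo s r s′ r′ s≤n s′≤n i i′ → proj₂ (proj₂ (proj₂ (h s r s′ r′ (dec s r s≤n i) (dec s′ r′ s′≤n i′)))) }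
      }
      where
      dec = decode {S₁} {C₁} {S₂} {C₂} {S₃} {C₃} p₁ p₂ p₃ e₁ e₂ e₃

    private
      row-bound : ∀ {S C} → suc (label S C + N) ≤ M → C < n
      row-bound {S} {C} le with C <? n
      ... | yes p = p
      ... | no p = ⊥-elim (lia 4 (λ n S CN nN → nN :≤ CN :⇒ con 1 :+ (CN :+ S :+ (con 1 :+ n)) :≤ nN :+ n :⇒ :⊥) refl n S (C * N) (n * N) (*-monoˡ-≤ N (≮⇒≥ p)) le)

      row-bound′ : ∀ {C} → suc (label n C + N) ≤ M → suc C < n
      row-bound′ {C} le with suc C <? n
      ... | yes p = p
      ... | no p = ⊥-elim (lia 3 (λ n CN nN → nN :≤ (con 1 :+ n) :+ CN :⇒ con 1 :+ (CN :+ n :+ (con 1 :+ n)) :≤ nN :+ n :⇒ :⊥) refl n (C * N) (n * N) (*-monoˡ-≤ N (≮⇒≥ p)) le)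

      next : ∀ S C → suc (label S C) ≡ label (suc S) C
      next S C = sym (+-suc (C * N) S)

      above : ∀ S C → label S C + N ≡ label S (suc C)
      above S C = lia 3 (λ n S CN → CN :+ S :+ (con 1 :+ n) :≡ (con 1 :+ n) :+ CN :+ S) refl n S (C * N)

      above-next : ∀ S C → suc (label S C + N) ≡ label (suc S) (suc C)
      above-next S C = trans (cong suc (above S C)) (next S (suc C))

      wrap : ∀ C → suc (label n C) ≡ label 0 (suc C)
      wrap C = lia 2 (λ n CN → con 1 :+ (CN :+ n) :≡ (con 1 :+ n) :+ CN :+ con 0) refl n (C * N)

      above-wrap : ∀ C → suc (label n C + N) ≡ label 0 (suc (suc C))
      above-wrap C = trans (cong suc (above n C)) (wrap (suc C))

    -- The facet depends on the position (S , C) of `a`: in the last column it is a rhombus at the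
    -- seam, otherwise in row 0 a `bot`, and elsewhere an ordinary rhombus. In `clean-upper`, row n
    -- - 1 and `top` replace row 0 and `bot`.
    clean-lower : ∀ a → suc (a + N) ≤ M → Clean (a , suc a , suc (a + N))
    clean-lower a le with column-row a
    ... | S , C , S≤n , refl with S ≟ n
    ...   | yes refl = clean (rhomb 0 (suc C)) (s≤s z≤n , row-bound′ {C} le , z≤n) ≤-refl z≤n z≤n refl (wrap C) (above-wrap C)
            (λ s r s′ r′ → lia 6 (λ n C s r s′ r′ → con 1 :≤ n :⇒ con 1 :+ C :< n :⇒ pointsForm s r n C (con 0) (con 1 :+ C) (con 0) (con 2 :+ C) :⇒ pointsForm s′ r′ n C (con 0) (con 1 :+ C) (con 0) (con 2 :+ C) :⇒
              rhombIn n (con 0) (con 1 :+ C) s r :∧ :¬ rhombBad n (con 0) (con 1 :+ C) s r s′ r′ :∧ :¬ hiBad n s r s′ r′ :∧ :¬ loBad n s r s′ r′) refl n C s r s′ r′ n≥1 (row-bound′ {C} le))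
    clean-lower a le | S , zero , S≤n , refl | no ne = clean (bot (suc S)) (≤∧≢⇒< S≤n ne) S≤n (≤∧≢⇒< S≤n ne) (≤∧≢⇒< S≤n ne) refl refl (above-next S 0)
            (λ s r s′ r′ → lia 6 (λ n S s r s′ r′ → con 1 :≤ n :⇒ S :< n :⇒ pointsForm s r S (con 0) (con 1 :+ S) (con 0) (con 1 :+ S) (con 1) :⇒ pointsForm s′ r′ S (con 0) (con 1 :+ S) (con 0) (con 1 :+ S) (con 1) :⇒
              botIn n (con 1 :+ S) s r :∧ :¬ botBad n (con 1 :+ S) s r s′ r′ :∧ :¬ hiBad n s r s′ r′ :∧ :¬ loBad n s r s′ r′) refl n S s r s′ r′ n≥1 (≤∧≢⇒< S≤n ne))
    clean-lower a le | S , suc C , S≤n , refl | no ne = clean (rhomb (suc S) (suc C)) (s≤s z≤n , row-bound {S} {suc C} le , ≤∧≢⇒< S≤n ne) S≤n (≤∧≢⇒< S≤n ne) (≤∧≢⇒< S≤n ne)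
            refl (next S (suc C)) (above-next S (suc C))
            (λ s r s′ r′ → lia 7 (λ n S C s r s′ r′ → con 1 :+ C :< n :⇒ pointsForm s r S (con 1 :+ C) (con 1 :+ S) (con 1 :+ C) (con 1 :+ S) (con 2 :+ C) :⇒ pointsForm s′ r′ S (con 1 :+ C) (con 1 :+ S) (con 1 :+ C) (con 1 :+ S) (con 2 :+ C) :⇒
              rhombIn n (con 1 :+ S) (con 1 :+ C) s r :∧ :¬ rhombBad n (con 1 :+ S) (con 1 :+ C) s r s′ r′ :∧ :¬ hiBad n s r s′ r′ :∧ :¬ loBad n s r s′ r′) refl n S C s r s′ r′ (row-bound {S} {suc C} le))

    clean-upper : ∀ a → suc (a + N) ≤ M → Clean (a , a + N , suc (a + N))
    clean-upper a le with column-row a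
    ... | S , C , S≤n , refl with S ≟ n | suc C ≟ n
    ...   | yes refl | _ = clean (rhomb 0 (suc C)) (s≤s z≤n , row-bound′ {C} le , z≤n) ≤-refl ≤-refl z≤n refl (above n C) (above-wrap C)
            (λ s r s′ r′ → lia 6 (λ n C s r s′ r′ → con 1 :≤ n :⇒ con 1 :+ C :< n :⇒ pointsForm s r n C n (con 1 :+ C) (con 0) (con 2 :+ C) :⇒ pointsForm s′ r′ n C n (con 1 :+ C) (con 0) (con 2 :+ C) :⇒
              rhombIn n (con 0) (con 1 :+ C) s r :∧ :¬ rhombBad n (con 0) (con 1 :+ C) s r s′ r′ :∧ :¬ hiBad n s r s′ r′ :∧ :¬ loBad n s r s′ r′) refl n C s r s′ r′ n≥1 (row-bound′ {C} le))
    ...   | no ne | yes refl = clean (top S) S≤n S≤n S≤n (≤∧≢⇒< S≤n ne) refl (above S C) (above-next S C)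
            (λ s r s′ r′ → lia 7 (λ n S C s r s′ r′ → n :≡ con 1 :+ C :⇒ S :< n :⇒ pointsForm s r S C S (con 1 :+ C) (con 1 :+ S) (con 1 :+ C) :⇒ pointsForm s′ r′ S C S (con 1 :+ C) (con 1 :+ S) (con 1 :+ C) :⇒
              topIn n S s r :∧ :¬ topBad n S s r s′ r′ :∧ :¬ hiBad n s r s′ r′ :∧ :¬ loBad n s r s′ r′) refl n S C s r s′ r′ refl (≤∧≢⇒< S≤n ne))
    ...   | no ne | no ne′ = clean (rhomb (suc S) (suc C)) (s≤s z≤n , ≤∧≢⇒< (row-bound {S} {C} le) ne′ , ≤∧≢⇒< S≤n ne) S≤n S≤n (≤∧≢⇒< S≤n ne)
            refl (above S C) (above-next S C)
            (λ s r s′ r′ → lia 7 (λ n S C s r s′ r′ → S :< n :⇒ con 1 :+ C :< n :⇒ pointsForm s r S C S (con 1 :+ C) (con 1 :+ S) (con 1 :+ C) :⇒ pointsForm s′ r′ S C S (con 1 :+ C) (con 1 :+ S) (con 1 :+ C) :⇒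
              rhombIn n (con 1 :+ S) (con 1 :+ C) s r :∧ :¬ rhombBad n (con 1 :+ S) (con 1 :+ C) s r s′ r′ :∧ :¬ hiBad n s r s′ r′ :∧ :¬ loBad n s r s′ r′) refl n S C s r s′ r′ (≤∧≢⇒< S≤n ne) (≤∧≢⇒< (row-bound {S} {C} le) ne′))

    clean-bottom : ∀ k → 1 ≤ k → k ≤ n → Clean (0 , k , suc k)
    clean-bottom k 1≤k k≤n with k ≟ n
    ... | yes refl = clean (bot 0) z≤n z≤n ≤-refl z≤n refl refl (wrap 0)
            (λ s r s′ r′ → lia 5 (λ n s r s′ r′ → con 1 :≤ n :⇒ pointsForm s r (con 0) (con 0) n (con 0) (con 0) (con 1) :⇒ pointsForm s′ r′ (con 0) (con 0) n (con 0) (con 0) (con 1) :⇒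
              botIn n (con 0) s r :∧ :¬ botBad n (con 0) s r s′ r′ :∧ :¬ hiBad n s r s′ r′ :∧ :¬ loBad n s r s′ r′) refl n s r s′ r′ n≥1)
    ... | no ne = clean (bot 0) z≤n z≤n k≤n (≤∧≢⇒< k≤n ne) refl refl refl
            (λ s r s′ r′ → lia 6 (λ n k s r s′ r′ → con 1 :≤ n :⇒ pointsForm s r (con 0) (con 0) k (con 0) (con 1 :+ k) (con 0) :⇒ pointsForm s′ r′ (con 0) (con 0) k (con 0) (con 1 :+ k) (con 0) :⇒
              botIn n (con 0) s r :∧ :¬ botBad n (con 0) s r s′ r′ :∧ :¬ hiBad n s r s′ r′ :∧ :¬ loBad n s r s′ r′) refl n k s r s′ r′ n≥1)

-- Helix triangles avoid bad pairs and cover the faces that do.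

module Cover where

  open import Data.Nat
  open import Data.Nat.Properties
  open Lia using (Exp; con; _:+_; Form; _:≤_; _:<_; _:≡_; _:∧_; _:∨_; _:⇒_; :¬_; lia)
  open Code using (predForm)
  open FacetCodes
  open Polytopes using (_∈₃_)
  open Helix using (lower; upper; bottom; top; closing) renaming (∈₃-form to memberForm)
  open TriangleCodes

  module _ (n : ℕ) (n≥1 : 1 ≤ n) where

    private
      N M : ℕ
      N = suc n
      M = n * N + n
      lab : ℕ → ℕ → ℕ
      lab = label n n≥1

    clean-top-row : ∀ S → suc (suc S) ≤ n → Clean n n≥1 (lab S n , suc (lab S n) , M)
    clean-top-row S lt = clean n n≥1 {S} {n} {suc S} {n} {n} {n} (top 0) z≤n (<⇒≤ (<⇒≤ lt)) (<⇒≤ lt) ≤-refl refl (sym (+-suc (n * N) S)) refl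
      (λ s r s′ r′ → lia 6 (λ n S s r s′ r′ → con 2 :+ S :≤ n :⇒ pointsForm s r S n (con 1 :+ S) n n n :⇒ pointsForm s′ r′ S n (con 1 :+ S) n n n :⇒
        topIn n (con 0) s r :∧ :¬ topBad n (con 0) s r s′ r′ :∧ :¬ hiBad n s r s′ r′ :∧ :¬ loBad n s r s′ r′) refl n S s r s′ r′ lt)

    clean-top-wrap : ∀ n′ → n ≡ suc n′ → Clean n n≥1 (lab n n′ , suc (lab n n′) , M)
    clean-top-wrap n′ refl = clean n n≥1 {n} {n′} {0} {n} {n} {n} (top n) ≤-refl ≤-refl z≤n ≤-refl refl
      (lia 2 (λ n CN → con 1 :+ (CN :+ n) :≡ (con 1 :+ n) :+ CN :+ con 0) refl n (n′ * N)) refl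
      (lia 5 (λ m s r s′ r′ → pointsForm s r (con 1 :+ m) m (con 0) (con 1 :+ m) (con 1 :+ m) (con 1 :+ m) :⇒ pointsForm s′ r′ (con 1 :+ m) m (con 0) (con 1 :+ m) (con 1 :+ m) (con 1 :+ m) :⇒
        topIn (con 1 :+ m) (con 1 :+ m) s r :∧ :¬ topBad (con 1 :+ m) (con 1 :+ m) s r s′ r′ :∧ :¬ hiBad (con 1 :+ m) s r s′ r′ :∧ :¬ loBad (con 1 :+ m) s r s′ r′) refl n′)

    weaken : ∀ {T T′} → (∀ v → v ∈₃ T → v ∈₃ T′) → Clean n n≥1 T′ → Clean n n≥1 T
    weaken f c = record
      { φ = φ ; ok = ok
      ; inside = λ s r p i → inside s r p (f _ i)
      ; good = λ s r s′ r′ p p′ i i′ → good s r s′ r′ p p′ (f _ i) (f _ i′)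
      ; side-good = λ σ s r s′ r′ p p′ i i′ → side-good σ s r s′ r′ p p′ (f _ i) (f _ i′)
      }
      where open Clean c

    clean-tri : ∀ {T} → Tri n n≥1 T → Clean n n≥1 T
    clean-tri (lower a lt) = clean-lower n n≥1 a (<⇒≤ lt)
    clean-tri (upper a lt) = clean-upper n n≥1 a (<⇒≤ lt)
    clean-tri (bottom k p q) = clean-bottom n n≥1 k p (≤-pred q)
    clean-tri (closing a e) = weaken (λ { v (inj₁ i) → inj₂ (inj₁ i) ; v (inj₂ (inj₁ i)) → inj₁ i ; v (inj₂ (inj₂ i)) → inj₂ (inj₂ (trans i (sym e))) })
      (clean-upper n n≥1 a (≤-reflexive e))
    -- The neighbours of `M` begin with M - N - 1 = (n - 1 , n - 1) and M - N = (n , n - 1); from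
    -- then on they are in row `n`.
    clean-tri (top k p q) with suc (k + N) ≟ M | n * N ≤? k
    ... | yes e | _ = weaken (λ { v (inj₁ i) → inj₁ i ; v (inj₂ (inj₁ i)) → inj₂ (inj₁ i) ; v (inj₂ (inj₂ i)) → inj₂ (inj₂ (trans i (sym e))) })
            (clean-lower n n≥1 k (≤-reflexive e))
    ... | no _ | yes le = subst (λ k → Clean n n≥1 (k , suc k , M)) (m+[n∸m]≡n le)
            (clean-top-row (k ∸ n * N) (+-cancelˡ-≤ (n * N) _ _ (≤-trans (≤-reflexive (trans (+-suc (n * N) _) (cong suc (trans (+-suc (n * N) _) (cong suc (m+[n∸m]≡n le)))))) q)))
    ... | no ne | no nle = subst (λ k → Clean n n≥1 (k , suc k , M)) eq (clean-top-wrap n′ (sym n≡))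
      where
      n′ = n ∸ 1
      n≡ : suc n′ ≡ n
      n≡ = m+[n∸m]≡n n≥1
      eq : lab n n′ ≡ k
      eq = lia 4 (λ n k nN CN → CN :+ (con 1 :+ n) :≡ nN :⇒ nN :+ n :≤ con 1 :+ (k :+ (con 1 :+ n)) :⇒ :¬ (con 1 :+ (k :+ (con 1 :+ n)) :≡ nN :+ n) :⇒ k :< nN :⇒ CN :+ n :≡ k) refl
        n k (n * N) (n′ * N) (proj₁ (proj₂ (rows n n≥1 n′ n)) n≡) p ne (≰⇒> nle)

    private
      below-top : ∀ {S C} → S < n → C < n → suc (lab S C + N) ≤ M
      below-top {S} {C} S<n C<n = lia 4 (λ n S CN nN → S :< n :⇒ CN :+ (con 1 :+ n) :≤ nN :⇒ con 1 :+ (CN :+ S :+ (con 1 :+ n)) :≤ nN :+ n) refl n S (C * N) (n * N) S<n (row-< n n≥1 C<n)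

      below-top′ : ∀ {C} → suc C < n → suc (lab n C + N) ≤ M
      below-top′ {C} C<n = lia 3 (λ n CN nN → (con 1 :+ n) :+ CN :+ (con 1 :+ n) :≤ nN :⇒ con 1 :+ (CN :+ n :+ (con 1 :+ n)) :≤ nN :+ n) refl n (C * N) (n * N) (row-< n n≥1 C<n)

    Covered : (ℕ → ℕ → Set) → Set
    Covered A = ∃ λ T → Tri n n≥1 T × (∀ s r → A s r → lab s r ∈₃ T)

    cover : ∀ {A : ℕ → ℕ → Set} {T} → (∃ λ T′ → Tri n n≥1 T′ × (∀ v → v ∈₃ T → v ∈₃ T′)) → (∀ s r → A s r → lab s r ∈₃ T) → Covered A
    cover (T′ , τ , f) h = T′ , τ , λ s r a → f _ (h s r a)

    module _ (A : ℕ → ℕ → Set) (s≤n : ∀ {s r} → A s r → s ≤ n) where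

      -- Here and in the next three, a face that misses one end of the removed diagonal lies in the
      -- triangle formed by the other end and the kept diagonal.
      cover-rhomb-top : ∀ S C → suc S ≤ n → C < n → (∀ s r → A s r → In n (rhomb (suc S) C) s r × ¬ (s ≡ S × suc r ≡ C)) → Covered A
      cover-rhomb-top S C S<n C<n h = cover (lower-tri n n≥1 (lab S C) (below-top S<n C<n)) λ s r a →
        lia 7 (λ n S C s r rN CN → con 1 :+ S :≤ n :⇒ s :≤ n :⇒ rowForm n r C rN CN :⇒ (rhombIn n (con 1 :+ S) C s r :∧ :¬ (s :≡ S :∧ con 1 :+ r :≡ C)) :⇒
          memberForm (rN :+ s) (CN :+ S) (con 1 :+ (CN :+ S)) (con 1 :+ (CN :+ S :+ (con 1 :+ n)))) refl
          n S C s r (r * N) (C * N) S<n (s≤n a) (rows n n≥1 r C) (h s r a)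

      cover-rhomb-bottom : ∀ S C → suc S ≤ n → suc C < n → (∀ s r → A s r → In n (rhomb (suc S) (suc C)) s r × ¬ (s ≡ suc S × r ≡ suc (suc C))) → Covered A
      cover-rhomb-bottom S C S<n C<n h = cover (upper-tri n n≥1 (lab S C) (below-top S<n (<-trans (n<1+n C) C<n))) λ s r a →
        lia 7 (λ n S C s r rN CN → con 1 :+ S :≤ n :⇒ s :≤ n :⇒ rowForm n r (con 1 :+ C) rN ((con 1 :+ n) :+ CN) :⇒
          (rhombIn n (con 1 :+ S) (con 1 :+ C) s r :∧ :¬ (s :≡ con 1 :+ S :∧ r :≡ con 2 :+ C)) :⇒
          memberForm (rN :+ s) (CN :+ S) (CN :+ S :+ (con 1 :+ n)) (con 1 :+ (CN :+ S :+ (con 1 :+ n)))) refl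
          n S C s r (r * N) (C * N) S<n (s≤n a) (rows n n≥1 r (suc C)) (h s r a)

      cover-wrap-last : ∀ C → suc C < n → (∀ s r → A s r → In n (rhomb 0 (suc C)) s r × ¬ (s ≡ 0 × r ≡ suc C)) → Covered A
      cover-wrap-last C C<n h = cover (upper-tri n n≥1 (lab n C) (below-top′ C<n)) λ s r a →
        lia 6 (λ n C s r rN CN → s :≤ n :⇒ rowForm n r (con 1 :+ C) rN ((con 1 :+ n) :+ CN) :⇒
          (rhombIn n (con 0) (con 1 :+ C) s r :∧ :¬ (s :≡ con 0 :∧ r :≡ con 1 :+ C)) :⇒
          memberForm (rN :+ s) (CN :+ n) (CN :+ n :+ (con 1 :+ n)) (con 1 :+ (CN :+ n :+ (con 1 :+ n)))) refl
          n C s r (r * N) (C * N) (s≤n a) (rows n n≥1 r (suc C)) (h s r a)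

      cover-wrap-first : ∀ C → suc C < n → (∀ s r → A s r → In n (rhomb 0 (suc C)) s r × ¬ (s ≡ n × r ≡ suc C)) → Covered A
      cover-wrap-first C C<n h = cover (lower-tri n n≥1 (lab n C) (below-top′ C<n)) λ s r a →
        lia 6 (λ n C s r rN CN → con 1 :≤ n :⇒ s :≤ n :⇒ rowForm n r (con 1 :+ C) rN ((con 1 :+ n) :+ CN) :⇒
          (rhombIn n (con 0) (con 1 :+ C) s r :∧ :¬ (s :≡ n :∧ r :≡ con 1 :+ C)) :⇒
          memberForm (rN :+ s) (CN :+ n) (con 1 :+ (CN :+ n)) (con 1 :+ (CN :+ n :+ (con 1 :+ n)))) refl
          n C s r (r * N) (C * N) n≥1 (s≤n a) (rows n n≥1 r (suc C)) (h s r a)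

      private
        n′ : ℕ
        n′ = n ∸ 1
        n≡ : suc n′ ≡ n
        n≡ = m+[n∸m]≡n n≥1
        nN : n′ * N + N ≡ n * N
        nN = proj₁ (proj₂ (rows n n≥1 n′ n)) n≡

      cover-top : ∀ u → u ≤ n → (∀ s r → A s r → (r ≡ n × (s ≡ u ⊎ (suc u ≡ s ⊎ (u ≡ n × s ≡ 0)))) ⊎ (s ≡ u × suc r ≡ n)) → Covered A
      cover-top u u≤n h with u ≟ n
      ... | no ne = cover (upper-tri n n≥1 (lab u n′) (below-top (≤∧≢⇒< u≤n ne) (≤-reflexive n≡))) λ s r a →
        lia 7 (λ n u s r rN nN CN → u :< n :⇒ CN :+ (con 1 :+ n) :≡ nN :⇒ rowForm n r n rN nN :⇒
          ((r :≡ n :∧ (s :≡ u :∨ predForm n u s)) :∨ (s :≡ u :∧ con 1 :+ r :≡ n)) :⇒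
          memberForm (rN :+ s) (CN :+ u) (CN :+ u :+ (con 1 :+ n)) (con 1 :+ (CN :+ u :+ (con 1 :+ n)))) refl
          n u s r (r * N) (n * N) (n′ * N) (≤∧≢⇒< u≤n ne) nN (rows n n≥1 r n) (h s r a)
      ... | yes refl = cover (top-tri n n≥1 (lab n n′)
          (lia 3 (λ n nN CN → CN :+ (con 1 :+ n) :≡ nN :⇒ nN :+ n :≤ con 1 :+ (CN :+ n :+ (con 1 :+ n))) refl n (n * N) (n′ * N) nN)
          (lia 3 (λ n nN CN → con 1 :≤ n :⇒ CN :+ (con 1 :+ n) :≡ nN :⇒ con 2 :+ (CN :+ n) :≤ nN :+ n) refl n (n * N) (n′ * N) n≥1 nN)) λ s r a →
        lia 6 (λ n s r rN nN CN → s :≤ n :⇒ CN :+ (con 1 :+ n) :≡ nN :⇒ rowForm n r n rN nN :⇒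
          ((r :≡ n :∧ (s :≡ n :∨ predForm n n s)) :∨ (s :≡ n :∧ con 1 :+ r :≡ n)) :⇒
          memberForm (rN :+ s) (CN :+ n) (con 1 :+ (CN :+ n)) (nN :+ n)) refl
          n s r (r * N) (n * N) (n′ * N) (s≤n a) nN (rows n n≥1 r n) (h s r a)

      cover-bot : ∀ u → u ≤ n → (∀ s r → A s r → (r ≡ 0 × (s ≡ u ⊎ (suc s ≡ u ⊎ (s ≡ n × u ≡ 0)))) ⊎ (s ≡ u × r ≡ 1)) → Covered A
      cover-bot zero u≤n h = cover (bottom-tri n n≥1 n n≥1 ≤-refl) λ s r a →
        lia 4 (λ n s r rN → s :≤ n :⇒ rowForm n r (con 0) rN (con 0) :⇒
          ((r :≡ con 0 :∧ (s :≡ con 0 :∨ predForm n s (con 0))) :∨ (s :≡ con 0 :∧ r :≡ con 1)) :⇒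
          memberForm (rN :+ s) (con 0) n (con 1 :+ n)) refl
          n s r (r * N) (s≤n a) (rows n n≥1 r 0) (h s r a)
      cover-bot (suc u) u≤n h = cover (lower-tri n n≥1 u (below-top {u} {0} u≤n n≥1)) λ s r a →
        lia 5 (λ n u s r rN → con 1 :+ u :≤ n :⇒ rowForm n r (con 0) rN (con 0) :⇒
          ((r :≡ con 0 :∧ (s :≡ con 1 :+ u :∨ predForm n s (con 1 :+ u))) :∨ (s :≡ con 1 :+ u :∧ r :≡ con 1)) :⇒
          memberForm (rN :+ s) u (con 1 :+ u) (con 1 :+ (u :+ (con 1 :+ n)))) refl
          n u s r (r * N) u≤n (rows n n≥1 r 0) (h s r a)

      cover-hi : ∀ k → k < n → (∀ s r → A s r → r ≡ n × (s ≡ n ⊎ suc s ≡ k ⊎ s ≡ k)) → Covered A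
      -- `n * N + k ∸ 1` is the label of (k - 1 , n) or, for k = 0, of (n , n - 1).
      cover-hi k k<n h = cover (top-tri n n≥1 (n * N + k ∸ 1)
          (lia 4 (λ n k t nN → con 1 :≤ n :⇒ t :+ con 1 :≡ nN :+ k :⇒ nN :+ n :≤ con 1 :+ (t :+ (con 1 :+ n))) refl n k (n * N + k ∸ 1) (n * N) n≥1 t-eq)
          (lia 4 (λ n k t nN → k :< n :⇒ t :+ con 1 :≡ nN :+ k :⇒ con 2 :+ t :≤ nN :+ n) refl n k (n * N + k ∸ 1) (n * N) k<n t-eq)) λ s r a →
        lia 7 (λ n k t s r rN nN → t :+ con 1 :≡ nN :+ k :⇒ rowForm n r n rN nN :⇒ (r :≡ n :∧ (s :≡ n :∨ con 1 :+ s :≡ k :∨ s :≡ k)) :⇒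
          memberForm (rN :+ s) t (con 1 :+ t) (nN :+ n)) refl
          n k (n * N + k ∸ 1) s r (r * N) (n * N) t-eq (rows n n≥1 r n) (h s r a)
        where
        t-eq : n * N + k ∸ 1 + 1 ≡ n * N + k
        t-eq = m∸n+n≡m (≤-trans (*-mono-≤ n≥1 (s≤s z≤n)) (m≤m+n (n * N) k))

      cover-lo : ∀ k → 1 ≤ k → k ≤ n → (∀ s r → A s r → r ≡ 0 × (s ≡ 0 ⊎ s ≡ k ⊎ (s ≡ suc k))) → Covered A
      cover-lo k 1≤k k≤n h = cover (bottom-tri n n≥1 k 1≤k k≤n) λ s r a →
        lia 5 (λ n k s r rN → rowForm n r (con 0) rN (con 0) :⇒ (r :≡ con 0 :∧ (s :≡ con 0 :∨ s :≡ k :∨ s :≡ con 1 :+ k)) :⇒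
          memberForm (rN :+ s) (con 0) k (con 1 :+ k)) refl
          n k s r (r * N) (rows n n≥1 r 0) (h s r a)

-- The two collapses, onto the helix triangles.

module CollapseOntoTriangles where

  open import Data.Nat
  open import Data.Nat.Properties
  open import Data.Fin using (Fin; toℕ; fromℕ<)
  open import Data.Fin.Properties using (any?; all?; toℕ-fromℕ<; toℕ<n)
  open import Data.Fin.Subset using (Subset; _∈_; _⊆_; _∪_; ⁅_⁆; _-_)
  open import Data.Fin.Subset.Properties using (_∈?_; x∈p∪q⁻; x∈⁅y⁆⇒x≡y)
  open import Function.Bundles using (_⇔_; mk⇔; Equivalence)
  open import Relation.Nullary.Decidable using (_×-dec_; _→-dec_; map′)
  open Lia using (con; _:+_; _:≤_; _:<_; _:≡_; _:∧_; _:∨_; _:⇒_; :¬_; lia)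
  open Polytopes using (_∈₃_)
  open Code using (CodeAdj; predForm)
  open FacetCodes
  open TriangleCodes using (label; Tri; Clean)
  open Cover
  open Toggling

  module Coded (n : ℕ) (n≥1 : 1 ≤ n) (size : ℕ) (Adj : Fin size → Fin size → Set) (col row : Fin size → ℕ)
    (col≤n : ∀ v → col v ≤ n) (row≤n : ∀ v → row v ≤ n)
    (code-injective : ∀ u v → col u ≡ col v → row u ≡ row v → u ≡ v)
    (code-surjective : ∀ s r → s ≤ n → r ≤ n → ∃ λ v → col v ≡ s × row v ≡ r)
    (adj⇔ : ∀ u v → Adj u v ⇔ CodeAdj n (col v) (row v) (col u) (row u)) where

    private
      V : Set
      V = Fin size
      K : Complex size
      K = NbhdComplex Adj

      InV : Facet → V → Set
      InV φ u = In n φ (col u) (row u)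

      BadV : Facet → V → V → Set
      BadV φ x y = Bad n φ (col x) (row x) (col y) (row y)

      SideBadV : Side → V → V → Set
      SideBadV σ x y = SideBad n σ (col x) (row x) (col y) (row y)

      Inside : Facet → Subset size → Set
      Inside φ F = ∀ u → u ∈ F → InV φ u

    in-facet : ∀ F → K F ⇔ (∃ λ φ → Ok n φ × Inside φ F)
    in-facet F = mk⇔ to from
      where
      to : K F → ∃ λ φ → Ok n φ × Inside φ F
      to (v , adj) with adj⇒facet n n≥1 (col v) (row v) (col≤n v) (row≤n v)
      ... | φ , ok , inside = φ , ok , λ u u∈ → inside (col u) (row u) (col≤n u) (row≤n u) (Equivalence.to (adj⇔ u v) (adj u u∈))
      from : (∃ λ φ → Ok n φ × Inside φ F) → K F
      from (φ , ok , inside) with facet⇒adj n n≥1 φ ok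
      ... | s₀ , r₀ , s₀≤n , r₀≤n , adj with code-surjective s₀ r₀ s₀≤n r₀≤n
      ...   | v , refl , refl = v , λ u u∈ → Equivalence.from (adj⇔ u v) (adj (col u) (row u) (col≤n u) (row≤n u) (inside u u∈))

    private
      facet-any? : (Q : Facet → Set) → (∀ φ → Dec (Q φ)) → Dec (∃ λ φ → Ok n φ × Q φ)
      facet-any? Q Q? with bounded (λ S → ∃ λ C → C < n × 1 ≤ C × Q (rhomb S C)) (λ S → rhombs S) | bounded (Q ∘ top) (Q? ∘ top) | bounded (Q ∘ bot) (Q? ∘ bot)
        where
        bounded : (R : ℕ → Set) → (∀ s → Dec (R s)) → Dec (∃ λ s → s ≤ n × R s)
        bounded R R? = map′ (λ (i , r) → toℕ i , ≤-pred (toℕ<n i) , r) (λ (s , p , r) → fromℕ< (s≤s p) , subst R (sym (toℕ-fromℕ< (s≤s p))) r) (any? λ (i : Fin (suc n)) → R? (toℕ i))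
        rhombs : ∀ S → Dec (∃ λ C → C < n × 1 ≤ C × Q (rhomb S C))
        rhombs S = map′ (λ (C , _ , p , q , r) → C , p , q , r) (λ (C , p , q , r) → C , <⇒≤ p , p , q , r)
          (bounded (λ C → C < n × 1 ≤ C × Q (rhomb S C)) λ C → (C <? n) ×-dec (1 ≤? C) ×-dec Q? (rhomb S C))
      ... | yes (S , S≤n , C , C<n , 1≤C , q) | _ | _ = yes (rhomb S C , (1≤C , C<n , S≤n) , q)
      ... | no _ | yes (u , u≤n , q) | _ = yes (top u , u≤n , q)
      ... | no _ | no _ | yes (u , u≤n , q) = yes (bot u , u≤n , q)
      ... | no a | no b | no c = no λ { (rhomb S C , (1≤C , C<n , S≤n) , q) → a (S , S≤n , C , C<n , 1≤C , q) ; (top u , u≤n , q) → b (u , u≤n , q) ; (bot u , u≤n , q) → c (u , u≤n , q) }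

      subset-any? : (F : Subset size) (R : V → Set) → (∀ u → Dec (R u)) → Dec (∃ λ u → u ∈ F × R u)
      subset-any? F R R? = any? λ u → (u ∈? F) ×-dec R? u

      HasBad : Facet → Subset size → Set
      HasBad φ F = ∃ λ x → x ∈ F × ∃ λ y → y ∈ F × BadV φ x y

      hasBad? : ∀ φ F → Dec (HasBad φ F)
      hasBad? φ F = subset-any? F _ λ x → subset-any? F _ λ y → bad? n φ (col x) (row x) (col y) (row y)

      inside? : ∀ φ F → Dec (Inside φ F)
      inside? φ F = all? λ u → (u ∈? F) →-dec in? n φ (col u) (row u)

      module _ (F : Subset size) {w : V} where

        in-union : ∀ {u} → u ∈ F ∪ ⁅ w ⁆ → u ∈ F ⊎ u ≡ w
        in-union u∈ with x∈p∪q⁻ F ⁅ w ⁆ u∈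
        ... | inj₁ h = inj₁ h
        ... | inj₂ h = inj₂ (x∈⁅y⁆⇒x≡y w h)

    -- The faces removed first: those that contain a bad pair of their facet φ, matched by toggling the apex of φ.
    Removed₁ : Subset size → V → Set
    Removed₁ F w = ∃ λ φ → Ok n φ × Inside φ F × HasBad φ F × IsApex n φ (col w) (row w)

    private
      bad-unique : ∀ {F φ φ′} → Ok n φ → Ok n φ′ → HasBad φ F → Inside φ′ F → φ′ ≡ φ
      bad-unique {φ = φ} {φ′} o o′ (x , x∈ , y , y∈ , b) i = bad-facet-unique n n≥1 φ φ′ _ _ _ _ o o′ (col≤n x) (row≤n x) (col≤n y) (row≤n y) b (i x x∈) (i y y∈)

      removed₁? : ∀ F → Dec (∃ (Removed₁ F))
      removed₁? F = map′ to (λ (w , φ , o , i , b , _) → φ , o , i , b) (facet-any? (λ φ → Inside φ F × HasBad φ F) λ φ → inside? φ F ×-dec hasBad? φ F)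
        where
        to : (∃ λ φ → Ok n φ × Inside φ F × HasBad φ F) → ∃ (Removed₁ F)
        to (φ , o , i , b) with apex-exists n n≥1 φ o
        ... | s , r , s≤n , r≤n , e with code-surjective s r s≤n r≤n
        ...   | w , refl , refl = w , φ , o , i , b , e

      functional₁ : ∀ {F w w′} → Removed₁ F w → Removed₁ F w′ → w ≡ w′
      functional₁ {F} {w} {w′} (φ , o , i , b , e) (φ′ , o′ , i′ , b′ , e′) with bad-unique {F} {φ} {φ′} o o′ b i′
      ... | refl = let p , q = apex-unique n n≥1 φ _ _ _ _ e e′ in code-injective w w′ p q

      upward₁ : ∀ {F G w} → Removed₁ F w → F ⊆ G → K G → Removed₁ G w
      upward₁ {F} {G} (φ , o , i , (x , x∈ , y , y∈ , b) , e) F⊆G k with Equivalence.to (in-facet G) k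
      ... | φ′ , o′ , i′ with bad-unique {F} {φ} {φ′} o o′ (x , x∈ , y , y∈ , b) (λ u u∈ → i′ u (F⊆G u∈))
      ...   | refl = φ , o , i′ , (x , F⊆G x∈ , y , F⊆G y∈ , b) , e

      without₁ : ∀ {F w} → Removed₁ F w → Removed₁ (F - w) w
      without₁ {F} {w} (φ , o , i , (x , x∈ , y , y∈ , b) , e) =
        φ , o , (λ u u∈ → i u (remove-⊆ {w = w} F u∈)) ,
        (x , remove-keeps F x∈ (λ { refl → proj₁ na (refl , refl) }) , y , remove-keeps F y∈ (λ { refl → proj₂ na (refl , refl) }) , b) , e
        where
        na = bad-not-apex n n≥1 φ (col x) (row x) (col y) (row y) (col w) (row w) o b e

      with-apex₁ : ∀ {F w} → Removed₁ F w → K (F ∪ ⁅ w ⁆)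
      with-apex₁ {F} {w} (φ , o , i , _ , e) = Equivalence.from (in-facet (F ∪ ⁅ w ⁆)) (φ , o , inside)
        where
        inside : Inside φ (F ∪ ⁅ w ⁆)
        inside u u∈ with in-union F u∈
        ... | inj₁ h = i u h
        ... | inj₂ refl = apex-in n n≥1 φ (col w) (row w) o e

    K₁ : Complex size
    K₁ F = K F × ¬ ∃ (Removed₁ F)

    collapse₁ : Collapses K K₁
    collapse₁ = toggle-collapse K Removed₁ removed₁? functional₁ upward₁ (λ {F} (φ , o , i , _) → Equivalence.from (in-facet F) (φ , o , i)) without₁ with-apex₁

    private
      no-bad : ∀ {F φ} → ¬ ∃ (Removed₁ F) → Ok n φ → Inside φ F → ¬ HasBad φ F
      no-bad {F} {φ} nr o i b with apex-exists n n≥1 φ o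
      ... | s , r , s≤n , r≤n , e with code-surjective s r s≤n r≤n
      ...   | w , refl , refl = nr (w , φ , o , i , b , e)

      cap : Side → Facet
      cap hi = top 0
      cap lo = bot 0

      cap-ok : ∀ σ → Ok n (cap σ)
      cap-ok hi = z≤n
      cap-ok lo = z≤n

      in-cap : ∀ σ u → row u ≡ edge n σ → InV (cap σ) u
      in-cap hi u e = inj₁ e
      in-cap lo u e = inj₁ e

      OnEdge : Side → Subset size → Set
      OnEdge σ F = ∀ u → u ∈ F → row u ≡ edge n σ

      HasSideBad : Side → Subset size → Set
      HasSideBad σ F = ∃ λ x → x ∈ F × ∃ λ y → y ∈ F × SideBadV σ x y

    -- The faces removed next, from the two simplices spanned by the first and by the last row: those that are not in
    -- the fan with centre (0 , 0), respectively (n , n).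
    Removed₂ : Subset size → V → Set
    Removed₂ F w = ∃ λ σ → OnEdge σ F × HasSideBad σ F × col w ≡ edge n σ × row w ≡ edge n σ

    private
      removed₂? : ∀ F → Dec (∃ (Removed₂ F))
      removed₂? F with side? hi | side? lo
        where
        side? : ∀ σ → Dec (OnEdge σ F × HasSideBad σ F)
        side? σ = (all? λ u → (u ∈? F) →-dec (row u ≟ edge n σ)) ×-dec
          (subset-any? F _ λ x → subset-any? F _ λ y → sideBad? n σ (col x) (row x) (col y) (row y))
      ... | yes (e , b) | _ = let w , p , q = code-surjective n n ≤-refl ≤-refl in yes (w , hi , e , b , p , q)
      ... | no _ | yes (e , b) = let w , p , q = code-surjective 0 0 z≤n z≤n in yes (w , lo , e , b , p , q)
      ... | no a | no b = no λ { (_ , hi , e , c , _) → a (e , c) ; (_ , lo , e , c , _) → b (e , c) }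

      functional₂ : ∀ {F w w′} → Removed₂ F w → Removed₂ F w′ → w ≡ w′
      functional₂ {w = w} {w′} (σ , e , (x , x∈ , _) , p , q) (σ′ , e′ , _ , p′ , q′) =
        code-injective w w′ (trans p (trans same (sym p′))) (trans q (trans same (sym q′)))
        where
        same : edge n σ ≡ edge n σ′
        same = trans (sym (e x x∈)) (e′ x x∈)

      upward₂ : ∀ {F G w} → Removed₂ F w → F ⊆ G → K₁ G → Removed₂ G w
      upward₂ {F} {G} (σ , e , (x , x∈ , y , y∈ , b) , p , q) F⊆G (k , nr) with Equivalence.to (in-facet G) k
      ... | φ , o , i = σ , onEdge , (x , F⊆G x∈ , y , F⊆G y∈ , b) , p , q
        where
        onEdge : OnEdge σ G
        onEdge u u∈ with side-bad-neighbour n n≥1 σ φ (col x) (row x) (col y) (row y) (col u) (row u) o (col≤n x) (col≤n y) (col≤n u) b (i x (F⊆G x∈)) (i y (F⊆G y∈)) (i u u∈)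
        ... | inj₁ h = h
        ... | inj₂ (inj₁ h) = ⊥-elim (no-bad {G} {φ} nr o i (u , u∈ , x , F⊆G x∈ , h))
        ... | inj₂ (inj₂ h) = ⊥-elim (no-bad {G} {φ} nr o i (u , u∈ , y , F⊆G y∈ , h))

      on-edge-K₁ : ∀ σ {F} → OnEdge σ F → K₁ F
      on-edge-K₁ σ {F} e = Equivalence.from (in-facet F) (cap σ , cap-ok σ , λ u u∈ → in-cap σ u (e u u∈)) ,
        λ (w , φ , o , i , (x , x∈ , y , y∈ , b) , _) → bad-not-in-edge n n≥1 σ φ (col x) (row x) (col y) (row y) o b (e x x∈) (e y y∈)

      without₂ : ∀ {F w} → Removed₂ F w → Removed₂ (F - w) w
      without₂ {F} {w} (σ , e , (x , x∈ , y , y∈ , b) , p , q) =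
        σ , (λ u u∈ → e u (remove-⊆ {w = w} F u∈)) ,
        (x , remove-keeps F x∈ (λ { refl → proj₁ na p }) , y , remove-keeps F y∈ (λ { refl → proj₂ na p }) , b) , p , q
        where
        na = side-bad-not-apex n n≥1 σ (col x) (row x) (col y) (row y) (col≤n x) b

      with-apex₂ : ∀ {F w} → Removed₂ F w → K₁ (F ∪ ⁅ w ⁆)
      with-apex₂ {F} {w} (σ , e , _ , _ , q) = on-edge-K₁ σ onEdge
        where
        onEdge : OnEdge σ (F ∪ ⁅ w ⁆)
        onEdge u u∈ with in-union F u∈
        ... | inj₁ h = e u h
        ... | inj₂ refl = q

    K₂ : Complex size
    K₂ F = K₁ F × ¬ ∃ (Removed₂ F)

    collapse₂ : Collapses K₁ K₂
    collapse₂ = toggle-collapse K₁ Removed₂ removed₂? functional₂ upward₂ (λ (σ , e , _) → on-edge-K₁ σ e) without₂ with-apex₂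

    L : Complex size
    L F = ∃ λ T → Tri n n≥1 T × (∀ u → u ∈ F → label n n≥1 (col u) (row u) ∈₃ T)

    private
      L⇒K₂ : ∀ F → L F → K₂ F
      L⇒K₂ F (T , τ , F⊆T) = (Equivalence.from (in-facet F) (φ , ok , ins) , not-removed₁) , not-removed₂
        where
        open Clean (clean-tri n n≥1 τ)
        ins : Inside φ F
        ins u u∈ = inside (col u) (row u) (col≤n u) (F⊆T u u∈)
        not-removed₁ : ¬ ∃ (Removed₁ F)
        not-removed₁ (w , φ′ , o′ , i′ , b@(x , x∈ , y , y∈ , bad) , _) with bad-unique {F} {φ′} {φ} o′ ok b ins
        ... | refl = good (col x) (row x) (col y) (row y) (col≤n x) (col≤n y) (F⊆T x x∈) (F⊆T y y∈) bad
        not-removed₂ : ¬ ∃ (Removed₂ F)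
        not-removed₂ (w , σ , _ , (x , x∈ , y , y∈ , bad) , _) = side-good σ (col x) (row x) (col y) (row y) (col≤n x) (col≤n y) (F⊆T x x∈) (F⊆T y y∈) bad

      module _ (F : Subset size) (nr : ¬ ∃ (Removed₁ F)) (nr₂ : ¬ ∃ (Removed₂ F)) where

        A : ℕ → ℕ → Set
        A s r = ∃ λ u → u ∈ F × col u ≡ s × row u ≡ r

        A≤n : ∀ {s r} → A s r → s ≤ n
        A≤n (u , _ , refl , _) = col≤n u

        from-covered : Covered n n≥1 A → L F
        from-covered (T , τ , h) = T , τ , λ u u∈ → h (col u) (row u) (u , u∈ , refl , refl)

        elements : ∀ {R : ℕ → ℕ → Set} → (∀ u → u ∈ F → R (col u) (row u)) → ∀ s r → A s r → R s r
        elements h s r (u , u∈ , refl , refl) = h u u∈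

        has? : ∀ (R : V → Set) → (∀ u → Dec (R u)) → Dec (∃ λ u → u ∈ F × R u)
        has? = subset-any? F

        good : ∀ {φ} → Ok n φ → Inside φ F → ∀ x y → x ∈ F → y ∈ F → ¬ BadV φ x y
        good {φ} o i x y x∈ y∈ b = no-bad {F} {φ} nr o i (x , x∈ , y , y∈ , b)

        side-good : ∀ σ → OnEdge σ F → ∀ x y → x ∈ F → y ∈ F → ¬ SideBadV σ x y
        side-good σ e x y x∈ y∈ b = let w , p , q = code-surjective (edge n σ) (edge n σ) (edge≤n σ) (edge≤n σ) in nr₂ (w , σ , e , (x , x∈ , y , y∈ , b) , p , q)
          where
          edge≤n : ∀ σ → edge n σ ≤ n
          edge≤n hi = ≤-refl
          edge≤n lo = z≤n

        -- Without a non-edge of the fan, at most two columns below `n` occur, and two are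
        -- consecutive; `k` is the larger, with default 0. In `covered-lo` it is the smaller of the
        -- columns above 0, with default 1.
        covered-hi : OnEdge hi F → L F
        covered-hi e with has? (λ u → col u < n) (λ u → col u <? n)
        ... | no none = from-covered (cover-hi n n≥1 A A≤n 0 n≥1 (elements λ u u∈ → e u u∈ , inj₁ (≤-antisym (col≤n u) (≮⇒≥ λ p → none (u , u∈ , p)))))
        ... | yes (x , x∈ , x<n) with has? (λ u → col u ≡ suc (col x) × col u < n) (λ u → (col u ≟ suc (col x)) ×-dec (col u <? n))
        ...   | yes (y , y∈ , y≡ , y<n) = from-covered (cover-hi n n≥1 A A≤n (suc (col x)) (subst (_< n) y≡ y<n) (elements λ u u∈ → e u u∈ ,
                lia 6 (λ n s x y r k → s :≤ n :⇒ y :≡ con 1 :+ x :⇒ y :< n :⇒ r :≡ n :⇒ k :≡ n :⇒ :¬ hiBad n s r y k :⇒ :¬ hiBad n x k s r :⇒ s :≡ n :∨ con 1 :+ s :≡ con 1 :+ x :∨ s :≡ con 1 :+ x) refl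
                  n (col u) (col x) (col y) (row u) n (col≤n u) y≡ y<n (e u u∈) refl
                  (subst (λ k → ¬ SideBad n hi (col u) (row u) (col y) k) (e y y∈) (side-good hi e u y u∈ y∈))
                  (subst (λ k → ¬ SideBad n hi (col x) k (col u) (row u)) (e x x∈) (side-good hi e x u x∈ u∈))))
        ...   | no none = from-covered (cover-hi n n≥1 A A≤n (col x) x<n (elements λ u u∈ → e u u∈ ,
                lia 5 (λ n s x r k → s :≤ n :⇒ x :< n :⇒ r :≡ n :⇒ k :≡ n :⇒ :¬ (s :≡ con 1 :+ x :∧ s :< n) :⇒ :¬ hiBad n s r x k :⇒ :¬ hiBad n x k s r :⇒ s :≡ n :∨ con 1 :+ s :≡ x :∨ s :≡ x) refl
                  n (col u) (col x) (row u) n (col≤n u) x<n (e u u∈) refl (λ h → none (u , u∈ , h))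
                  (subst (λ k → ¬ SideBad n hi (col u) (row u) (col x) k) (e x x∈) (side-good hi e u x u∈ x∈))
                  (subst (λ k → ¬ SideBad n hi (col x) k (col u) (row u)) (e x x∈) (side-good hi e x u x∈ u∈))))

        covered-lo : OnEdge lo F → L F
        covered-lo e with has? (λ u → 1 ≤ col u) (λ u → 1 ≤? col u)
        ... | no none = from-covered (cover-lo n n≥1 A A≤n 1 ≤-refl n≥1 (elements λ u u∈ → e u u∈ , inj₁ (n<1⇒n≡0 (≰⇒> λ p → none (u , u∈ , p)))))
        ... | yes (x , x∈ , 1≤x) with has? (λ u → suc (col u) ≡ col x × 1 ≤ col u) (λ u → (suc (col u) ≟ col x) ×-dec (1 ≤? col u))
        ...   | yes (y , y∈ , y≡ , 1≤y) = from-covered (cover-lo n n≥1 A A≤n (col y) 1≤y (col≤n y) (elements λ u u∈ → e u u∈ ,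
                lia 6 (λ n s x y r k → con 1 :+ y :≡ x :⇒ con 1 :≤ y :⇒ r :≡ con 0 :⇒ k :≡ con 0 :⇒ :¬ loBad n y k s r :⇒ :¬ loBad n s r x k :⇒ s :≡ con 0 :∨ s :≡ y :∨ s :≡ con 1 :+ y) refl
                  n (col u) (col x) (col y) (row u) 0 y≡ 1≤y (e u u∈) refl
                  (subst (λ k → ¬ SideBad n lo (col y) k (col u) (row u)) (e y y∈) (side-good lo e y u y∈ u∈))
                  (subst (λ k → ¬ SideBad n lo (col u) (row u) (col x) k) (e x x∈) (side-good lo e u x u∈ x∈))))
        ...   | no none = from-covered (cover-lo n n≥1 A A≤n (col x) 1≤x (col≤n x) (elements λ u u∈ → e u u∈ ,
                lia 5 (λ n s x r k → con 1 :≤ x :⇒ r :≡ con 0 :⇒ k :≡ con 0 :⇒ :¬ (con 1 :+ s :≡ x :∧ con 1 :≤ s) :⇒ :¬ loBad n x k s r :⇒ :¬ loBad n s r x k :⇒ s :≡ con 0 :∨ s :≡ x :∨ s :≡ con 1 :+ x) refl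
                  n (col u) (col x) (row u) 0 1≤x (e u u∈) refl (λ h → none (u , u∈ , h))
                  (subst (λ k → ¬ SideBad n lo (col x) k (col u) (row u)) (e x x∈) (side-good lo e x u x∈ u∈))
                  (subst (λ k → ¬ SideBad n lo (col u) (row u) (col x) k) (e x x∈) (side-good lo e u x u∈ x∈))))

        -- In a rhombus the face contains at most one end of the removed diagonal. In `top` and
        -- `bot`, the vertex outside the row leaves only two partners in it; without that vertex the
        -- face is in the row, where the fan applies.
        covered : ∀ φ → Ok n φ → Inside φ F → L F
        covered (rhomb (suc S) (suc C)) o@(_ , C<n , S<n) i with has? (λ u → col u ≡ suc S × row u ≡ suc (suc C)) (λ u → (col u ≟ suc S) ×-dec (row u ≟ suc (suc C)))
        ... | yes (t , t∈ , p , q) = from-covered (cover-rhomb-top n n≥1 A A≤n S (suc C) S<n C<n (elements λ u u∈ → i u u∈ ,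
                λ (a , b) → good {rhomb (suc S) (suc C)} o i u t u∈ t∈ (inj₁ (cong suc a , b , p , q))))
        ... | no none = from-covered (cover-rhomb-bottom n n≥1 A A≤n S C S<n C<n (elements λ u u∈ → i u u∈ , λ h → none (u , u∈ , h)))
        covered (rhomb zero (suc C)) o@(_ , C<n , _) i with has? (λ u → col u ≡ n × row u ≡ suc C) (λ u → (col u ≟ n) ×-dec (row u ≟ suc C))
        ... | yes (t , t∈ , p , q) = from-covered (cover-wrap-last n n≥1 A A≤n C C<n (elements λ u u∈ → i u u∈ ,
                λ (a , b) → good {rhomb zero (suc C)} o i u t u∈ t∈ (inj₂ (refl , a , b , p , q))))
        ... | no none = from-covered (cover-wrap-first n n≥1 A A≤n C C<n (elements λ u u∈ → i u u∈ , λ h → none (u , u∈ , h)))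
        covered (top u₀) o i with has? (λ u → suc (row u) ≡ n) (λ u → suc (row u) ≟ n)
        ... | no none = covered-hi λ u u∈ → on-row u u∈ (i u u∈)
          where
          on-row : ∀ u → u ∈ F → InV (top u₀) u → row u ≡ n
          on-row u u∈ (inj₁ e) = e
          on-row u u∈ (inj₂ (_ , e)) = ⊥-elim (none (u , u∈ , e))
        ... | yes (x , x∈ , e) = from-covered (cover-top n n≥1 A A≤n u₀ o (elements λ u u∈ →
                lia 6 (λ n v s r x k → con 1 :+ k :≡ n :⇒ topIn n v x k :⇒ topIn n v s r :⇒ :¬ topBad n v x k s r :⇒
                  (r :≡ n :∧ (s :≡ v :∨ predForm n v s)) :∨ (s :≡ v :∧ con 1 :+ r :≡ n)) refl
                  n u₀ (col u) (row u) (col x) (row x) e (i x x∈) (i u u∈) (good {top u₀} o i x u x∈ u∈)))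
        covered (bot u₀) o i with has? (λ u → row u ≡ 1) (λ u → row u ≟ 1)
        ... | no none = covered-lo λ u u∈ → on-row u u∈ (i u u∈)
          where
          on-row : ∀ u → u ∈ F → InV (bot u₀) u → row u ≡ 0
          on-row u u∈ (inj₁ e) = e
          on-row u u∈ (inj₂ (_ , e)) = ⊥-elim (none (u , u∈ , e))
        ... | yes (x , x∈ , e) = from-covered (cover-bot n n≥1 A A≤n u₀ o (elements λ u u∈ →
                lia 6 (λ n v s r x k → k :≡ con 1 :⇒ botIn n v x k :⇒ botIn n v s r :⇒ :¬ botBad n v x k s r :⇒
                  (r :≡ con 0 :∧ (s :≡ v :∨ predForm n s v)) :∨ (s :≡ v :∧ r :≡ con 1)) refl
                  n u₀ (col u) (row u) (col x) (row x) e (i x x∈) (i u u∈) (good {bot u₀} o i x u x∈ u∈)))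

      K₂⇒L : ∀ F → K₂ F → L F
      K₂⇒L F ((k , nr) , nr₂) with Equivalence.to (in-facet F) k
      ... | φ , o , i = covered F nr nr₂ φ o i

    collapse : Collapses K L
    collapse = collapses-trans collapse₁ (collapses-trans collapse₂ (done λ F → mk⇔ (K₂⇒L F) (L⇒K₂ F)))

-- Labelling the vertices and assembling the theorem.

module Assembly where

  open import Data.Nat using (ℕ; suc; _+_; _*_; _∸_; _≤_; _<_; _≥_; z≤n; s≤s; _≟_; _<?_; >-nonZero)
  open import Data.Nat.Properties
  open import Data.Fin using (Fin; toℕ; fromℕ<)
  open import Data.Fin.Properties using (toℕ-injective; toℕ-fromℕ<; toℕ<n)
  open import Function.Bundles using (_⇔_; mk⇔)
  open Lia using (con; _:+_; _:≤_; _:<_; :⊥; _:⇒_; lia)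
  open Polytopes using (_∈₃_; _∈₃?_; Polytope)
  open Helix using (Helix; HelixV; lower; bottom; closing) renaming (∈₃-form to memberForm)
  open HelixPolytope using (helix-polytope)
  open Realizations using (module Realization)
  open Code using (CodeAdj)
  open StableSets using (module Coding)
  open TriangleCodes using (label; label-injective; column-row; row-<)
  open CollapseOntoTriangles using (module Coded)

  module Assemble (n : ℕ) (n≥1 : 1 ≤ n) (size : ℕ) (Adj : Fin size → Fin size → Set) (col row : Fin size → ℕ)
    (col≤n : ∀ v → col v ≤ n) (row≤n : ∀ v → row v ≤ n)
    (code-injective : ∀ u v → col u ≡ col v → row u ≡ row v → u ≡ v)
    (code-surjective : ∀ s r → s ≤ n → r ≤ n → ∃ λ v → col v ≡ s × row v ≡ r)
    (adj⇔ : ∀ u v → Adj u v ⇔ CodeAdj n (col v) (row v) (col u) (row u))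
    (N<M : suc n < n * suc n + n)
    (polytope : Polytope (HelixV (n * suc n + n) (n * suc n + n)) (Helix (suc n) (n * suc n + n) (n * suc n + n))) where

    open Coded n n≥1 size Adj col row col≤n row≤n code-injective code-surjective adj⇔ public using (L; collapse)

    private
      N M m : ℕ
      N = suc n
      M = n * N + n
      m = suc M

      covered : ∀ v → v < m → ∃ λ F → Helix N M M F × v ∈₃ F
      covered v v<m with v ≟ 0 | v <? N | v <? M
      ... | yes refl | _ | _ = _ , bottom 1 ≤-refl (s≤s n≥1) , inj₁ refl
      ... | no ne | yes lt | _ = _ , bottom v (n≢0⇒n>0 ne) lt , inj₂ (inj₁ refl)
      ... | no _ | no ge | no ge′ = _ , closing (M ∸ suc N) (trans (sym (+-suc (M ∸ suc N) N)) (m∸n+n≡m N<M)) , inj₂ (inj₂ (≤-antisym (≤-pred v<m) (≮⇒≥ ge′)))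
      ... | no _ | no ge | yes lt with v ≟ N
      ...   | yes refl = _ , bottom n n≥1 ≤-refl , inj₂ (inj₂ refl)
      ...   | no ne = _ , lower (v ∸ suc N) (subst (_< M) (sym eq) lt) , inj₂ (inj₂ (sym eq))
        where
        eq : suc (v ∸ suc N + N) ≡ v
        eq = trans (sym (+-suc (v ∸ suc N) N)) (m∸n+n≡m (≤∧≢⇒< (≮⇒≥ ge) (λ e → ne (sym e))))

      outside : ∀ F → ∃ λ v → v < m × ¬ v ∈₃ F
      -- Since N < M, the labels 0, ..., 3 all exist, and a triple misses one of them.
      outside F@(a , b , c) with 0 ∈₃? F | 1 ∈₃? F | 2 ∈₃? F | 3 ∈₃? F
      ... | no p | _ | _ | _ = 0 , s≤s z≤n , p
      ... | _ | no p | _ | _ = 1 , s≤s (≤-trans (s≤s z≤n) (<⇒≤ N<M)) , p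
      ... | _ | _ | no p | _ = 2 , s≤s (≤-trans (s≤s n≥1) (<⇒≤ N<M)) , p
      ... | _ | _ | _ | no p = 3 , s≤s (≤-trans (s≤s (s≤s n≥1)) N<M) , p
      ... | yes p | yes q | yes r | yes s = ⊥-elim (lia 3 (λ a b c →
              memberForm (con 0) a b c :⇒ memberForm (con 1) a b c :⇒ memberForm (con 2) a b c :⇒ memberForm (con 3) a b c :⇒ :⊥) refl a b c p q r s)

      V⇒< : ∀ {v} → HelixV M M v → v < m
      V⇒< (inj₁ lt) = m<n⇒m<1+n lt
      V⇒< (inj₂ refl) = ≤-refl

      <⇒V : ∀ {v} → v < m → HelixV M M v
      <⇒V {v} lt with v ≟ M
      ... | yes e = inj₂ e
      ... | no ne = inj₁ (≤∧≢⇒< (≤-pred lt) ne)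

    open Realization polytope m V⇒< <⇒V covered (_ , bottom 1 ≤-refl (s≤s n≥1)) outside

    private
      lab : Fin (size) → ℕ
      lab v = label n n≥1 (col v) (row v)

      lab<m : ∀ v → lab v < m
      lab<m v = s≤s (+-mono-≤ (*-monoˡ-≤ N (row≤n v)) (col≤n v))

      vertex : ∀ a → a < m → ∃ λ v → lab v ≡ a
      vertex a a<m with column-row n n≥1 a
      ... | S , C , S≤n , refl with code-surjective S C S≤n C≤n
        where
        C≤n : C ≤ n
        C≤n = ≮⇒≥ λ lt → lia 4 (λ n S CN nN → nN :+ (con 1 :+ n) :≤ CN :⇒ CN :+ S :< con 1 :+ (nN :+ n) :⇒ :⊥) refl n S (C * N) (n * N) (row-< n n≥1 lt) a<m
      ...   | v , refl , refl = v , refl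

      embed : Fin m → Fin (size)
      embed j = proj₁ (vertex (toℕ j) (toℕ<n j))

      lab-embed : ∀ j → lab (embed j) ≡ toℕ j
      lab-embed j = proj₂ (vertex (toℕ j) (toℕ<n j))

      embed-injective : ∀ j k → embed j ≡ embed k → j ≡ k
      embed-injective j k e = toℕ-injective (trans (sym (lab-embed j)) (trans (cong lab e) (lab-embed k)))

      embed-onto : ∀ v → ∃ λ j → embed j ≡ v
      embed-onto v = j , code-injective (embed j) v (proj₁ same) (proj₂ same)
        where
        j = fromℕ< (lab<m v)
        same : col (embed j) ≡ col v × row (embed j) ≡ row v
        same = label-injective n n≥1 _ _ _ _ (col≤n (embed j)) (col≤n v) (trans (lab-embed j) (toℕ-fromℕ< (lab<m v)))

    boundary : IsoToBoundaryOf3Polytope L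
    boundary = m , p , embed , simplicial , embed-injective , (λ _ _ i _ → embed-onto i) , λ S T S⊆ T⊆ → mk⇔
      (λ { (F , τ , h) → within-Φ⇒face T τ λ j j∈ → subst (_∈₃ F) (lab-embed j) (h (embed j) (T⊆ j j∈)) })
      (λ face → let F , τ , h = face⇒within-Φ T face in F , τ , λ u u∈ →
        let j , j∈ , e = S⊆ u u∈ in subst (_∈₃ F) (trans (sym (lab-embed j)) (cong lab e)) (h j j∈))

open import Data.Nat using (suc; _+_; _*_; _<_; s≤s; >-nonZero)
open import Data.Nat.Properties using (m≤n*m; ≤-refl)
open Lia using (con; _:+_; _:≤_; _:<_; _:⇒_; lia)
open StableSets using (module Coding)
open HelixPolytope using (helix-polytope)
open Assembly using (module Assemble)

theorem1p2 : ∀ (n : ℕ) → n ≥ 1 →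
    Σ (Complex (SGsize n)) λ L → Collapses (NSG n) L × IsoToBoundaryOf3Polytope L
theorem1p2 n n≥1 = L , collapse , boundary
  where
  open Coding n n≥1
  N<M : suc n < n * suc n + n
  N<M = lia 2 (λ n nN → con 1 :≤ n :⇒ con 1 :+ n :≤ nN :⇒ con 1 :+ n :< nN :+ n) refl n (n * suc n) n≥1 (m≤n*m (suc n) n {{>-nonZero n≥1}})
  open Assemble n n≥1 (SGsize n) (SGAdj n) col row col≤n row≤n code-injective code-surjective adj⇔ N<M
    (helix-polytope (suc n) (n * suc n + n) (s≤s n≥1) (n * suc n + n) N<M ≤-refl)
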